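{- Let $D$ be the random $n$-vertex directed graph in which between every pair of vertices there is exactly one arc, oriented in either direction with probability $1/2$, independently. Then asymptotically almost surely (as $n\to\infty$), $\nu_t(D)=n^2/6+o(n^2)$ and $\tau_t(D)=n^2/4-o(n^2)$.
   Context: A directed triangle is a triple of arcs $uv,vw,wu$. $\nu_t(D)$ is the maximum number of pairwise arc-disjoint directed triangles in $D$; $\tau_t(D)$ is the minimum number of arcs whose removal leaves no directed triangle. -}

module Defs where

open import Data.Nat using (ℕ; zero; suc; _+_; _*_; _≤_)
open import Data.Bool using (Bool; true; false; not; T)
open import Data.Fin using (Fin; zero; suc)
open import Data.Vec using (Vec; []; _∷_; lookup)
open import Data.List using (List; []; _∷_; length; concatMap; map)
open import Data.List.Membership.Propositional using (_∈_; _∉_)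
open import Data.List.Relation.Unary.All using (All)
open import Data.List.Relation.Unary.AllPairs using (AllPairs)
open import Data.List.Relation.Binary.Sublist.Propositional using (_⊆_)
open import Data.Product using (_×_; _,_; ∃; Σ-syntax)
open import Data.Sum using (_⊎_)
open import Data.Unit using (⊤; tt)

-- A tournament on vertex set Fin n, built vertex by vertex: a tournament on
-- suc n is a tournament on the old vertices (suc i) together with, for each
-- old vertex j, the orientation of the pair {new vertex zero, suc j}
-- (true = arc from zero to suc j).  Each such object is exactly one
-- orientation of every pair, so the uniform distribution on Tour n is the
-- random tournament (each pair oriented independently with prob. 1/2).
Tour : ℕ → Set
Tour zero    = ⊤
Tour (suc n) = Tour n × Vec Bool n

arc : ∀ {n} → Tour n → Fin n → Fin n → Bool
arc {suc n} (D , v) zero    zero    = false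
arc {suc n} (D , v) zero    (suc j) = lookup v j
arc {suc n} (D , v) (suc i) zero    = not (lookup v i)
arc {suc n} (D , v) (suc i) (suc j) = arc D i j

Arc : ∀ {n} → Tour n → Fin n → Fin n → Set
Arc D u v = T (arc D u v)

allVec : (k : ℕ) → List (Vec Bool k)
allVec zero    = [] ∷ []
allVec (suc k) = concatMap (λ w → (true ∷ w) ∷ (false ∷ w) ∷ []) (allVec k)

allTour : (n : ℕ) → List (Tour n)
allTour zero    = tt ∷ []
allTour (suc n) = concatMap (λ D → map (λ v → (D , v)) (allVec n)) (allTour n)

ArcPair : ℕ → Set
ArcPair n = Fin n × Fin n

Triple : ℕ → Set
Triple n = Fin n × Fin n × Fin n

arcsOf : ∀ {n} → Triple n → List (ArcPair n)
arcsOf (u , v , w) = (u , v) ∷ (v , w) ∷ (w , u) ∷ []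

IsTriangle : ∀ {n} → Tour n → Triple n → Set
IsTriangle D (u , v , w) = Arc D u v × Arc D v w × Arc D w u

ArcDisjoint : ∀ {n} → Triple n → Triple n → Set
ArcDisjoint t s = ∀ {a} → a ∈ arcsOf t → a ∉ arcsOf s

IsPacking : ∀ {n} → Tour n → List (Triple n) → Set
IsPacking D P = All (IsTriangle D) P × AllPairs ArcDisjoint P

IsTransversal : ∀ {n} → Tour n → List (ArcPair n) → Set
IsTransversal D X =
  All (λ a → Arc D (Data.Product.proj₁ a) (Data.Product.proj₂ a)) X ×
  (∀ t → IsTriangle D t → Σ[ a ∈ ArcPair _ ] (a ∈ arcsOf t × a ∈ X))

-- With ε = 1/(k+1):
-- |ν_t D - n²/6| ≤ ε n², i.e. for all P: 6(k+1)|P| ≤ (k+1)n² + 6n²,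
-- and some packing P has (k+1)n² ≤ 6(k+1)|P| + 6n².
νClose : ∀ {n} → ℕ → Tour n → Set
νClose {n} k D =
  (Σ[ P ∈ List (Triple n) ] (IsPacking D P ×
      (suc k) * (n * n) ≤ 6 * (suc k) * length P + 6 * (n * n))) ×
  (∀ P → IsPacking D P → 6 * (suc k) * length P ≤ (suc k) * (n * n) + 6 * (n * n))

-- |τ_t D - n²/4| ≤ ε n²
τClose : ∀ {n} → ℕ → Tour n → Set
τClose {n} k D =
  (Σ[ X ∈ List (ArcPair n) ] (IsTransversal D X ×
      4 * (suc k) * length X ≤ (suc k) * (n * n) + 4 * (n * n))) ×
  (∀ X → IsTransversal D X → (suc k) * (n * n) ≤ 4 * (suc k) * length X + 4 * (n * n))

-- Pr[ E ] ≥ 1 - 1/(m+1) for the uniform random tournament on n vertices: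
-- there is a sub-collection `good` of the sample space (a sublist of the
-- duplicate-free list allTour n), all of whose members satisfy E, with
-- (m+1)·|good| ≥ m·|allTour n|.
ProbAtLeast : (n m : ℕ) → (Tour n → Set) → Set
ProbAtLeast n m E =
  Σ[ good ∈ List (Tour n) ] (good ⊆ allTour n × All E good ×
     m * length (allTour n) ≤ suc m * length good)

{-# OPTIONS --safe #-}
module Submission where

-- Packing.  Split the vertices into fibres {a} × (ℤ/2)^r, a ∈ ℤ/q.  The triples of distinct residues
-- with a + b + c ≡ 0 partition almost all pairs into tripartite blocks of bounded size.  In a block,
-- triangles are chosen in r rounds; round i uses the triples with x + y + z = e_i, and takes those
-- that are directed triangles of unused arcs.  The three arcs of such a triple depend on disjoint
-- sets of pairs, so the probability q_i that an arc is present and unused satisfies exactly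
-- q_{i+1} = q_i − q_i³; hence q_r → 0 and Markov's inequality bounds the number of unused arcs.
--
-- Transversals.  The expected number of signed quadrilaterals is O(n³), so with high probability
-- all U, W satisfy 2 e(U,W) ≤ ∣U∣∣W∣ + δn² (Cauchy–Schwarz).  Let F be a subdigraph without
-- directed triangles.  If F has more than (1/4 + ε)v² arcs on some v vertices, a density increment
-- finds linear sets U, W of equal size without large holes in either direction.  For a vertex z, an
-- out-neighbourhood in W and an in-neighbourhood in U cannot both be large (nor with U and W
-- exchanged), so U ∪ W has average degree at most about v/2; removing a vertex of small degree and
-- inducting gives e(F) ≤ n²/4 + o(n²).

open import Defs
open import Algebra.Bundles using (CommutativeMonoid; CommutativeSemiring)
import Algebra.Properties.CommutativeSemigroup
open import Data.Bool using (Bool; true; false; not; if_then_else_; _∧_; T; _xor_)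
import Data.Bool.Properties as Boolₚ
open import Data.Empty using (⊥; ⊥-elim)
open import Data.Fin using (Fin; zero; suc)
import Data.Fin as Fin
import Data.Fin.Properties as Finₚ
open import Data.Fin.Subset.Properties using (anySubset?)
import Data.Integer as ℤ
open import Data.Integer using (ℤ; -[1+_]; ∣_∣) renaming (+_ to pos)
import Data.Integer.Properties as ℤₚ
import Data.Integer.Tactic.RingSolver as ℤ-Solver
open import Data.List using (List; []; _∷_; _++_; length; map; concatMap; filter; cartesianProduct)
import Data.List.Properties as Listₚ
import Data.List.Membership.DecPropositional
open import Data.List.Membership.Propositional using (_∈_; _∉_; find)
import Data.List.Membership.Propositional.Properties as ∈ₚ
open import Data.List.Relation.Binary.Sublist.Propositional.Properties using (filter-⊆)
open import Data.List.Relation.Unary.All as All using (All; []; _∷_)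
import Data.List.Relation.Unary.All.Properties as Allₚ
open import Data.List.Relation.Unary.AllPairs using (AllPairs; []; _∷_)
import Data.List.Relation.Unary.AllPairs.Properties as AllPairsₚ
open import Data.List.Relation.Unary.Any using (here; there)
open import Data.List.Relation.Unary.Unique.Propositional using (Unique)
import Data.List.Relation.Unary.Unique.Propositional.Properties as Uniqueₚ
open import Data.Nat using (ℕ; zero; suc; _+_; _*_; _∸_; _^_; _≤_; _<_; z≤n; s≤s)
import Data.Nat as ℕ
open import Data.Nat.Divisibility using (_∣_; ∣-refl; ∣m+n∣m⇒∣n; ∣m∣n⇒∣m+n; n∣m*n; >⇒∤)
open import Data.Nat.DivMod using (_/_; _%_; m%n<n; m≡m%n+[m/n]*n; m/n*n≤m; m≥n⇒m/n>0)
open import Data.Nat.Properties as ℕₚ using (≤-refl; ≤-trans; ≤-reflexive; +-mono-≤; *-mono-≤)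
open import Data.Nat.Tactic.RingSolver using (solve-∀)
open import Data.Product using (_×_; _,_; proj₁; proj₂; ∃; Σ-syntax)
import Data.Product.Properties
open import Data.Sum using (_⊎_; inj₁; inj₂)
import Data.Sum
open import Data.Unit using (tt)
open import Data.Vec using (Vec; []; _∷_; lookup; tabulate)
import Data.Vec.Properties as Vecₚ
open import Function using (_∘_)
open import Level using (0ℓ)
open import Relation.Binary.Definitions using (Tri; tri<; tri≈; tri>)
open import Relation.Binary.PropositionalEquality
open import Relation.Nullary using (¬_; Dec; yes; no; contradiction)
open import Relation.Nullary.Decidable using (⌊_⌋; map′; ¬?; _×-dec_; _⊎-dec_; _→-dec_)

-- Finite sums, and flipping one pair of a tournament

-- The packing is arranged so that first moments suffice. For transversals the factor 1/2 has two
-- origins. If one direction between two sets is empty, only the other is left, and quasirandomness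
-- holds it to about half of the pairs; hence a hole has low density. Seen from U ∪ W, vertices z
-- that mostly receive from both sets, or mostly send to both, are halved on average by
-- quasirandomness; any other z nearly misses one of the sets, and as the sizes are equal this is
-- again half. With r = 3/ε and M = r³, densities are measured in units of 1/(2M). A hole raises the
-- density by one unit and shrinks the sets by a factor r, so the smallest sets have size about n /
-- r^(M+2). This is still linear in n, and δ is fixed relative to it.

module Sums (R : CommutativeSemiring 0ℓ 0ℓ) where
  open CommutativeSemiring R using (Carrier; _≈_; 0#; 1#; setoid; +-cong; +-assoc; +-identityˡ; +-identityʳ; *-congˡ;
    *-comm; distribˡ; zeroʳ; +-commutativeMonoid; +-congˡ; +-congʳ)
    renaming (_+_ to _⊕_; _*_ to _⊗_; refl to ≈-refl; sym to ≈-sym; trans to ≈-trans)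
  open Algebra.Properties.CommutativeSemigroup
    (CommutativeMonoid.commutativeSemigroup +-commutativeMonoid) using (interchange)

  sum : {A : Set} → List A → (A → Carrier) → Carrier
  sum []       f = 0#
  sum (x ∷ xs) f = f x ⊕ sum xs f

  module _ {A : Set} where

    sum-cong : ∀ (xs : List A) {f g : A → Carrier} → (∀ x → f x ≈ g x) → sum xs f ≈ sum xs g
    sum-cong []       e = ≈-refl
    sum-cong (x ∷ xs) e = +-cong (e x) (sum-cong xs e)

    sum-zero : ∀ (xs : List A) → sum xs (λ _ → 0#) ≈ 0#
    sum-zero []       = ≈-refl
    sum-zero (x ∷ xs) = ≈-trans (+-identityˡ _) (sum-zero xs)

    sum-+ : ∀ (xs : List A) (f g : A → Carrier) → sum xs (λ x → f x ⊕ g x) ≈ sum xs f ⊕ sum xs g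
    sum-+ []       f g = ≈-sym (+-identityˡ _)
    sum-+ (x ∷ xs) f g = ≈-trans (+-congˡ (sum-+ xs f g)) (interchange _ _ _ _)

    sum-*ˡ : ∀ (xs : List A) c (f : A → Carrier) → sum xs (λ x → c ⊗ f x) ≈ c ⊗ sum xs f
    sum-*ˡ []       c f = ≈-sym (zeroʳ c)
    sum-*ˡ (x ∷ xs) c f = ≈-trans (+-congˡ (sum-*ˡ xs c f)) (≈-sym (distribˡ c _ _))

    sum-*ʳ : ∀ (xs : List A) (f : A → Carrier) c → sum xs (λ x → f x ⊗ c) ≈ sum xs f ⊗ c
    sum-*ʳ xs f c = ≈-trans (sum-cong xs (λ x → *-comm _ _)) (≈-trans (sum-*ˡ xs c f) (*-comm _ _))

    sum-++ : ∀ (xs ys : List A) (f : A → Carrier) → sum (xs ++ ys) f ≈ sum xs f ⊕ sum ys f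
    sum-++ []       ys f = ≈-sym (+-identityˡ _)
    sum-++ (x ∷ xs) ys f = ≈-trans (+-congˡ (sum-++ xs ys f)) (≈-sym (+-assoc _ _ _))

  module _ {A B : Set} where

    sum-map : ∀ (h : A → B) (xs : List A) (f : B → Carrier) → sum (map h xs) f ≈ sum xs (f ∘ h)
    sum-map h []       f = ≈-refl
    sum-map h (x ∷ xs) f = +-congˡ (sum-map h xs f)

    sum-concatMap : ∀ (h : A → List B) (xs : List A) (f : B → Carrier) →
                    sum (concatMap h xs) f ≈ sum xs (λ x → sum (h x) f)
    sum-concatMap h []       f = ≈-refl
    sum-concatMap h (x ∷ xs) f = ≈-trans (sum-++ (h x) (concatMap h xs) f) (+-congˡ (sum-concatMap h xs f))

    sum-swap : ∀ (xs : List A) (ys : List B) (f : A → B → Carrier) →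
               sum xs (λ x → sum ys (f x)) ≈ sum ys (λ y → sum xs (λ x → f x y))
    sum-swap []       ys f = ≈-sym (sum-zero ys)
    sum-swap (x ∷ xs) ys f = ≈-trans (+-congˡ (sum-swap xs ys f)) (≈-sym (sum-+ ys (f x) _))

  sum-product : ∀ {A B : Set} (xs : List A) (ys : List B) (f : A → Carrier) (g : B → Carrier) →
                sum xs (λ x → sum ys (λ y → f x ⊗ g y)) ≈ sum xs f ⊗ sum ys g
  sum-product xs ys f g = ≈-trans (sum-cong xs (λ x → sum-*ˡ ys (f x) g)) (sum-*ʳ xs f (sum ys g))

module Nat = Sums ℕₚ.+-*-commutativeSemiring
module Int = Sums ℤₚ.+-*-commutativeSemiring

open Nat public

sum-mono : ∀ {A : Set} (xs : List A) {f g : A → ℕ} → (∀ x → f x ≤ g x) → sum xs f ≤ sum xs g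
sum-mono []       e = z≤n
sum-mono (x ∷ xs) e = +-mono-≤ (e x) (sum-mono xs e)

sum-const : ∀ {A : Set} (xs : List A) c → sum xs (λ _ → c) ≡ length xs * c
sum-const []       c = refl
sum-const (x ∷ xs) c = cong (c +_) (sum-const xs c)

length-sum : ∀ {A : Set} (xs : List A) → length xs ≡ sum xs (λ _ → 1)
length-sum xs = sym (trans (sum-const xs 1) (ℕₚ.*-identityʳ _))

sum-ℤ : ∀ {A : Set} (xs : List A) (f : A → ℕ) → pos (sum xs f) ≡ Int.sum xs (λ x → pos (f x))
sum-ℤ []       f = refl
sum-ℤ (x ∷ xs) f = cong (ℤ._+_ (pos (f x))) (sum-ℤ xs f)

-- Inequalities are proved below by adding known ones: x ≤ y yields a ≤ b as soon as
-- a + y = b + x, and that equation is left to the ring solver.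
by-adding : ∀ {a b x y} → x ≤ y → a + y ≡ b + x → a ≤ b
by-adding {a} {b} {x} {y} x≤y e = ℕₚ.+-cancelʳ-≤ y a b (≤-trans (≤-reflexive e) (ℕₚ.+-monoʳ-≤ b x≤y))

*-swap : ∀ a b c → a * (b * c) ≡ b * (a * c)
*-swap = solve-∀

⟦_⟧ : Bool → ℕ
⟦ true  ⟧ = 1
⟦ false ⟧ = 0

⟦⟧≤1 : ∀ b → ⟦ b ⟧ ≤ 1
⟦⟧≤1 true  = ≤-refl
⟦⟧≤1 false = z≤n

⟦∧⟧ : ∀ a b → ⟦ a ∧ b ⟧ ≡ ⟦ a ⟧ * ⟦ b ⟧
⟦∧⟧ true  b = sym (ℕₚ.+-identityʳ _)
⟦∧⟧ false b = refl

⟦not⟧ : ∀ b → ⟦ b ⟧ + ⟦ not b ⟧ ≡ 1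
⟦not⟧ true  = refl
⟦not⟧ false = refl

fins : ∀ n → List (Fin n)
fins zero    = []
fins (suc n) = zero ∷ map suc (fins n)

_==_ : ∀ {n} → Fin n → Fin n → Bool
u == v = ⌊ u Fin.≟ v ⌋

==-refl : ∀ {n} (u : Fin n) → (u == u) ≡ true
==-refl u with u Fin.≟ u
... | yes _ = refl
... | no  p = contradiction refl p

==-suc : ∀ {n} (u v : Fin n) → (Fin.suc u == Fin.suc v) ≡ (u == v)
==-suc u v with u Fin.≟ v
... | yes _ = refl
... | no  _ = refl

==⇒≡ : ∀ {n} {u v : Fin n} → (u == v) ≡ true → u ≡ v
==⇒≡ {u = u} {v} e with u Fin.≟ v
... | yes p = p

length-fins : ∀ n → length (fins n) ≡ n
length-fins zero    = refl
length-fins (suc n) = cong suc (trans (Listₚ.length-map suc (fins n)) (length-fins n))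

sum-fins : ∀ n (f : Fin (suc n) → ℕ) → sum (fins (suc n)) f ≡ f zero + sum (fins n) (f ∘ suc)
sum-fins n f = cong (f zero +_) (sum-map suc (fins n) f)

sum-const-fins : ∀ n c → sum (fins n) (λ _ → c) ≡ n * c
sum-const-fins n c = trans (sum-const (fins n) c) (cong (_* c) (length-fins n))

sum-point : ∀ {n} (u : Fin n) (f : Fin n → ℕ) → sum (fins n) (λ v → ⟦ u == v ⟧ * f v) ≡ f u
sum-point {suc n} zero f = trans (sum-fins n (λ v → ⟦ zero == v ⟧ * f v))
  (trans (cong₂ _+_ (ℕₚ.+-identityʳ _) (sum-zero (fins n))) (ℕₚ.+-identityʳ _))
sum-point {suc n} (suc u) f = trans (sum-fins n (λ v → ⟦ suc u == v ⟧ * f v))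
  (trans (sum-cong (fins n) (λ v → cong (λ b → ⟦ b ⟧ * f (suc v)) (==-suc u v))) (sum-point u (f ∘ suc)))

-- Flipping one pair of a tournament is a measure-preserving involution; all independence
-- statements are derived from it.
flipAt : ∀ {n} → Fin n → Vec Bool n → Vec Bool n
flipAt zero    (b ∷ v) = not b ∷ v
flipAt (suc j) (b ∷ v) = b ∷ flipAt j v

flip : ∀ {n} → Fin n → Fin n → Tour n → Tour n
flip zero    zero    D       = D
flip zero    (suc j) (D , v) = D , flipAt j v
flip (suc i) zero    (D , v) = D , flipAt i v
flip (suc i) (suc j) (D , v) = flip i j D , v

lookup-flipAt : ∀ {n} (j : Fin n) v → lookup (flipAt j v) j ≡ not (lookup v j)
lookup-flipAt zero    (b ∷ v) = refl
lookup-flipAt (suc j) (b ∷ v) = lookup-flipAt j v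

lookup-flipAt-≢ : ∀ {n} (j i : Fin n) v → i ≢ j → lookup (flipAt j v) i ≡ lookup v i
lookup-flipAt-≢ zero    zero    (b ∷ v) i≢j = contradiction refl i≢j
lookup-flipAt-≢ zero    (suc i) (b ∷ v) i≢j = refl
lookup-flipAt-≢ (suc j) zero    (b ∷ v) i≢j = refl
lookup-flipAt-≢ (suc j) (suc i) (b ∷ v) i≢j = lookup-flipAt-≢ j i v (i≢j ∘ cong suc)

arc-flip : ∀ {n} (u v : Fin n) D → u ≢ v → arc (flip u v D) u v ≡ not (arc D u v)
arc-flip zero    zero    D       u≢v = contradiction refl u≢v
arc-flip zero    (suc j) (D , v) u≢v = lookup-flipAt j v
arc-flip (suc i) zero    (D , v) u≢v = cong not (lookup-flipAt i v)
arc-flip (suc i) (suc j) (D , v) u≢v = arc-flip i j D (u≢v ∘ cong suc)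

arc-flip-≢ : ∀ {n} (u v u′ v′ : Fin n) D → ¬ (u ≡ u′ × v ≡ v′) → ¬ (u ≡ v′ × v ≡ u′) →
             arc (flip u v D) u′ v′ ≡ arc D u′ v′
arc-flip-≢ {suc n} zero    zero    u′       v′       D       p q = refl
arc-flip-≢ {suc n} zero    (suc j) zero     zero     D       p q = refl
arc-flip-≢ {suc n} zero    (suc j) zero     (suc j′) (D , v) p q =
  lookup-flipAt-≢ j j′ v (λ e → p (refl , cong suc (sym e)))
arc-flip-≢ {suc n} zero    (suc j) (suc i′) zero     (D , v) p q =
  cong not (lookup-flipAt-≢ j i′ v (λ e → q (refl , cong suc (sym e))))
arc-flip-≢ {suc n} zero    (suc j) (suc i′) (suc j′) (D , v) p q = refl
arc-flip-≢ {suc n} (suc i) zero    zero     zero     (D , v) p q = refl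
arc-flip-≢ {suc n} (suc i) zero    zero     (suc j′) (D , v) p q =
  lookup-flipAt-≢ i j′ v (λ e → q (cong suc (sym e) , refl))
arc-flip-≢ {suc n} (suc i) zero    (suc i′) zero     (D , v) p q =
  cong not (lookup-flipAt-≢ i i′ v (λ e → p (cong suc (sym e) , refl)))
arc-flip-≢ {suc n} (suc i) zero    (suc i′) (suc j′) (D , v) p q = refl
arc-flip-≢ {suc n} (suc i) (suc j) zero     zero     (D , v) p q = refl
arc-flip-≢ {suc n} (suc i) (suc j) zero     (suc j′) (D , v) p q = refl
arc-flip-≢ {suc n} (suc i) (suc j) (suc i′) zero     (D , v) p q = refl
arc-flip-≢ {suc n} (suc i) (suc j) (suc i′) (suc j′) (D , v) p q =
  arc-flip-≢ i j i′ j′ D (λ (a , b) → p (cong suc a , cong suc b)) (λ (a , b) → q (cong suc a , cong suc b))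

arc-irrefl : ∀ {n} (D : Tour n) u → arc D u u ≡ false
arc-irrefl {suc n} D       zero    = refl
arc-irrefl {suc n} (D , v) (suc i) = arc-irrefl D i

arc-anti : ∀ {n} (D : Tour n) u v → u ≢ v → arc D v u ≡ not (arc D u v)
arc-anti {suc n} D       zero    zero    p = contradiction refl p
arc-anti {suc n} D       zero    (suc j) p = refl
arc-anti {suc n} (D , v) (suc i) zero    p = sym (Boolₚ.not-involutive (lookup v i))
arc-anti {suc n} (D , v) (suc i) (suc j) p = arc-anti D i j (p ∘ cong suc)

bools : List Bool
bools = true ∷ false ∷ []

-- Serves two semirings: ℕ for the probability of an arc, ℤ for the cancellation of signed
-- quadrilaterals.
module Flips (R : CommutativeSemiring 0ℓ 0ℓ) where
  open CommutativeSemiring R using (Carrier; _≈_; +-comm; +-congʳ; +-identityʳ; +-congˡ)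
    renaming (refl to ≈-refl; sym to ≈-sym; trans to ≈-trans)
  module S = Sums R

  sum-allVec : ∀ k (f : Vec Bool (suc k) → Carrier) →
    S.sum (allVec (suc k)) f ≈ S.sum (allVec k) (λ v → S.sum bools (λ b → f (b ∷ v)))
  sum-allVec k f = S.sum-concatMap (λ w → (true ∷ w) ∷ (false ∷ w) ∷ []) (allVec k) f

  sum-allTour : ∀ n (f : Tour (suc n) → Carrier) →
    S.sum (allTour (suc n)) f ≈ S.sum (allTour n) (λ D → S.sum (allVec n) (λ v → f (D , v)))
  sum-allTour n f = ≈-trans (S.sum-concatMap (λ D → map (D ,_) (allVec n)) (allTour n) f)
    (S.sum-cong (allTour n) (λ D → S.sum-map (D ,_) (allVec n) f))

  sum-flipAt : ∀ {n} (j : Fin n) (f : Vec Bool n → Carrier) →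
    S.sum (allVec n) (f ∘ flipAt j) ≈ S.sum (allVec n) f
  sum-flipAt {suc n} zero f = ≈-trans (sum-allVec n _) (≈-trans (S.sum-cong (allVec n) (λ v →
      ≈-trans (+-congˡ (+-identityʳ _)) (≈-trans (+-comm _ _) (+-congˡ (≈-sym (+-identityʳ _))))))
    (≈-sym (sum-allVec n f)))
  sum-flipAt {suc n} (suc j) f = ≈-trans (sum-allVec n _) (≈-trans (S.sum-swap (allVec n) bools (λ v b → f (b ∷ flipAt j v)))
    (≈-trans (S.sum-cong bools (λ b → sum-flipAt j (λ v → f (b ∷ v))))
    (≈-trans (≈-sym (S.sum-swap (allVec n) bools (λ v b → f (b ∷ v)))) (≈-sym (sum-allVec n f)))))

  sum-flip : ∀ {n} (u v : Fin n) (f : Tour n → Carrier) →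
    S.sum (allTour n) (f ∘ flip u v) ≈ S.sum (allTour n) f
  sum-flip zero zero f = ≈-refl
  sum-flip {suc n} zero (suc j) f = ≈-trans (sum-allTour n _)
    (≈-trans (S.sum-cong (allTour n) (λ D → sum-flipAt j _)) (≈-sym (sum-allTour n f)))
  sum-flip {suc n} (suc i) zero f = ≈-trans (sum-allTour n _)
    (≈-trans (S.sum-cong (allTour n) (λ D → sum-flipAt i _)) (≈-sym (sum-allTour n f)))
  sum-flip {suc n} (suc i) (suc j) f = ≈-trans (sum-allTour n _)
    (≈-trans (sum-flip i j _) (≈-sym (sum-allTour n f)))

module NatFlips = Flips ℕₚ.+-*-commutativeSemiring
module IntFlips = Flips ℤₚ.+-*-commutativeSemiring

-- Packing the directed triangles of a tripartite block

_⊞_ : ∀ {r} → Vec Bool r → Vec Bool r → Vec Bool r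
[]      ⊞ []      = []
(a ∷ x) ⊞ (b ∷ y) = (a xor b) ∷ (x ⊞ y)

xor-cancel : ∀ a b → b xor (a xor b) ≡ a
xor-cancel true  true  = refl
xor-cancel true  false = refl
xor-cancel false true  = refl
xor-cancel false false = refl

⊞-cancel : ∀ {r} (x y : Vec Bool r) → y ⊞ (x ⊞ y) ≡ x
⊞-cancel []      []      = refl
⊞-cancel (a ∷ x) (b ∷ y) = cong₂ _∷_ (xor-cancel a b) (⊞-cancel x y)

not-xor-cancel : ∀ a b → not (b xor not (a xor b)) ≡ a
not-xor-cancel true  true  = refl
not-xor-cancel true  false = refl
not-xor-cancel false true  = refl
not-xor-cancel false false = refl

b≢not-b : ∀ {b} → b ≢ not b
b≢not-b {true}  ()
b≢not-b {false} ()

xor-not-≢ : ∀ a b → a ≢ b xor not (a xor b)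
xor-not-≢ true  true  ()
xor-not-≢ true  false ()
xor-not-≢ false true  ()
xor-not-≢ false false ()

not-xor-≢ : ∀ a b → b ≢ not (a xor b) xor a
not-xor-≢ true  true  ()
not-xor-≢ true  false ()
not-xor-≢ false true  ()
not-xor-≢ false false ()

-- The fate of the pair (x , y) in a block: not an arc, an arc not yet in a triangle, or an arc
-- whose triangle has third vertex z.
data State (r : ℕ) : Set where
  off live : State r
  used     : Vec Bool r → State r

isLive : ∀ {r} → State r → Bool
isLive live     = true
isLive off      = false
isLive (used _) = false

isUsed : ∀ {r} → State r → Bool
isUsed (used _) = true
isUsed live     = false
isUsed off      = false

-- One round for one arc. The booleans tell whether the other two arcs of its odd triple are live. A
-- triangle inherited from the even sub-block has its third vertex in the half with bit `k`, a new
-- triangle in the half with bit `not k`.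
advance : ∀ {r} → State r → Bool → Bool → Bool → Vec Bool r → State (suc r)
advance off      _     _     k z = off
advance (used w) _     _     k z = used (k ∷ w)
advance live     true  true  k z = used (not k ∷ z)
advance live     true  false k z = live
advance live     false _     k z = live

Part : ℕ → ℕ → Set
Part r n = Vec Bool r → Fin n

half : ∀ {r n} → Part (suc r) n → Bool → Part r n
half α i x = α (i ∷ x)

-- A block is a complete tripartite graph with parts α, β, γ of size 2^r, of which only the arcs
-- α → β → γ → α matter.  Its halves form four sub-blocks, those of even parity, which partition
-- its pairs; the triangles added at the last level have odd parity, so that their three arcs
-- come from three different sub-blocks and are independent.
state : ∀ {r n} → Tour n → (α β γ : Part r n) → Vec Bool r → Vec Bool r → State r
state {zero}  D α β γ []      []      = if arc D (α []) (β []) then live else off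
state {suc r} D α β γ (i ∷ x) (j ∷ y) =
  advance (state D (half α i) (half β j) (half γ k) x y)
          (isLive (state D (half β j) (half γ (not k)) (half α (j xor not k)) y z))
          (isLive (state D (half γ (not k)) (half α i) (half β (not k xor i)) z x))
          k z
  where
  k = i xor j
  z = x ⊞ y

-- A live arc stops being live exactly when the other two arcs of its odd triple are live as well;
-- this is the source of the term -q³.
advance-live : ∀ {r} (s : State r) a b k z →
               ⟦ isLive (advance s a b k z) ⟧ + ⟦ isLive s ⟧ * (⟦ a ⟧ * ⟦ b ⟧) ≡ ⟦ isLive s ⟧
advance-live off      _     _     k z = refl
advance-live (used w) _     _     k z = refl
advance-live live     true  true  k z = refl
advance-live live     true  false k z = refl
advance-live live     false _     k z = refl

advance-arc : ∀ {r} (s : State r) a b k z → let s′ = advance s a b k z in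
              ⟦ isUsed s′ ⟧ + ⟦ isLive s′ ⟧ ≡ ⟦ isUsed s ⟧ + ⟦ isLive s ⟧
advance-arc off      _     _     k z = refl
advance-arc (used w) _     _     k z = refl
advance-arc live     true  true  k z = refl
advance-arc live     true  false k z = refl
advance-arc live     false _     k z = refl

-- Rounds only move an arc from live to used, so the arcs missed by the triangles of a block are
-- exactly its live arcs.
state-arc : ∀ {r n} (D : Tour n) (α β γ : Part r n) x y →
            ⟦ isUsed (state D α β γ x y) ⟧ + ⟦ isLive (state D α β γ x y) ⟧ ≡ ⟦ arc D (α x) (β y) ⟧
state-arc {zero} D α β γ [] [] with arc D (α []) (β [])
... | true  = refl
... | false = refl
state-arc {suc r} D α β γ (i ∷ x) (j ∷ y) =
  trans (advance-arc (state D (half α i) (half β j) (half γ (i xor j)) x y) _ _ _ _)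
        (state-arc D (half α i) (half β j) (half γ (i xor j)) x y)

used-arc : ∀ {r n} (D : Tour n) (α β γ : Part r n) x y {z} →
           state D α β γ x y ≡ used z → arc D (α x) (β y) ≡ true
used-arc D α β γ x y e with arc D (α x) (β y) | state-arc D α β γ x y
... | true  | _ = refl
... | false | p rewrite e with () ← p

isLive⇒live : ∀ {r} {s : State r} → isLive s ≡ true → s ≡ live
isLive⇒live {s = live} _ = refl

-- The three arcs of a triple perform the same test in rotated order, and each vertex is recovered
-- from the other two by the same parity rule; hence they agree on their triangle.
used-rotate : ∀ {r n} (D : Tour n) (α β γ : Part r n) x y {z} →
              state D α β γ x y ≡ used z → state D β γ α y z ≡ used x
used-rotate {zero} D α β γ [] [] e with arc D (α []) (β [])
used-rotate {zero} D α β γ [] [] () | true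
used-rotate {zero} D α β γ [] [] () | false
used-rotate {suc r} D α β γ (i ∷ x) (j ∷ y) e
  with state D (half α i) (half β j) (half γ (i xor j)) x y in e₁
     | isLive (state D (half β j) (half γ (not (i xor j))) (half α (j xor not (i xor j))) y (x ⊞ y)) in e₂
     | isLive (state D (half γ (not (i xor j))) (half α i) (half β (not (i xor j) xor i)) (x ⊞ y) x) in e₃
used-rotate {suc r} D α β γ (i ∷ x) (j ∷ y) refl | used w | b₂ | b₃
  rewrite xor-cancel i j | used-rotate D (half α i) (half β j) (half γ (i xor j)) x y e₁ = refl
-- The odd triple seen from its second arc: the bit recomputed there is the negation of `i`, and the
-- three liveness tests recur cyclically shifted.
used-rotate {suc r} D α β γ (i ∷ x) (j ∷ y) refl | live | true | true
  rewrite isLive⇒live e₂ | not-xor-cancel i j | ⊞-cancel x y | e₃ | e₁ | not-xor-cancel i j = refl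
used-rotate {suc r} D α β γ (i ∷ x) (j ∷ y) () | live | true  | false
used-rotate {suc r} D α β γ (i ∷ x) (j ∷ y) () | live | false | _
used-rotate {suc r} D α β γ (i ∷ x) (j ∷ y) () | off  | _     | _

SameArcs : ∀ {r n} → Tour n → Tour n → Part r n → Part r n → Set
SameArcs D D′ α β = ∀ x y → arc D (α x) (β y) ≡ arc D′ (α x) (β y)

state-cong : ∀ {r n} (D D′ : Tour n) (α β γ : Part r n) →
             SameArcs D D′ α β → SameArcs D D′ β γ → SameArcs D D′ γ α →
             ∀ x y → state D α β γ x y ≡ state D′ α β γ x y
state-cong {zero}  D D′ α β γ p q s []      []      = cong (λ b → if b then live else off) (p [] [])
state-cong {suc r} D D′ α β γ p q s (i ∷ x) (j ∷ y)
  rewrite state-cong D D′ (half α i) (half β j) (half γ (i xor j))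
            (λ x y → p _ _) (λ x y → q _ _) (λ x y → s _ _) x y
        | state-cong D D′ (half β j) (half γ (not (i xor j))) (half α (j xor not (i xor j)))
            (λ x y → q _ _) (λ x y → s _ _) (λ x y → p _ _) y (x ⊞ y)
        | state-cong D D′ (half γ (not (i xor j))) (half α i) (half β (not (i xor j) xor i))
            (λ x y → s _ _) (λ x y → p _ _) (λ x y → q _ _) (x ⊞ y) x = refl

Avoids : ∀ {r n} → Fin n → Part r n → Set
Avoids u α = ∀ x → u ≢ α x

-- Independence of sub-blocks, expressed through flips

record Fresh {r n} (u : Fin n) (α β γ : Part r n) : Set where
  constructor fresh
  field
    ∉α : Avoids u α
    ∉β : Avoids u β
    ∉γ : Avoids u γ

flip-same : ∀ {r n} (u v : Fin n) D {α β : Part r n} → (Avoids u α × Avoids u β) ⊎ (Avoids v α × Avoids v β) →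
            SameArcs (flip u v D) D α β
flip-same u v D (inj₁ (a , b)) x y = arc-flip-≢ u v _ _ D (λ (e , _) → a x e) (λ (e , _) → b y e)
flip-same u v D (inj₂ (a , b)) x y = arc-flip-≢ u v _ _ D (λ (_ , e) → b y e) (λ (_ , e) → a x e)

-- A state reads only pairs inside its block, and a pair with an end outside is not among them.
state-flip : ∀ {r n} (u v : Fin n) D (α β γ : Part r n) → Fresh u α β γ ⊎ Fresh v α β γ →
             ∀ x y → state (flip u v D) α β γ x y ≡ state D α β γ x y
state-flip u v D α β γ (inj₁ (fresh a b c)) = state-cong (flip u v D) D α β γ
  (flip-same u v D (inj₁ (a , b))) (flip-same u v D (inj₁ (b , c))) (flip-same u v D (inj₁ (c , a)))
state-flip u v D α β γ (inj₂ (fresh a b c)) = state-cong (flip u v D) D α β γ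
  (flip-same u v D (inj₂ (a , b))) (flip-same u v D (inj₂ (b , c))) (flip-same u v D (inj₂ (c , a)))

FlipInv : ∀ {r n} → (Tour n → ℕ) → Part r n → Part r n → Set
FlipInv G α β = ∀ x y D → G (flip (α x) (β y) D) ≡ G D

-- Independence of `G` from the arcs of a block. As invariance under flips it passes to products and
-- to sub-blocks without any product measure.
record Inv {r n} (G : Tour n → ℕ) (α β γ : Part r n) : Set where
  constructor inv
  field
    αβ : FlipInv G α β
    βγ : FlipInv G β γ
    γα : FlipInv G γ α

Inv-rotate : ∀ {r n} {G : Tour n → ℕ} {α β γ : Part r n} → Inv G α β γ → Inv G β γ α
Inv-rotate (inv a b c) = inv b c a

Inv-* : ∀ {r n} {G H : Tour n → ℕ} {α β γ : Part r n} → Inv G α β γ → Inv H α β γ →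
        Inv (λ D → G D * H D) α β γ
Inv-* (inv a b c) (inv a′ b′ c′) = inv
  (λ x y D → cong₂ _*_ (a x y D) (a′ x y D))
  (λ x y D → cong₂ _*_ (b x y D) (b′ x y D))
  (λ x y D → cong₂ _*_ (c x y D) (c′ x y D))

Inv-half : ∀ {r n} {G : Tour n → ℕ} {α β γ : Part (suc r) n} → Inv G α β γ →
           ∀ i j k → Inv G (half α i) (half β j) (half γ k)
Inv-half (inv a b c) i j k = inv (λ x y → a _ _) (λ x y → b _ _) (λ x y → c _ _)

liveAt : ∀ {r n} (α β γ : Part r n) → Vec Bool r → Vec Bool r → Tour n → ℕ
liveAt α β γ x y D = ⟦ isLive (state D α β γ x y) ⟧

-- Every pair between two of the parts `α`, `β`, `γ` has an end in `α` or in `γ`, so it is enough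
-- that these two parts lie outside the other block.
live-Inv : ∀ {r n} {α β γ α′ β′ γ′ : Part r n} →
           (∀ x → Fresh (α x) α′ β′ γ′) → (∀ x → Fresh (γ x) α′ β′ γ′) →
           ∀ x y → Inv (liveAt α′ β′ γ′ x y) α β γ
live-Inv {α′ = α′} {β′} {γ′} p q x y = inv
  (λ a b D → cong (λ s → ⟦ isLive s ⟧) (state-flip _ _ D α′ β′ γ′ (inj₁ (p a)) x y))
  (λ a b D → cong (λ s → ⟦ isLive s ⟧) (state-flip _ _ D α′ β′ γ′ (inj₂ (q b)) x y))
  (λ a b D → cong (λ s → ⟦ isLive s ⟧) (state-flip _ _ D α′ β′ γ′ (inj₁ (q a)) x y))

record Proper {r n} (α β γ : Part r n) : Set where
  constructor proper
  field
    injα : ∀ {x y} → α x ≡ α y → x ≡ y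
    injβ : ∀ {x y} → β x ≡ β y → x ≡ y
    injγ : ∀ {x y} → γ x ≡ γ y → x ≡ y
    α≢β  : ∀ x → Avoids (α x) β
    β≢γ  : ∀ x → Avoids (β x) γ
    γ≢α  : ∀ x → Avoids (γ x) α

Proper-rotate : ∀ {r n} {α β γ : Part r n} → Proper α β γ → Proper β γ α
Proper-rotate (proper a b c d e f) = proper b c a e f d

Proper-half : ∀ {r n} {α β γ : Part (suc r) n} → Proper α β γ →
              ∀ i j k → Proper (half α i) (half β j) (half γ k)
Proper-half (proper a b c d e f) i j k = proper
  (λ p → Vecₚ.∷-injectiveʳ (a p)) (λ p → Vecₚ.∷-injectiveʳ (b p)) (λ p → Vecₚ.∷-injectiveʳ (c p))
  (λ x y → d _ _) (λ x y → e _ _) (λ x y → f _ _)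

half-Fresh : ∀ {r n} {α β γ : Part (suc r) n} → Proper α β γ → ∀ {i i′ j k} → i ≢ i′ →
             ∀ x → Fresh (α (i ∷ x)) (half β j) (half γ k) (half α i′)
half-Fresh (proper a b c d e f) i≢i′ x =
  fresh (λ y → d _ _) (λ z q → f _ _ (sym q)) (λ x′ q → i≢i′ (Vecₚ.∷-injectiveˡ (a q)))

Fresh-rotate : ∀ {r n} {u : Fin n} {α β γ : Part r n} → Fresh u α β γ → Fresh u β γ α
Fresh-rotate (fresh a b c) = fresh b c a

-- With q = num / den the probability that a given arc of a level-r block is present and live,
-- q₀ = 1/2 and q_{r+1} = q_r − q_r³; here gap = den − num, which avoids subtraction.
num gap den : ℕ → ℕ
num zero    = 1
num (suc r) = num r * gap r * (num r + den r)
gap zero    = 1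
gap (suc r) = gap r * (den r * den r) + num r * (num r * num r)
den r = num r + gap r

den-suc : ∀ r → den (suc r) ≡ den r * (den r * den r)
den-suc r = identity (num r) (gap r)
  where
  identity : ∀ a b → a * b * (a + (a + b)) + (b * ((a + b) * (a + b)) + a * (a * a)) ≡
                     (a + b) * ((a + b) * (a + b))
  identity = solve-∀

num-suc : ∀ r → num (suc r) + num r * (num r * num r) ≡ num r * (den r * den r)
num-suc r = identity (num r) (gap r)
  where
  identity : ∀ a b → a * b * (a + (a + b)) + a * (a * a) ≡ a * ((a + b) * (a + b))
  identity = solve-∀

-- The step from q to q - q³ over the denominator d³, where q = n/d. `U` and `S` weigh the
-- tournaments in which the arc is live before and after the round; `T`, where all three arcs are
-- live, loses one factor q in each of the last three equations' steps `T` to `V` to `W` to `Z`.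
live-step : ∀ {d n g n′ S T U V W Z : ℕ} → n′ + g ≡ n * (d * d) → g ≡ n * (n * n) →
            S + T ≡ U → d * U ≡ n * Z → d * T ≡ n * V → d * V ≡ n * W → d * W ≡ n * Z →
            d * (d * d) * S ≡ n′ * Z
live-step {d} {n} {g} {n′} {S} {T} {U} {V} {W} {Z} e₀ refl e e₁ e₂ e₃ e₄ =
  ℕₚ.+-cancelʳ-≡ (d * (d * d) * T) _ _ (begin
    d * (d * d) * S + d * (d * d) * T ≡⟨ ℕₚ.*-distribˡ-+ (d * (d * d)) S T ⟨
    d * (d * d) * (S + T)             ≡⟨ cong (d * (d * d) *_) e ⟩
    d * (d * d) * U                   ≡⟨ assoc d d U ⟩
    d * d * (d * U)                   ≡⟨ cong (d * d *_) e₁ ⟩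
    d * d * (n * Z)                   ≡⟨ comm d n Z ⟩
    n * (d * d) * Z                   ≡⟨ cong (_* Z) e₀ ⟨
    (n′ + n * (n * n)) * Z            ≡⟨ ℕₚ.*-distribʳ-+ Z n′ _ ⟩
    n′ * Z + n * (n * n) * Z          ≡⟨ cong (n′ * Z +_) (sym cube) ⟩
    n′ * Z + d * (d * d) * T          ∎)
  where
  open ≡-Reasoning
  assoc : ∀ a b c → a * (a * b) * c ≡ a * b * (a * c)
  assoc = solve-∀
  comm : ∀ a b c → a * a * (b * c) ≡ b * (a * a) * c
  comm = solve-∀
  swap : ∀ a b c → a * a * (b * c) ≡ a * b * (a * c)
  swap = solve-∀
  swap′ : ∀ a b c → a * b * (b * c) ≡ b * b * (a * c)
  swap′ = solve-∀
  last : ∀ b c → b * b * (b * c) ≡ b * (b * b) * c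
  last = solve-∀
  cube : d * (d * d) * T ≡ n * (n * n) * Z
  cube = begin
    d * (d * d) * T   ≡⟨ assoc d d T ⟩
    d * d * (d * T)   ≡⟨ cong (d * d *_) e₂ ⟩
    d * d * (n * V)   ≡⟨ swap d n V ⟩
    d * n * (d * V)   ≡⟨ cong (d * n *_) e₃ ⟩
    d * n * (n * W)   ≡⟨ swap′ d n W ⟩
    n * n * (d * W)   ≡⟨ cong (n * n *_) e₄ ⟩
    n * n * (n * Z)   ≡⟨ last n Z ⟩
    n * (n * n) * Z   ∎

-- Of `D` and its flip exactly one contains the arc from `u` to `v`, and `G` agrees on both.
arc-uniform : ∀ {n} (u v : Fin n) (G : Tour n → ℕ) → u ≢ v → (∀ D → G (flip u v D) ≡ G D) →
              2 * sum (allTour n) (λ D → ⟦ arc D u v ⟧ * G D) ≡ sum (allTour n) G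
arc-uniform {n} u v G u≢v G-flip = begin
  2 * S          ≡⟨ cong (S +_) (ℕₚ.+-identityʳ S) ⟩
  S + S          ≡⟨ cong (S +_) (NatFlips.sum-flip u v _) ⟨
  S + sum (allTour n) (λ D → ⟦ arc (flip u v D) u v ⟧ * G (flip u v D))
                 ≡⟨ sum-+ (allTour n) _ _ ⟨
  sum (allTour n) (λ D → ⟦ arc D u v ⟧ * G D + ⟦ arc (flip u v D) u v ⟧ * G (flip u v D))
                 ≡⟨ sum-cong (allTour n) pointwise ⟩
  sum (allTour n) G ∎
  where
  open ≡-Reasoning
  S = sum (allTour n) (λ D → ⟦ arc D u v ⟧ * G D)
  pointwise : ∀ D → ⟦ arc D u v ⟧ * G D + ⟦ arc (flip u v D) u v ⟧ * G (flip u v D) ≡ G D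
  pointwise D rewrite arc-flip u v D u≢v | G-flip D = begin
    ⟦ arc D u v ⟧ * G D + ⟦ not (arc D u v) ⟧ * G D ≡⟨ ℕₚ.*-distribʳ-+ (G D) ⟦ arc D u v ⟧ _ ⟨
    (⟦ arc D u v ⟧ + ⟦ not (arc D u v) ⟧) * G D     ≡⟨ cong (_* G D) (⟦not⟧ (arc D u v)) ⟩
    1 * G D                                          ≡⟨ ℕₚ.*-identityˡ (G D) ⟩
    G D ∎

-- The weight `G` carries the induction: in the product of three liveness indicators each factor in
-- turn is averaged out, while the remaining ones, independent of its sub-block, are absorbed into
-- the weight.
live-probability : ∀ {r n} (α β γ : Part r n) (G : Tour n → ℕ) → Proper α β γ → Inv G α β γ → ∀ x y →
                   den r * sum (allTour n) (λ D → liveAt α β γ x y D * G D) ≡ num r * sum (allTour n) G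
live-probability {zero} {n} α β γ G P I [] [] = trans
  (cong (2 *_) (sum-cong (allTour n) (λ D → cong (_* G D) (pointwise (arc D (α []) (β []))))))
  (trans (arc-uniform (α []) (β []) G (Proper.α≢β P [] []) (Inv.αβ I [] []))
         (sym (ℕₚ.*-identityˡ _)))
  where
  pointwise : ∀ b → ⟦ isLive {0} (if b then live else off) ⟧ ≡ ⟦ b ⟧
  pointwise true  = refl
  pointwise false = refl
live-probability {suc r} {n} α β γ G P I (i ∷ x) (j ∷ y) = trans (cong (_* sum (allTour n) (λ D → L D * G D)) (den-suc r))
  (live-step {d = den r} {n = num r} (num-suc r) refl total
    (live-probability α₁ β₁ γ₁ G (Proper-half P i j k) (Inv-half I i j k) x y)
    (live-probability α₁ β₁ γ₁ (λ D → L₂ D * (L₃ D * G D)) (Proper-half P i j k)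
      (Inv-* I₁₂ (Inv-* I₁₃ (Inv-half I i j k))) x y)
    (live-probability β₁ γ₂ α₂ (λ D → L₃ D * G D) (Proper-half (Proper-rotate P) j (not k) (j xor not k))
      (Inv-* I₂₃ (Inv-half (Inv-rotate I) j (not k) (j xor not k))) y z)
    (live-probability γ₂ α₁ β₂ G (Proper-half (Proper-rotate (Proper-rotate P)) (not k) i (not k xor i))
      (Inv-half (Inv-rotate (Inv-rotate I)) (not k) i (not k xor i)) z x))
  where
  k = i xor j
  z = x ⊞ y
  α₁ = half α i
  β₁ = half β j
  γ₁ = half γ k
  γ₂ = half γ (not k)
  α₂ = half α (j xor not k)
  β₂ = half β (not k xor i)
  L  = liveAt α β γ (i ∷ x) (j ∷ y)
  L₁ = liveAt α₁ β₁ γ₁ x y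
  L₂ = liveAt β₁ γ₂ α₂ y z
  L₃ = liveAt γ₂ α₁ β₂ z x
  P′ = Proper-rotate P
  P″ = Proper-rotate P′
  -- Any two of the three sub-blocks share just one half, `β₁`, `α₁` and `γ₂` respectively, so no
  -- pair belongs to both.
  I₁₂ : Inv L₂ α₁ β₁ γ₁
  I₁₂ = live-Inv (half-Fresh P (xor-not-≢ i j))
    (λ c → Fresh-rotate (half-Fresh P″ b≢not-b c)) y z
  I₁₃ : Inv L₃ α₁ β₁ γ₁
  I₁₃ = Inv-rotate (live-Inv
    (λ c → Fresh-rotate (Fresh-rotate (half-Fresh P″ b≢not-b c))) (half-Fresh P′ (not-xor-≢ i j)) z x)
  I₂₃ : Inv L₃ β₁ γ₂ α₂
  I₂₃ = live-Inv (half-Fresh P′ (not-xor-≢ i j))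
    (λ c → Fresh-rotate (half-Fresh P (xor-not-≢ i j ∘ sym) c)) z x
  total : sum (allTour n) (λ D → L D * G D) +
          sum (allTour n) (λ D → L₁ D * (L₂ D * (L₃ D * G D))) ≡ sum (allTour n) (λ D → L₁ D * G D)
  total = trans (sym (sum-+ (allTour n) _ _)) (sum-cong (allTour n) λ D → begin
    L D * G D + L₁ D * (L₂ D * (L₃ D * G D))
      ≡⟨ factor (L D) (L₁ D) (L₂ D) (L₃ D) (G D) ⟩
    (L D + L₁ D * (L₂ D * L₃ D)) * G D
      ≡⟨ cong (_* G D) (advance-live (state D α₁ β₁ γ₁ x y) _ _ k z) ⟩
    L₁ D * G D ∎)
    where
    open ≡-Reasoning
    factor : ∀ a b c d e → a * e + b * (c * (d * e)) ≡ (a + b * (c * d)) * e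
    factor = solve-∀

-- Block triangles of a whole tournament

-- The second alternative is q_r ≤ 1 - r/K³ without denominators. While q_r > 1/K it passes to r +
-- 1, since the subtracted q_r³ exceeds 1/K³; at r = K³ + 1 it is impossible.
decay-step : ∀ K r → (∃ λ R → K * num R ≤ den R) ⊎ (r * den r + K * (K * K) * num r ≤ K * (K * K) * den r)
decay-step K zero = inj₂ (ℕₚ.*-monoʳ-≤ (K * (K * K)) (ℕₚ.m≤m+n 1 1))
decay-step K (suc r) with decay-step K r
... | inj₁ p = inj₁ p
... | inj₂ p with K * num r ℕ.≤? den r
... | yes q = inj₁ (r , q)
... | no  q = inj₂ (by-adding (+-mono-≤ (ℕₚ.*-monoʳ-≤ (den r * den r) p) cube) equation)
  where
  c = K * (K * K)
  lt = ℕₚ.<⇒≤ (ℕₚ.≰⇒> q)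
  cube : den r * (den r * den r) ≤ (K * num r) * ((K * num r) * (K * num r))
  cube = *-mono-≤ lt (*-mono-≤ lt lt)
  identity : ∀ K n d g n′ d′ r → d′ ≡ d * (d * d) → n′ + g ≡ n * (d * d) → g ≡ n * (n * n) →
    (suc r * d′ + K * (K * K) * n′) + (d * d * (K * (K * K) * d) + (K * n) * ((K * n) * (K * n))) ≡
    K * (K * K) * d′ + (d * d * (r * d + K * (K * K) * n) + d * (d * d))
  identity K n d g n′ d′ r refl e refl = begin
    (suc r * d′ + K * (K * K) * n′) + (d * d * (K * (K * K) * d) + (K * n) * ((K * n) * (K * n)))
      ≡⟨ one K n d n′ r ⟩
    suc r * d′ + K * (K * K) * (n′ + n * (n * n)) + d * d * (K * (K * K) * d)
      ≡⟨ cong (λ x → suc r * d′ + K * (K * K) * x + d * d * (K * (K * K) * d)) e ⟩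
    suc r * d′ + K * (K * K) * (n * (d * d)) + d * d * (K * (K * K) * d)
      ≡⟨ two K n d r ⟩
    K * (K * K) * d′ + (d * d * (r * d + K * (K * K) * n) + d * (d * d)) ∎
    where
    open ≡-Reasoning
    one : ∀ K n d n′ r →
      (suc r * (d * (d * d)) + K * (K * K) * n′) + (d * d * (K * (K * K) * d) + (K * n) * ((K * n) * (K * n))) ≡
      suc r * (d * (d * d)) + K * (K * K) * (n′ + n * (n * n)) + d * d * (K * (K * K) * d)
    one = solve-∀
    two : ∀ K n d r → suc r * (d * (d * d)) + K * (K * K) * (n * (d * d)) + d * d * (K * (K * K) * d) ≡
      K * (K * K) * (d * (d * d)) + (d * d * (r * d + K * (K * K) * n) + d * (d * d))
    two = solve-∀
  equation = identity K (num r) (den r) (num r * (num r * num r)) (num (suc r)) (den (suc r)) r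
    (den-suc r) (num-suc r) refl

num-pos : ∀ r → 1 ≤ num r × 1 ≤ gap r
num-pos zero    = ≤-refl , ≤-refl
num-pos (suc r) with num-pos r
... | p , q = *-mono-≤ (*-mono-≤ p q) (≤-trans p (ℕₚ.m≤m+n _ _)) ,
              ≤-trans (*-mono-≤ q (*-mono-≤ d d)) (ℕₚ.m≤m+n _ _)
  where
  d : 1 ≤ den r
  d = ≤-trans p (ℕₚ.m≤m+n _ _)

den-pos : ∀ r → 1 ≤ den r
den-pos r = ≤-trans (proj₁ (num-pos r)) (ℕₚ.m≤m+n _ _)

-- As long as q > 1/K, each step lowers q by at least 1/K³.
num/den→0 : ∀ K → ∃ λ R → K * num R ≤ den R
num/den→0 K with decay-step K (suc (K * (K * K)))
... | inj₁ p = p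
... | inj₂ p = contradiction (ℕₚ.+-cancelʳ-≤ (K * (K * K) * d) d 0 (≤-trans (ℕₚ.m≤m+n _ _) p))
                             (ℕₚ.<⇒≱ (den-pos (suc (K * (K * K)))))
  where
  d = den (suc (K * (K * K)))

-- Triples of residues with sum zero

residue-unique : ∀ q x {c c′} → c′ < q → q ∣ x + c → q ∣ x + c′ → c ≤ c′ → c ≡ c′
residue-unique q x {c} {c′} c′<q p p′ c≤c′ with c′ ∸ c in e
... | zero  = ℕₚ.≤-antisym c≤c′ (ℕₚ.m∸n≡0⇒m≤n e)
... | suc d = contradiction q∣d (>⇒∤ (ℕₚ.≤-<-trans (subst (_≤ c′) e (ℕₚ.m∸n≤m c′ c)) c′<q))
  where
  q∣d : q ∣ suc d
  q∣d = ∣m+n∣m⇒∣n (subst (q ∣_)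
    (trans (cong (x +_) (trans (sym (ℕₚ.m+[n∸m]≡n c≤c′)) (cong (c +_) e))) (sym (ℕₚ.+-assoc x c (suc d)))) p′) p

-- The residue -a - b. Adding the modulus twice makes the truncated subtraction exact.
third : ∀ {q} → Fin q → Fin q → Fin q
third {suc q} a b = Fin.fromℕ< (m%n<n (suc q + suc q ∸ (Fin.toℕ a + Fin.toℕ b)) (suc q))

third-∣ : ∀ {q} (a b : Fin q) → q ∣ Fin.toℕ a + Fin.toℕ b + Fin.toℕ (third a b)
third-∣ {suc q} a b rewrite Finₚ.toℕ-fromℕ< (m%n<n (suc q + suc q ∸ (Fin.toℕ a + Fin.toℕ b)) (suc q)) =
  ∣m+n∣m⇒∣n {m = m / suc q * suc q} (subst (suc q ∣_) whole (∣m∣n⇒∣m+n ∣-refl ∣-refl)) (n∣m*n (m / suc q))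
  where
  s = Fin.toℕ a + Fin.toℕ b
  m = suc q + suc q ∸ s
  open ≡-Reasoning
  whole : suc q + suc q ≡ m / suc q * suc q + (s + m % suc q)
  whole = begin
    suc q + suc q                     ≡⟨ ℕₚ.m+[n∸m]≡n (+-mono-≤ (ℕₚ.<⇒≤ (Finₚ.toℕ<n a)) (ℕₚ.<⇒≤ (Finₚ.toℕ<n b))) ⟨
    s + m                             ≡⟨ cong (s +_) (m≡m%n+[m/n]*n m (suc q)) ⟩
    s + (m % suc q + m / suc q * suc q) ≡⟨ rearrange s (m % suc q) _ ⟩
    m / suc q * suc q + (s + m % suc q) ∎
    where
    rearrange : ∀ a b c → a + (b + c) ≡ c + (a + b)
    rearrange = solve-∀

third-unique : ∀ {q} (a b c : Fin q) → q ∣ Fin.toℕ a + Fin.toℕ b + Fin.toℕ c → third a b ≡ c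
third-unique {q} a b c p with ℕₚ.≤-total (Fin.toℕ (third a b)) (Fin.toℕ c)
... | inj₁ le = Finₚ.toℕ-injective (residue-unique q _ (Finₚ.toℕ<n c) (third-∣ a b) p le)
... | inj₂ le = Finₚ.toℕ-injective (sym (residue-unique q _ (Finₚ.toℕ<n (third a b)) p (third-∣ a b) le))

third-rotate : ∀ {q} (a b : Fin q) → third b (third a b) ≡ a
third-rotate {q} a b = third-unique b (third a b) a (subst (q ∣_) (rearrange (Fin.toℕ a) _ _) (third-∣ a b))
  where
  rearrange : ∀ a b c → a + b + c ≡ b + c + a
  rearrange = solve-∀

third-involutive : ∀ {q} (a b : Fin q) → third a (third a b) ≡ b
third-involutive {q} a b = third-unique a (third a b) b (subst (q ∣_) (rearrange (Fin.toℕ a) _ _) (third-∣ a b))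
  where
  rearrange : ∀ a b c → a + b + c ≡ a + c + b
  rearrange = solve-∀

-- Listing the points of the fibres and embedding them in the vertex set

cube : ∀ r → List (Vec Bool r)
cube zero    = [] ∷ []
cube (suc r) = map (true ∷_) (cube r) ++ map (false ∷_) (cube r)

cube-unique : ∀ r → Unique (cube r)
cube-unique zero    = [] ∷ []
cube-unique (suc r) = Uniqueₚ.++⁺ (Uniqueₚ.map⁺ Vecₚ.∷-injectiveʳ (cube-unique r))
  (Uniqueₚ.map⁺ Vecₚ.∷-injectiveʳ (cube-unique r)) heads
  where
  heads : ∀ {x} → ¬ (x ∈ map (true ∷_) (cube r) × x ∈ map (false ∷_) (cube r))
  heads (p , q) with ∈ₚ.∈-map⁻ (true ∷_) p | ∈ₚ.∈-map⁻ (false ∷_) q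
  ... | _ , _ , refl | _ , _ , ()

∈-cube : ∀ {r} (x : Vec Bool r) → x ∈ cube r
∈-cube []          = here refl
∈-cube (true  ∷ x) = ∈ₚ.∈-++⁺ˡ (∈ₚ.∈-map⁺ (true ∷_) (∈-cube x))
∈-cube (false ∷ x) = ∈ₚ.∈-++⁺ʳ _ (∈ₚ.∈-map⁺ (false ∷_) (∈-cube x))

length-cube : ∀ r → length (cube r) ≡ 2 ^ r
length-cube zero    = refl
length-cube (suc r) = trans (Listₚ.length-++ (map (true ∷_) (cube r)))
  (cong₂ _+_ (trans (Listₚ.length-map (true ∷_) (cube r)) (length-cube r))
    (trans (trans (Listₚ.length-map (false ∷_) (cube r)) (length-cube r)) (sym (ℕₚ.+-identityʳ _))))

fins-unique : ∀ n → Unique (fins n)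
fins-unique zero    = []
fins-unique (suc n) = All.tabulate no-zero ∷ Uniqueₚ.map⁺ Finₚ.suc-injective (fins-unique n)
  where
  no-zero : ∀ {x} → x ∈ map Fin.suc (fins n) → zero ≢ x
  no-zero p with ∈ₚ.∈-map⁻ Fin.suc p
  ... | _ , _ , refl = λ ()

∈-fins : ∀ {n} (u : Fin n) → u ∈ fins n
∈-fins zero    = here refl
∈-fins (suc u) = there (∈ₚ.∈-map⁺ Fin.suc (∈-fins u))

code : ∀ {r} → Vec Bool r → Fin (2 ^ r)
code []          = zero
code {suc r} (true  ∷ x) = Fin.combine {2} {2 ^ r} zero (code x)
code {suc r} (false ∷ x) = Fin.combine {2} {2 ^ r} (suc zero) (code x)

code-injective : ∀ {r} {x y : Vec Bool r} → code x ≡ code y → x ≡ y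
code-injective {x = []}        {[]}        e = refl
code-injective {suc r} {x = true  ∷ x} {true  ∷ y} e =
  cong (true ∷_) (code-injective (Finₚ.combine-injectiveʳ {2} {2 ^ r} zero (code x) zero (code y) e))
code-injective {suc r} {x = true  ∷ x} {false ∷ y} e
  with () ← Finₚ.combine-injectiveˡ {2} {2 ^ r} zero (code x) (suc zero) (code y) e
code-injective {suc r} {x = false ∷ x} {true  ∷ y} e
  with () ← Finₚ.combine-injectiveˡ {2} {2 ^ r} (suc zero) (code x) zero (code y) e
code-injective {suc r} {x = false ∷ x} {false ∷ y} e =
  cong (false ∷_) (code-injective (Finₚ.combine-injectiveʳ {2} {2 ^ r} (suc zero) (code x) (suc zero) (code y) e))

-- The points fill the first q·2^r vertices; the vertices beyond them are left out of the packing.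
fibre : ∀ {q r n} → q * 2 ^ r ≤ n → Fin q → Part r n
fibre le a x = Fin.inject≤ (Fin.combine a (code x)) le

fibre-injective : ∀ {q r n} (le : q * 2 ^ r ≤ n) (a b : Fin q) (x y : Vec Bool r) →
                  fibre le a x ≡ fibre le b y → a ≡ b × x ≡ y
fibre-injective le a b x y e with Finₚ.combine-injective a (code x) b (code y)
  (Finₚ.inject≤-injective le le _ _ e)
... | p , p′ = p , code-injective p′

length-filter-sum : ∀ {A : Set} {P : A → Set} (P? : ∀ x → Dec (P x)) xs →
                    length (filter P? xs) ≡ sum xs (λ x → ⟦ ⌊ P? x ⌋ ⟧)
length-filter-sum P? []       = refl
length-filter-sum P? (x ∷ xs) with P? x
... | yes _ = cong suc (length-filter-sum P? xs)
... | no  _ = length-filter-sum P? xs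

sum-cartesianProduct : ∀ {A B : Set} (xs : List A) (ys : List B) (f : A × B → ℕ) →
                       sum (cartesianProduct xs ys) f ≡ sum xs (λ x → sum ys (λ y → f (x , y)))
sum-cartesianProduct []       ys f = refl
sum-cartesianProduct (x ∷ xs) ys f = trans (sum-++ (map (x ,_) ys) _ f)
  (cong₂ _+_ (sum-map (x ,_) ys f) (sum-cartesianProduct xs ys f))

∈⇒≤sum : ∀ {A : Set} {xs : List A} (f : A → ℕ) {x} → x ∈ xs → f x ≤ sum xs f
∈⇒≤sum f (here refl) = ℕₚ.m≤m+n _ _
∈⇒≤sum f (there p)   = ≤-trans (∈⇒≤sum f p) (ℕₚ.m≤n+m _ _)

unique⇒allPairs : ∀ {A : Set} {P : A → Set} {R : A → A → Set} → (∀ {x y} → P x → P y → x ≢ y → R x y) →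
                  ∀ {xs} → All P xs → Unique xs → AllPairs R xs
unique⇒allPairs h []       []       = []
unique⇒allPairs {P = P} {R} h (p ∷ ps) (u ∷ us) = go ps u ∷ unique⇒allPairs h ps us
  where
  go : ∀ {ys} → All P ys → All (_ ≢_) ys → All (R _) ys
  go []       []       = []
  go (q ∷ qs) (v ∷ vs) = h p q v ∷ go qs vs

⌊⌋-true : ∀ {P : Set} (P? : Dec P) → P → ⟦ ⌊ P? ⌋ ⟧ ≡ 1
⌊⌋-true (yes _) p = refl
⌊⌋-true (no ¬p) p = contradiction p ¬p

⌊⌋-≤ : ∀ {P : Set} (P? : Dec P) {m} → (P → 1 ≤ m) → ⟦ ⌊ P? ⌋ ⟧ ≤ m
⌊⌋-≤ (yes p) h = h p
⌊⌋-≤ (no _)  h = z≤n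

-- `Δ` holds for all three rotations of a chosen triangle. Keeping only the rotation that begins at
-- its least vertex lists each triangle once.
module RotationInvariant {n} (D : Tour n) {I : Set} (points : List I) (points-unique : Unique points)
  (ι : I → Fin n) (ι-injective : ∀ {u v} → ι u ≡ ι v → u ≡ v)
  {Δ : I → I → I → Set} (Δ? : ∀ u v w → Dec (Δ u v w))
  (Δ-rotate : ∀ {u v w} → Δ u v w → Δ v w u)
  (Δ-unique : ∀ {u v w w′} → Δ u v w → Δ u v w′ → w ≡ w′)
  (Δ-arc : ∀ {u v w} → Δ u v w → Arc D (ι u) (ι v)) where

  Least : I × I × I → Set
  Least (u , v , w) = Δ u v w × ι u Fin.< ι v × ι u Fin.< ι w

  least? : ∀ t → Dec (Least t)
  least? (u , v , w) = Δ? u v w ×-dec (ι u Finₚ.<? ι v) ×-dec (ι u Finₚ.<? ι w)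

  triples : List (I × I × I)
  triples = cartesianProduct points (cartesianProduct points points)

  place : I × I × I → Triple n
  place (u , v , w) = ι u , ι v , ι w

  packing : List (Triple n)
  packing = map place (filter least? triples)

  Δ-unique′ : ∀ {u v w u′ v′ w′} → Δ u v w → Δ u′ v′ w′ → (ι u , ι v) ≡ (ι u′ , ι v′) →
              u ≡ u′ × v ≡ v′ × w ≡ w′
  Δ-unique′ {u} {v} {w} {u′} {v′} {w′} t t′ e = go (ι-injective (cong proj₁ e)) (ι-injective (cong proj₂ e))
    where
    go : u ≡ u′ → v ≡ v′ → u ≡ u′ × v ≡ v′ × w ≡ w′
    go refl refl = refl , refl , Δ-unique t t′

  same : ∀ {u v w u′ v′ w′ : I} → u ≡ u′ × v ≡ v′ × w ≡ w′ → (u , v , w) ≡ (u′ , v′ , w′)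
  same (refl , refl , refl) = refl

  rot¹ : ∀ {u v w u′ v′ w′} → Least (u , v , w) → Least (u′ , v′ , w′) → u ≡ v′ × v ≡ w′ × w ≡ u′ → ⊥
  rot¹ (_ , _ , p) (_ , q , _) (refl , refl , refl) = ℕₚ.<-asym p q

  rot² : ∀ {u v w u′ v′ w′} → Least (u , v , w) → Least (u′ , v′ , w′) → u ≡ w′ × v ≡ u′ × w ≡ v′ → ⊥
  rot² (_ , p , _) (_ , _ , q) (refl , refl , refl) = ℕₚ.<-asym p q

  turn : ∀ {u v w u′ v′ w′ : I} → u ≡ u′ × v ≡ v′ × w ≡ w′ → v ≡ v′ × w ≡ w′ × u ≡ u′
  turn (a , b , c) = b , c , a

  -- As `Δ` determines the third point, a common arc forces the two triples to agree up to rotation;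
  -- two different rotations cannot both begin at the least vertex.
  disjoint : ∀ {t s} → Least t → Least s → t ≢ s → ArcDisjoint (place t) (place s)
  disjoint {u , v , w} {u′ , v′ , w′} l@(t , _) l′@(t′ , _) t≢s = go
    where
    t¹ = Δ-rotate t
    t² = Δ-rotate t¹
    s¹ = Δ-rotate t′
    s² = Δ-rotate s¹
    go : ArcDisjoint (place (u , v , w)) (place (u′ , v′ , w′))
    go (here p) (here p′) = t≢s (same (Δ-unique′ t t′ (trans (sym p) p′)))
    go (here p) (there (here p′)) = rot¹ l l′ (Δ-unique′ t s¹ (trans (sym p) p′))
    go (here p) (there (there (here p′))) = rot² l l′ (Δ-unique′ t s² (trans (sym p) p′))
    go (there (here p)) (here p′) = rot² l l′ (turn (turn (Δ-unique′ t¹ t′ (trans (sym p) p′))))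
    go (there (here p)) (there (here p′)) = t≢s (same (turn (turn (Δ-unique′ t¹ s¹ (trans (sym p) p′)))))
    go (there (here p)) (there (there (here p′))) = rot¹ l l′ (turn (turn (Δ-unique′ t¹ s² (trans (sym p) p′))))
    go (there (there (here p))) (here p′) = rot¹ l l′ (turn (Δ-unique′ t² t′ (trans (sym p) p′)))
    go (there (there (here p))) (there (here p′)) = rot² l l′ (turn (Δ-unique′ t² s¹ (trans (sym p) p′)))
    go (there (there (here p))) (there (there (here p′))) = t≢s (same (turn (Δ-unique′ t² s² (trans (sym p) p′))))

  triangle : ∀ {t} → Least t → IsTriangle D (place t)
  triangle (t , _) = Δ-arc t , Δ-arc (Δ-rotate t) , Δ-arc (Δ-rotate (Δ-rotate t))

  packing-valid : IsPacking D packing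
  packing-valid = Allₚ.map⁺ (All.map triangle all-least) ,
    AllPairsₚ.map⁺ (unique⇒allPairs disjoint all-least
      (Uniqueₚ.filter⁺ least? (Uniqueₚ.cartesianProduct⁺ points-unique
        (Uniqueₚ.cartesianProduct⁺ points-unique points-unique))))
    where
    all-least : All Least (filter least? triples)
    all-least = Allₚ.all-filter least? triples

  total : (I → I → I → ℕ) → ℕ
  total f = sum points (λ u → sum points (λ v → sum points (f u v)))

  total-rotate : ∀ f → total (λ u v w → f v w u) ≡ total f
  total-rotate f = trans (sum-swap points points (λ u v → sum points (λ w → f v w u)))
    (sum-cong points (λ v → sum-swap points points (λ u w → f v w u)))

  least : I → I → I → ℕ
  least u v w = ⟦ ⌊ least? (u , v , w) ⌋ ⟧

  -- There are no loops, so the three vertices are distinct, one of them is least, and the rotation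
  -- beginning there is kept.
  some-least : ∀ u v w → ⟦ ⌊ Δ? u v w ⌋ ⟧ ≤ least u v w + (least v w u + least w u v)
  some-least u v w = ⌊⌋-≤ (Δ? u v w) (λ t →
    minimum t (Finₚ.<-cmp (ι u) (ι v)) (Finₚ.<-cmp (ι v) (ι w)) (Finₚ.<-cmp (ι u) (ι w)))
    where
    goal = least u v w + (least v w u + least w u v)
    first : Least (u , v , w) → 1 ≤ goal
    first l = ≤-trans (≤-reflexive (sym (⌊⌋-true (least? (u , v , w)) l))) (ℕₚ.m≤m+n _ _)
    second : Least (v , w , u) → 1 ≤ goal
    second l = ≤-trans (≤-reflexive (sym (⌊⌋-true (least? (v , w , u)) l)))
      (≤-trans (ℕₚ.m≤m+n _ _) (ℕₚ.m≤n+m _ (least u v w)))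
    final : Least (w , u , v) → 1 ≤ goal
    final l = ≤-trans (≤-reflexive (sym (⌊⌋-true (least? (w , u , v)) l)))
      (≤-trans (ℕₚ.m≤n+m _ (least v w u)) (ℕₚ.m≤n+m _ (least u v w)))
    no-loop : ∀ {x y z} → Δ x y z → ι x ≢ ι y
    no-loop {x} s e = subst T (trans (cong (arc D (ι x)) (sym e)) (arc-irrefl D (ι x))) (Δ-arc s)
    minimum : Δ u v w → Tri (ι u Fin.< ι v) (ι u ≡ ι v) (ι v Fin.< ι u) →
              Tri (ι v Fin.< ι w) (ι v ≡ ι w) (ι w Fin.< ι v) →
              Tri (ι u Fin.< ι w) (ι u ≡ ι w) (ι w Fin.< ι u) → 1 ≤ goal
    minimum t (tri≈ _ e _) _ _ = contradiction e (no-loop t)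
    minimum t _ (tri≈ _ e _) _ = contradiction e (no-loop (Δ-rotate t))
    minimum t _ _ (tri≈ _ e _) = contradiction (sym e) (no-loop (Δ-rotate (Δ-rotate t)))
    minimum t (tri< a _ _) _ (tri< b _ _) = first (t , a , b)
    minimum t (tri< a _ _) _ (tri> _ _ b) = final (Δ-rotate (Δ-rotate t) , b , ℕₚ.<-trans b a)
    minimum t (tri> _ _ a) (tri< b _ _) _ = second (Δ-rotate t , b , a)
    minimum t (tri> _ _ a) (tri> _ _ b) _ = final (Δ-rotate (Δ-rotate t) , ℕₚ.<-trans b a , b)

  -- Summation over all triples is invariant under rotation, so the three terms of `some-least`
  -- contribute equally.
  packing-size : total (λ u v w → ⟦ ⌊ Δ? u v w ⌋ ⟧) ≤ 3 * length packing
  packing-size = begin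
    total (λ u v w → ⟦ ⌊ Δ? u v w ⌋ ⟧)
      ≤⟨ sum-mono points (λ u → sum-mono points (λ v → sum-mono points (some-least u v))) ⟩
    total (λ u v w → least u v w + (least v w u + least w u v))
      ≡⟨ total-+ least _ ⟩
    total least + total (λ u v w → least v w u + least w u v)
      ≡⟨ cong (total least +_) (total-+ (λ u v w → least v w u) (λ u v w → least w u v)) ⟩
    total least + (total (λ u v w → least v w u) + total (λ u v w → least w u v))
      ≡⟨ cong (total least +_) (cong₂ _+_ (total-rotate least)
           (trans (total-rotate (λ u v w → least v w u)) (total-rotate least))) ⟩
    total least + (total least + total least)
      ≡⟨ cong (λ x → x + (x + x)) (sym size) ⟩
    length packing + (length packing + length packing)
      ≡⟨ triple (length packing) ⟩
    3 * length packing ∎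
    where
    open ℕₚ.≤-Reasoning
    triple : ∀ x → x + (x + x) ≡ 3 * x
    triple = solve-∀
    total-+ : ∀ f g → total (λ u v w → f u v w + g u v w) ≡ total f + total g
    total-+ f g = trans (sum-cong points (λ u → trans (sum-cong points (λ v → sum-+ points (f u v) (g u v)))
      (sum-+ points _ _))) (sum-+ points _ _)
    size : length packing ≡ total least
    size = trans (Listₚ.length-map place (filter least? triples)) (trans (length-filter-sum least? triples)
      (trans (sum-cartesianProduct points _ _) (sum-cong points (λ u → sum-cartesianProduct points points _))))

used? : ∀ {r} (s : State r) z → Dec (s ≡ used z)
used? off      z = no λ ()
used? live     z = no λ ()
used? (used w) z with Vecₚ.≡-dec Boolₚ._≟_ w z
... | yes refl = yes refl
... | no  w≢z  = no λ { refl → w≢z refl }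

isUsed-≤ : ∀ {r} (s : State r) {m} → (∀ z → s ≡ used z → 1 ≤ m) → ⟦ isUsed s ⟧ ≤ m
isUsed-≤ off      h = z≤n
isUsed-≤ live     h = z≤n
isUsed-≤ (used z) h = h z refl

≡true⇒T : ∀ {b} → b ≡ true → T b
≡true⇒T refl = tt

sum-==-fins : ∀ {n} (u : Fin n) → sum (fins n) (λ v → ⟦ u == v ⟧) ≡ 1
sum-==-fins u = trans (sum-cong (fins _) (λ v → sym (ℕₚ.*-identityʳ ⟦ u == v ⟧))) (sum-point u (λ _ → 1))

-- Residue classes of blocks, and degenerate pairs

record Class {q} (a b c : Fin q) : Set where
  constructor class
  field
    is-third : third a b ≡ c
    a≢b : a ≢ b
    b≢c : b ≢ c
    c≢a : c ≢ a

class? : ∀ {q} (a b c : Fin q) → Dec (Class a b c)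
class? a b c = map′ (λ (p , x , y , z) → class p x y z) (λ (class p x y z) → p , x , y , z)
  ((third a b Fin.≟ c) ×-dec ¬? (a Fin.≟ b) ×-dec ¬? (b Fin.≟ c) ×-dec ¬? (c Fin.≟ a))

class-rotate : ∀ {q} {a b c : Fin q} → Class a b c → Class b c a
class-rotate {a = a} {b} (class refl x y z) = class (third-rotate a b) y z x

-- The number of ways in which a, b and third a b can fail to be distinct.
degenerate : ∀ {q} → Fin q → Fin q → ℕ
degenerate a b = ⟦ a == b ⟧ + (⟦ third b b == a ⟧ + ⟦ third a a == b ⟧)

==-intro : ∀ {n} {u v : Fin n} → u ≡ v → ⟦ u == v ⟧ ≡ 1
==-intro {u = u} refl = cong ⟦_⟧ (==-refl u)

class-or-degenerate : ∀ {q} (a b : Fin q) → ¬ Class a b (third a b) → 1 ≤ degenerate a b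
class-or-degenerate a b ¬cl with a Fin.≟ b
... | yes a≡b = s≤s z≤n
... | no  a≢b with b Fin.≟ third a b
... | yes p = ≤-trans (≤-reflexive (sym (==-intro
    (trans (cong (third b) p) (third-rotate a b))))) (ℕₚ.m≤m+n _ _)
... | no  b≢c with third a b Fin.≟ a
... | yes p = ≤-trans (≤-reflexive (sym (==-intro
    (trans (cong (third a) (sym p)) (third-involutive a b))))) (ℕₚ.m≤n+m _ ⟦ third b b == a ⟧)
... | no  c≢a = contradiction (class refl a≢b b≢c c≢a) ¬cl

-- Each of the three coincidences determines one residue from the other and so has q solutions.
sum-degenerate : ∀ q → sum (fins q) (λ a → sum (fins q) (degenerate a)) ≡ 3 * q
sum-degenerate q = begin
  sum (fins q) (λ a → sum (fins q) (degenerate a))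
    ≡⟨ sum-cong (fins q) (λ a → sum-+ (fins q) (λ b → ⟦ a == b ⟧) (λ b → ⟦ third b b == a ⟧ + ⟦ third a a == b ⟧)) ⟩
  sum (fins q) (λ a → sum (fins q) (λ b → ⟦ a == b ⟧) +
                      sum (fins q) (λ b → ⟦ third b b == a ⟧ + ⟦ third a a == b ⟧))
    ≡⟨ sum-+ (fins q) _ _ ⟩
  sum (fins q) (λ a → sum (fins q) (λ b → ⟦ a == b ⟧)) +
  sum (fins q) (λ a → sum (fins q) (λ b → ⟦ third b b == a ⟧ + ⟦ third a a == b ⟧))
    ≡⟨ cong₂ _+_ (trans (sum-cong (fins q) sum-==-fins) ones)
         (trans (sum-cong (fins q) (λ a → sum-+ (fins q) (λ b → ⟦ third b b == a ⟧) (λ b → ⟦ third a a == b ⟧)))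
                (sum-+ (fins q) _ _)) ⟩
  q + (sum (fins q) (λ a → sum (fins q) (λ b → ⟦ third b b == a ⟧)) +
       sum (fins q) (λ a → sum (fins q) (λ b → ⟦ third a a == b ⟧)))
    ≡⟨ cong (q +_) (cong₂ _+_
         (trans (sum-swap (fins q) (fins q) _) (trans (sum-cong (fins q) (λ b → sum-==-fins (third b b))) ones))
         (trans (sum-cong (fins q) (λ a → sum-==-fins (third a a))) ones)) ⟩
  q + (q + q)
    ≡⟨ triple q ⟩
  3 * q ∎
  where
  open ≡-Reasoning
  ones : sum (fins q) (λ _ → 1) ≡ q
  ones = trans (sym (length-sum (fins q))) (length-fins q)
  triple : ∀ q → q + (q + q) ≡ 3 * q
  triple = solve-∀

module BlockPacking {q r n} (fits : q * 2 ^ r ≤ n) where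

  Point : Set
  Point = Fin q × Vec Bool r

  points : List Point
  points = cartesianProduct (fins q) (cube r)

  place : Point → Fin n
  place (a , x) = fibre fits a x

  place-injective : ∀ {u v} → place u ≡ place v → u ≡ v
  place-injective {a , x} {b , y} e =
    cong₂ _,_ (proj₁ (fibre-injective fits a b x y e)) (proj₂ (fibre-injective fits a b x y e))

  points-unique : Unique points
  points-unique = Uniqueₚ.cartesianProduct⁺ (fins-unique q) (cube-unique r)

  ∈-points : ∀ u → u ∈ points
  ∈-points (a , x) = ∈ₚ.∈-cartesianProduct⁺ (∈-fins a) (∈-cube x)

  Chosen : Tour n → Point → Point → Point → Set
  Chosen D (a , x) (b , y) (c , z) = Class a b c × state D (fibre fits a) (fibre fits b) (fibre fits c) x y ≡ used z

  chosen? : ∀ D u v w → Dec (Chosen D u v w)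
  chosen? D (a , x) (b , y) (c , z) = class? a b c ×-dec used? _ z

  chosen-rotate : ∀ D {u v w} → Chosen D u v w → Chosen D v w u
  chosen-rotate D {a , x} {b , y} {c , z} (cl , e) =
    class-rotate cl , used-rotate D (fibre fits a) (fibre fits b) (fibre fits c) x y e

  chosen-unique : ∀ D {u v w w′} → Chosen D u v w → Chosen D u v w′ → w ≡ w′
  chosen-unique D (class refl _ _ _ , e) (class refl _ _ _ , e′) with trans (sym e) e′
  ... | refl = refl

  chosen-arc : ∀ D {u v w} → Chosen D u v w → Arc D (place u) (place v)
  chosen-arc D {a , x} {b , y} {c , z} (cl , e) =
    ≡true⇒T (used-arc D (fibre fits a) (fibre fits b) (fibre fits c) x y e)

  leftover : Tour n → Point → Point → ℕ
  leftover D (a , x) (b , y) =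
    ⟦ ⌊ class? a b (third a b) ⌋ ⟧ * liveAt (fibre fits a) (fibre fits b) (fibre fits (third a b)) x y D

  sum² : (Point → Point → ℕ) → ℕ
  sum² f = sum points (λ u → sum points (f u))

  sum²-+ : ∀ f g → sum² (λ u v → f u v + g u v) ≡ sum² f + sum² g
  sum²-+ f g = trans (sum-cong points (λ u → sum-+ points (f u) (g u))) (sum-+ points _ _)

  sum²-mono : ∀ {f g} → (∀ u v → f u v ≤ g u v) → sum² f ≤ sum² g
  sum²-mono h = sum-mono points (λ u → sum-mono points (h u))

  sum²-classes : ∀ (f : Fin q → Fin q → ℕ) → sum² (λ u v → f (proj₁ u) (proj₁ v)) ≡
                 sum (fins q) (λ a → sum (fins q) (f a)) * (2 ^ r * 2 ^ r)
  sum²-classes f = begin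
    sum² (λ u v → f (proj₁ u) (proj₁ v))
      ≡⟨ sum-cong points (λ u → inner (f (proj₁ u))) ⟩
    sum points (λ u → sum (fins q) (f (proj₁ u)) * 2 ^ r)
      ≡⟨ inner (λ a → sum (fins q) (f a) * 2 ^ r) ⟩
    sum (fins q) (λ a → sum (fins q) (f a) * 2 ^ r) * 2 ^ r
      ≡⟨ cong (_* 2 ^ r) (sum-*ʳ (fins q) _ (2 ^ r)) ⟩
    sum (fins q) (λ a → sum (fins q) (f a)) * 2 ^ r * 2 ^ r
      ≡⟨ ℕₚ.*-assoc (sum (fins q) (λ a → sum (fins q) (f a))) (2 ^ r) (2 ^ r) ⟩
    sum (fins q) (λ a → sum (fins q) (f a)) * (2 ^ r * 2 ^ r) ∎
    where
    open ≡-Reasoning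
    inner : ∀ (g : Fin q → ℕ) → sum points (λ u → g (proj₁ u)) ≡ sum (fins q) g * 2 ^ r
    inner g = trans (sum-cartesianProduct (fins q) (cube r) _)
      (trans (sum-cong (fins q) (λ a → trans (sum-const (cube r) (g a))
        (trans (ℕₚ.*-comm (length (cube r)) (g a)) (cong (g a *_) (length-cube r)))))
      (sum-*ʳ (fins q) g (2 ^ r)))

  size : ℕ
  size = q * 2 ^ r

  sum²-const : ∀ c → sum² (λ _ _ → c) ≡ size * size * c
  sum²-const c = trans (sum²-classes (λ _ _ → c)) (trans
    (cong (_* (2 ^ r * 2 ^ r)) (trans (sum-cong (fins q) (λ _ → sum-const-fins q c)) (sum-const-fins q (q * c))))
    (identity q (2 ^ r) c))
    where
    identity : ∀ q s c → q * (q * c) * (s * s) ≡ q * s * (q * s) * c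
    identity = solve-∀

  -- In a block on distinct residues an arc is used, and then its third vertex gives a chosen
  -- triple, or it is live. Pairs that lie in no block are paid for by `degenerate`.
  arc-covered : ∀ D u v → ⟦ arc D (place u) (place v) ⟧ ≤
    sum points (λ w → ⟦ ⌊ chosen? D u v w ⌋ ⟧) + (leftover D u v + degenerate (proj₁ u) (proj₁ v))
  arc-covered D (a , x) (b , y) with class? a b (third a b)
  ... | no ¬cl = ≤-trans (⟦⟧≤1 _) (≤-trans (class-or-degenerate a b ¬cl)
    (ℕₚ.m≤n+m (degenerate a b) (sum points (λ w → ⟦ ⌊ chosen? D (a , x) (b , y) w ⌋ ⟧))))
  ... | yes cl = begin
    ⟦ arc D (fibre fits a x) (fibre fits b y) ⟧
      ≡⟨ state-arc D (fibre fits a) (fibre fits b) (fibre fits (third a b)) x y ⟨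
    ⟦ isUsed s ⟧ + ⟦ isLive s ⟧
      ≤⟨ +-mono-≤ (isUsed-≤ s used-chosen) (≤-trans (≤-reflexive (sym (ℕₚ.+-identityʳ _))) (ℕₚ.m≤m+n _ _)) ⟩
    sum points (λ w → ⟦ ⌊ chosen? D (a , x) (b , y) w ⌋ ⟧) + (⟦ isLive s ⟧ + 0 + degenerate a b) ∎
    where
    open ℕₚ.≤-Reasoning
    s = state D (fibre fits a) (fibre fits b) (fibre fits (third a b)) x y
    used-chosen : ∀ z → s ≡ used z → 1 ≤ sum points (λ w → ⟦ ⌊ chosen? D (a , x) (b , y) w ⌋ ⟧)
    used-chosen z e = ≤-trans (≤-reflexive (sym (⌊⌋-true (chosen? D (a , x) (b , y) (third a b , z)) (cl , e))))
      (∈⇒≤sum (λ w → ⟦ ⌊ chosen? D (a , x) (b , y) w ⌋ ⟧) (∈-points (third a b , z)))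

  one-arc : ∀ D u v → 1 ≤ ⟦ arc D (place u) (place v) ⟧ + (⟦ arc D (place v) (place u) ⟧ + degenerate (proj₁ u) (proj₁ v))
  one-arc D u@(a , x) v@(b , y) with a Fin.≟ b
  ... | yes _ = ≤-trans (s≤s z≤n) (≤-trans (ℕₚ.m≤n+m _ _) (ℕₚ.m≤n+m _ ⟦ arc D (place u) (place v) ⟧))
  ... | no a≢b rewrite arc-anti D (place u) (place v) (λ e → a≢b (proj₁ (fibre-injective fits a b x y e))) = begin
    1 ≡⟨ ⟦not⟧ (arc D (place u) (place v)) ⟨
    ⟦ arc D (place u) (place v) ⟧ + ⟦ not (arc D (place u) (place v)) ⟧
      ≤⟨ ℕₚ.+-monoʳ-≤ ⟦ arc D (place u) (place v) ⟧ (ℕₚ.m≤m+n _ _) ⟩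
    _ ∎
    where open ℕₚ.≤-Reasoning

  -- Every non-degenerate ordered pair has an arc in one of its two directions, so the sum over
  -- ordered pairs counts the arcs twice. Degenerate pairs enter three times, once for missing arcs
  -- and once in each count of arcs, each time with 3·size·2^r; hence the 9.
  large-packing : ∀ D → ∃ λ P → IsPacking D P ×
                  size * size ≤ 6 * length P + 2 * sum² (leftover D) + 9 * (size * 2 ^ r)
  large-packing D = packing , packing-valid , (begin
    size * size
      ≡⟨ trans (sym (ℕₚ.*-identityʳ _)) (sym (sum²-const 1)) ⟩
    sum² (λ _ _ → 1)
      ≤⟨ sum²-mono (one-arc D) ⟩
    sum² (λ u v → A u v + (A v u + deg u v))
      ≡⟨ trans (sum²-+ A (λ u v → A v u + deg u v)) (cong (sum² A +_)
           (trans (sum²-+ (λ u v → A v u) deg) (cong (_+ sum² deg) (sum-swap points points (λ u v → A v u))))) ⟩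
    sum² A + (sum² A + sum² deg)
      ≤⟨ +-mono-≤ arcs (ℕₚ.+-monoˡ-≤ (sum² deg) arcs) ⟩
    3 * length packing + (L + sum² deg) + (3 * length packing + (L + sum² deg) + sum² deg)
      ≡⟨ cong (λ g → 3 * length packing + (L + g) + (3 * length packing + (L + g) + g)) all-degenerate ⟩
    3 * length packing + (L + g) + (3 * length packing + (L + g) + g)
      ≡⟨ collect (length packing) L (size * 2 ^ r) ⟩
    6 * length packing + 2 * L + 9 * (size * 2 ^ r) ∎)
    where
    open ℕₚ.≤-Reasoning
    open RotationInvariant D points points-unique place place-injective (chosen? D)
      (chosen-rotate D) (chosen-unique D) (chosen-arc D) hiding (place)
    A deg : Point → Point → ℕ
    A u v = ⟦ arc D (place u) (place v) ⟧
    deg u v = degenerate (proj₁ u) (proj₁ v)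
    L = sum² (leftover D)
    g = 3 * (size * 2 ^ r)
    all-degenerate : sum² deg ≡ g
    all-degenerate = trans (sum²-classes degenerate) (trans (cong (_* (2 ^ r * 2 ^ r)) (sum-degenerate q))
      (identity q (2 ^ r)))
      where
      identity : ∀ q s → 3 * q * (s * s) ≡ 3 * (q * s * s)
      identity = solve-∀
    arcs : sum² A ≤ 3 * length packing + (L + sum² deg)
    arcs = ≤-trans (sum²-mono (arc-covered D)) (≤-trans
      (≤-reflexive (trans (sum²-+ (λ u v → sum points (λ w → ⟦ ⌊ chosen? D u v w ⌋ ⟧)) (λ u v → leftover D u v + deg u v))
        (cong (total (λ u v w → ⟦ ⌊ chosen? D u v w ⌋ ⟧) +_) (sum²-+ (leftover D) deg))))
      (ℕₚ.+-monoˡ-≤ _ packing-size))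
    collect : ∀ p l s → 3 * p + (l + 3 * s) + (3 * p + (l + 3 * s) + 3 * s) ≡ 6 * p + 2 * l + 9 * s
    collect = solve-∀

  -- The case of constant weight 1: distinct residues give disjoint fibres, and a pair outside all
  -- blocks contributes nothing.
  leftover-mean : ∀ u v → den r * sum (allTour n) (λ D → leftover D u v) ≤ num r * length (allTour n)
  leftover-mean (a , x) (b , y) with class? a b (third a b)
  ... | no _ = ≤-trans (≤-reflexive (trans (cong (den r *_) (sum-zero (allTour n))) (ℕₚ.*-zeroʳ (den r)))) z≤n
  ... | yes (class _ a≢b b≢c c≢a) = ≤-reflexive (begin
    den r * sum (allTour n) (λ D → ℓ D + 0)
      ≡⟨ cong (den r *_) (sum-cong (allTour n) (λ D → trans (ℕₚ.+-identityʳ _) (sym (ℕₚ.*-identityʳ _)))) ⟩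
    den r * sum (allTour n) (λ D → ℓ D * 1)
      ≡⟨ live-probability (fibre fits a) (fibre fits b) (fibre fits (third a b)) (λ _ → 1)
           (proper same same same (apart a≢b) (apart b≢c) (apart c≢a))
           (inv (λ _ _ _ → refl) (λ _ _ _ → refl) (λ _ _ _ → refl)) x y ⟩
    num r * sum (allTour n) (λ _ → 1)
      ≡⟨ cong (num r *_) (length-sum (allTour n)) ⟨
    num r * length (allTour n) ∎)
    where
    open ≡-Reasoning
    ℓ : Tour n → ℕ
    ℓ = liveAt (fibre fits a) (fibre fits b) (fibre fits (third a b)) x y
    same : ∀ {c : Fin q} {x y : Vec Bool r} → fibre fits c x ≡ fibre fits c y → x ≡ y
    same {c} {x} {y} e = proj₂ (fibre-injective fits c c x y e)
    apart : ∀ {c d : Fin q} → c ≢ d → ∀ x → Avoids (fibre {r = r} fits c x) (fibre {r = r} fits d)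
    apart {c} {d} c≢d x y e = c≢d (proj₁ (fibre-injective fits c d x y e))

  expected-leftover : ∀ K → K * num r ≤ den r →
    K * sum (allTour n) (λ D → sum² (leftover D)) ≤ size * size * length (allTour n)
  expected-leftover K small = ℕₚ.*-cancelˡ-≤ (den r) {{ℕ.>-nonZero (den-pos r)}} (begin
    den r * (K * E)
      ≡⟨ *-swap (den r) K E ⟩
    K * (den r * E)
      ≡⟨ cong (λ e → K * (den r * e)) exchange ⟩
    K * (den r * sum² (λ u v → sum (allTour n) (λ D → leftover D u v)))
      ≡⟨ cong (K *_) (trans (sym (sum-*ˡ points (den r) _)) (sum-cong points (λ u → sym (sum-*ˡ points (den r) _)))) ⟩
    K * sum² (λ u v → den r * sum (allTour n) (λ D → leftover D u v))
      ≤⟨ ℕₚ.*-monoʳ-≤ K (sum²-mono leftover-mean) ⟩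
    K * sum² (λ _ _ → num r * length (allTour n))
      ≡⟨ cong (K *_) (sum²-const _) ⟩
    K * (size * size * (num r * length (allTour n)))
      ≡⟨ regroup K (size * size) (num r) (length (allTour n)) ⟩
    K * num r * (size * size * length (allTour n))
      ≤⟨ ℕₚ.*-monoˡ-≤ (size * size * length (allTour n)) small ⟩
    den r * (size * size * length (allTour n)) ∎)
    where
    open ℕₚ.≤-Reasoning
    E = sum (allTour n) (λ D → sum² (leftover D))
    exchange : E ≡ sum² (λ u v → sum (allTour n) (λ D → leftover D u v))
    exchange = trans (sum-swap (allTour n) points _) (sum-cong points (λ u → sum-swap (allTour n) points _))
    regroup : ∀ a b c d → a * (b * (c * d)) ≡ a * c * (b * d)
    regroup = solve-∀

-- Quasirandomness from the number of quadrilaterals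

sq : ℕ → ℕ
sq a = a * a

sq-cancel-≤ : ∀ {a b} → sq a ≤ sq b → a ≤ b
sq-cancel-≤ {a} {b} le with a ℕ.≤? b
... | yes p = p
... | no ¬p = contradiction le (ℕₚ.<⇒≱ (ℕₚ.*-mono-< (ℕₚ.≰⇒> ¬p) (ℕₚ.≰⇒> ¬p)))

am-gm-≤ : ∀ {a b} → a ≤ b → 2 * (a * b) ≤ sq a + sq b
am-gm-≤ {a} {b} a≤b = subst (λ b → 2 * (a * b) ≤ sq a + sq b) (ℕₚ.m+[n∸m]≡n a≤b)
  (by-adding (z≤n {sq (b ∸ a)}) (identity a (b ∸ a)))
  where
  identity : ∀ a d → 2 * (a * (a + d)) + d * d ≡ a * a + (a + d) * (a + d) + 0
  identity = solve-∀

am-gm : ∀ a b → 2 * (a * b) ≤ sq a + sq b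
am-gm a b with ℕₚ.≤-total a b
... | inj₁ a≤b = am-gm-≤ a≤b
... | inj₂ b≤a = subst₂ _≤_ (cong (2 *_) (ℕₚ.*-comm b a)) (ℕₚ.+-comm (sq b) (sq a)) (am-gm-≤ b≤a)

cauchy-schwarz : ∀ {A : Set} (xs : List A) (f : A → ℕ) → sq (sum xs f) ≤ length xs * sum xs (λ x → sq (f x))
cauchy-schwarz xs f = ℕₚ.*-cancelˡ-≤ 2 (begin
  2 * sq (sum xs f)
    ≡⟨ cong (2 *_) (sum-product xs xs f f) ⟨
  2 * sum xs (λ x → sum xs (λ y → f x * f y))
    ≡⟨ sum-*ˡ xs 2 _ ⟨
  sum xs (λ x → 2 * sum xs (λ y → f x * f y))
    ≡⟨ sum-cong xs (λ x → sum-*ˡ xs 2 _) ⟨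
  sum xs (λ x → sum xs (λ y → 2 * (f x * f y)))
    ≤⟨ sum-mono xs (λ x → sum-mono xs (λ y → am-gm (f x) (f y))) ⟩
  sum xs (λ x → sum xs (λ y → sq (f x) + sq (f y)))
    ≡⟨ sum-cong xs (λ x → trans (sum-+ xs (λ _ → sq (f x)) (λ y → sq (f y))) (cong (_+ q) (sum-const xs (sq (f x))))) ⟩
  sum xs (λ x → length xs * sq (f x) + q)
    ≡⟨ trans (sum-+ xs (λ x → length xs * sq (f x)) (λ _ → q)) (cong₂ _+_ (sum-*ˡ xs (length xs) _) (sum-const xs q)) ⟩
  length xs * q + length xs * q
    ≡⟨ cong (length xs * q +_) (ℕₚ.+-identityʳ _) ⟨
  2 * (length xs * q) ∎)
  where
  open ℕₚ.≤-Reasoning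
  q = sum xs (λ x → sq (f x))

∣sum∣≤ : ∀ {A : Set} (xs : List A) (f : A → ℤ) → ∣ Int.sum xs f ∣ ≤ sum xs (λ x → ∣ f x ∣)
∣sum∣≤ []       f = z≤n
∣sum∣≤ (x ∷ xs) f = ≤-trans (ℤₚ.∣i+j∣≤∣i∣+∣j∣ (f x) _) (ℕₚ.+-monoʳ-≤ ∣ f x ∣ (∣sum∣≤ xs f))

∣_∣² : ℤ → ℕ
∣ i ∣² = sq ∣ i ∣

pos-∣∣² : ∀ i → pos ∣ i ∣² ≡ i ℤ.* i
pos-∣∣² (pos a)     = ℤₚ.pos-* a a
pos-∣∣² -[1+ a ]  = refl

∣⟦⟧*∣²≤ : ∀ b i → ∣ pos ⟦ b ⟧ ℤ.* i ∣² ≤ ∣ i ∣²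
∣⟦⟧*∣²≤ true  i = ≤-reflexive (cong ∣_∣² (ℤₚ.*-identityˡ i))
∣⟦⟧*∣²≤ false i = z≤n

cauchy-schwarz-ℤ : ∀ {A : Set} (xs : List A) (f : A → ℤ) →
                   ∣ Int.sum xs f ∣² ≤ length xs * sum xs (λ x → ∣ f x ∣²)
cauchy-schwarz-ℤ xs f = ≤-trans (*-mono-≤ (∣sum∣≤ xs f) (∣sum∣≤ xs f)) (cauchy-schwarz xs _)

i≡-1*i⇒∣i∣≡0 : ∀ i → i ≡ ℤ.-1ℤ ℤ.* i → ∣ i ∣ ≡ 0
i≡-1*i⇒∣i∣≡0 (pos zero)    e = refl
i≡-1*i⇒∣i∣≡0 (pos (suc a)) ()
i≡-1*i⇒∣i∣≡0 -[1+ a ]    ()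

-- Expected number of signed quadrilaterals

sign : ∀ {n} → Tour n → Fin n → Fin n → ℤ
sign D u v = pos ⟦ arc D u v ⟧ ℤ.- pos ⟦ arc D v u ⟧

sign-self : ∀ {n} (D : Tour n) u → sign D u u ≡ ℤ.0ℤ
sign-self D u = ℤₚ.+-inverseʳ (pos ⟦ arc D u u ⟧)

∣sign∣≤1 : ∀ {n} (D : Tour n) u v → ∣ sign D u v ∣ ≤ 1
∣sign∣≤1 D u v with arc D u v | arc D v u
... | true  | true  = z≤n
... | true  | false = ≤-refl
... | false | true  = ≤-refl
... | false | false = z≤n

sign-flip : ∀ {n} (u v : Fin n) D → sign (flip u v D) u v ≡ ℤ.-1ℤ ℤ.* sign D u v
sign-flip u v D with u Fin.≟ v
... | yes refl = trans (sign-self (flip u u D) u) (cong (ℤ.-1ℤ ℤ.*_) (sym (sign-self D u)))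
... | no u≢v rewrite arc-anti (flip u v D) u v u≢v | arc-flip u v D u≢v | arc-anti D u v u≢v with arc D u v
... | true  = refl
... | false = refl

sign-flip-≢ : ∀ {n} (u v u′ v′ : Fin n) D → ¬ (u ≡ u′ × v ≡ v′) → ¬ (u ≡ v′ × v ≡ u′) →
              sign (flip u v D) u′ v′ ≡ sign D u′ v′
sign-flip-≢ u v u′ v′ D p q = cong₂ (λ a b → pos ⟦ a ⟧ ℤ.- pos ⟦ b ⟧)
  (arc-flip-≢ u v u′ v′ D p q)
  (arc-flip-≢ u v v′ u′ D q p)

codegree : ∀ {n} → Tour n → Fin n → Fin n → ℤ
codegree D w w′ = Int.sum (fins _) (λ u → sign D u w ℤ.* sign D u w′)

-- Expanding the squares gives the sum of the signs of all closed walks w u w′ u′, degenerate ones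
-- included; quasirandomness means that it is of lower order than n⁴.
irregularity : ∀ {n} → Tour n → ℕ
irregularity D = sum (fins _) (λ w → sum (fins _) (λ w′ → ∣ codegree D w w′ ∣²))

quadrilateral : ∀ {n} → Fin n → Fin n → Fin n → Fin n → Tour n → ℤ
quadrilateral w w′ u u′ D = (sign D u w ℤ.* sign D u w′) ℤ.* (sign D u′ w ℤ.* sign D u′ w′)

∣quadrilateral∣≤1 : ∀ {n} (w w′ u u′ : Fin n) D → ∣ quadrilateral w w′ u u′ D ∣ ≤ 1
∣quadrilateral∣≤1 w w′ u u′ D = ≤-trans
  (≤-reflexive (trans (ℤₚ.∣i*j∣≡∣i∣*∣j∣ (sign D u w ℤ.* sign D u w′) _)
    (cong₂ _*_ (ℤₚ.∣i*j∣≡∣i∣*∣j∣ (sign D u w) _) (ℤₚ.∣i*j∣≡∣i∣*∣j∣ (sign D u′ w) _))))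
  (*-mono-≤ (*-mono-≤ (∣sign∣≤1 D u w) (∣sign∣≤1 D u w′)) (*-mono-≤ (∣sign∣≤1 D u′ w) (∣sign∣≤1 D u′ w′)))

-- The flip negates one of the four signs and leaves the others alone. The opposite sign could be
-- that of the same pair reversed only if u = w′, and then the product vanishes because the sign of
-- u, w′ does.
quadrilateral-flip : ∀ {n} (w w′ u u′ : Fin n) D → u ≢ u′ → w ≢ w′ →
  quadrilateral w w′ u u′ (flip u w D) ≡ ℤ.-1ℤ ℤ.* quadrilateral w w′ u u′ D
quadrilateral-flip w w′ u u′ D u≢u′ w≢w′ with u Fin.≟ w′
... | yes refl rewrite sign-self D u | sign-self (flip u w D) u
                     | ℤₚ.*-zeroʳ (sign (flip u w D) u w) | ℤₚ.*-zeroʳ (sign D u w) = refl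
... | no u≢w′ rewrite sign-flip u w D
                    | sign-flip-≢ u w u w′ D (λ (_ , e) → w≢w′ e) (λ (e , _) → u≢w′ e)
                    | sign-flip-≢ u w u′ w D (λ (e , _) → u≢u′ e) (λ (e , e′) → u≢u′ (trans e e′))
                    | sign-flip-≢ u w u′ w′ D (λ (e , _) → u≢u′ e) (λ (e , _) → u≢w′ e) =
  identity (sign D u w) (sign D u w′) (sign D u′ w) (sign D u′ w′)
  where
  identity : ∀ a b c d → ((ℤ.-1ℤ ℤ.* a) ℤ.* b) ℤ.* (c ℤ.* d) ≡ ℤ.-1ℤ ℤ.* ((a ℤ.* b) ℤ.* (c ℤ.* d))
  identity = ℤ-Solver.solve-∀

∣sum-quadrilateral∣≤ : ∀ {n} (w w′ u u′ : Fin n) →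
  ∣ Int.sum (allTour n) (quadrilateral w w′ u u′) ∣ ≤ length (allTour n)
∣sum-quadrilateral∣≤ {n} w w′ u u′ = ≤-trans (∣sum∣≤ (allTour n) (quadrilateral w w′ u u′)) (≤-trans
  (sum-mono (allTour n) (∣quadrilateral∣≤1 w w′ u u′)) (≤-reflexive (sym (length-sum (allTour n)))))

-- For u ≠ u′ and w ≠ w′ a flip carries the sum to its negative, so it vanishes; in the remaining
-- cases the trivial bound is used.
sum-quadrilateral : ∀ {n} (w w′ u u′ : Fin n) →
  ∣ Int.sum (allTour n) (quadrilateral w w′ u u′) ∣ ≤ (⟦ u == u′ ⟧ + ⟦ w == w′ ⟧) * length (allTour n)
sum-quadrilateral {n} w w′ u u′ with u Fin.≟ u′ | w Fin.≟ w′
... | no u≢u′ | no w≢w′ = ≤-reflexive (i≡-1*i⇒∣i∣≡0 _ (begin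
  Int.sum (allTour n) (quadrilateral w w′ u u′)
    ≡⟨ IntFlips.sum-flip u w (quadrilateral w w′ u u′) ⟨
  Int.sum (allTour n) (λ D → quadrilateral w w′ u u′ (flip u w D))
    ≡⟨ Int.sum-cong (allTour n) (λ D → quadrilateral-flip w w′ u u′ D u≢u′ w≢w′) ⟩
  Int.sum (allTour n) (λ D → ℤ.-1ℤ ℤ.* quadrilateral w w′ u u′ D)
    ≡⟨ Int.sum-*ˡ (allTour n) ℤ.-1ℤ (quadrilateral w w′ u u′) ⟩
  ℤ.-1ℤ ℤ.* Int.sum (allTour n) (quadrilateral w w′ u u′) ∎))
  where open ≡-Reasoning
... | yes _ | w=w′ = ≤-trans (∣sum-quadrilateral∣≤ w w′ u u′) (ℕₚ.m≤m+n _ _)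
... | no _ | yes _ = ≤-trans (∣sum-quadrilateral∣≤ w w′ u u′) (≤-reflexive (sym (ℕₚ.*-identityˡ _)))

-- Only quadruples with u = u′ or w = w′ contribute, and there are at most 2n³ of them.
expected-irregularity : ∀ n → sum (allTour n) irregularity ≤ 2 * (n * n * n) * length (allTour n)
expected-irregularity n = begin
  sum (allTour n) irregularity
    ≡⟨ trans (sum-swap (allTour n) (fins n) _) (sum-cong (fins n) (λ w → sum-swap (allTour n) (fins n) _)) ⟩
  sum (fins n) (λ w → sum (fins n) (λ w′ → sum (allTour n) (λ D → ∣ codegree D w w′ ∣²)))
    ≤⟨ sum-mono (fins n) (λ w → sum-mono (fins n) (λ w′ → term w w′)) ⟩
  sum (fins n) (λ w → sum (fins n) (λ w′ → sum (fins n) (λ u → sum (fins n) (λ u′ →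
    (⟦ u == u′ ⟧ + ⟦ w == w′ ⟧) * t))))
    ≡⟨ sum-cong (fins n) (λ w → sum-cong (fins n) (λ w′ → inner w w′)) ⟩
  sum (fins n) (λ w → sum (fins n) (λ w′ → n * t + ⟦ w == w′ ⟧ * (n * n * t)))
    ≡⟨ sum-cong (fins n) (λ w → trans (sum-+ (fins n) (λ _ → n * t) _)
         (cong₂ _+_ (sum-const-fins n (n * t)) (sum-point w (λ _ → n * n * t)))) ⟩
  sum (fins n) (λ w → n * (n * t) + n * n * t)
    ≡⟨ sum-const-fins n _ ⟩
  n * (n * (n * t) + n * n * t)
    ≡⟨ collect n t ⟩
  2 * (n * n * n) * t ∎
  where
  open ℕₚ.≤-Reasoning
  t = length (allTour n)
  collect : ∀ n t → n * (n * (n * t) + n * n * t) ≡ 2 * (n * n * n) * t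
  collect = solve-∀
  inner : ∀ w w′ → sum (fins n) (λ u → sum (fins n) (λ u′ → (⟦ u == u′ ⟧ + ⟦ w == w′ ⟧) * t)) ≡
          n * t + ⟦ w == w′ ⟧ * (n * n * t)
  inner w w′ = trans (sum-cong (fins n) (λ u → trans
      (sum-cong (fins n) (λ u′ → ℕₚ.*-distribʳ-+ t ⟦ u == u′ ⟧ ⟦ w == w′ ⟧))
      (trans (sum-+ (fins n) (λ u′ → ⟦ u == u′ ⟧ * t) (λ _ → ⟦ w == w′ ⟧ * t))
        (cong₂ _+_ (sum-point u (λ _ → t)) (sum-const-fins n (⟦ w == w′ ⟧ * t))))))
    (trans (sum-const-fins n _) (identity n t ⟦ w == w′ ⟧))
    where
    identity : ∀ n t b → n * (t + n * (b * t)) ≡ n * t + b * (n * n * t)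
    identity = solve-∀
  term : ∀ w w′ → sum (allTour n) (λ D → ∣ codegree D w w′ ∣²) ≤
         sum (fins n) (λ u → sum (fins n) (λ u′ → (⟦ u == u′ ⟧ + ⟦ w == w′ ⟧) * t))
  term w w′ = begin
    sum (allTour n) (λ D → ∣ codegree D w w′ ∣²)
      ≡⟨ cong ∣_∣ expand ⟩
    ∣ Int.sum (fins n) (λ u → Int.sum (fins n) (λ u′ → Int.sum (allTour n) (quadrilateral w w′ u u′))) ∣
      ≤⟨ ≤-trans (∣sum∣≤ (fins n) _) (sum-mono (fins n) (λ u → ∣sum∣≤ (fins n) _)) ⟩
    sum (fins n) (λ u → sum (fins n) (λ u′ → ∣ Int.sum (allTour n) (quadrilateral w w′ u u′) ∣))
      ≤⟨ sum-mono (fins n) (λ u → sum-mono (fins n) (λ u′ → sum-quadrilateral w w′ u u′)) ⟩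
    sum (fins n) (λ u → sum (fins n) (λ u′ → (⟦ u == u′ ⟧ + ⟦ w == w′ ⟧) * t)) ∎
    where
    expand : pos (sum (allTour n) (λ D → ∣ codegree D w w′ ∣²)) ≡
      Int.sum (fins n) (λ u → Int.sum (fins n) (λ u′ → Int.sum (allTour n) (quadrilateral w w′ u u′)))
    expand = trans (sum-ℤ (allTour n) _) (trans
      (Int.sum-cong (allTour n) (λ D → trans (pos-∣∣² (codegree D w w′))
        (sym (Int.sum-product (fins n) (fins n) (λ u → sign D u w ℤ.* sign D u w′) (λ u → sign D u w ℤ.* sign D u w′)))))
      (trans (Int.sum-swap (allTour n) (fins n) (λ D u → Int.sum (fins n) (λ u′ → quadrilateral w w′ u u′ D)))
        (Int.sum-cong (fins n) (λ u → Int.sum-swap (allTour n) (fins n) (λ D u′ → quadrilateral w w′ u u′ D)))))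

-- Discrepancy between two vertex sets

card : ∀ {n} → (Fin n → Bool) → ℕ
card U = sum (fins _) (λ u → ⟦ U u ⟧)

between : ∀ {n} → (Fin n → Fin n → ℕ) → (Fin n → Bool) → (Fin n → Bool) → ℕ
between f U W = sum (fins _) (λ u → ⟦ U u ⟧ * sum (fins _) (λ w → ⟦ W w ⟧ * f u w))

arcℕ : ∀ {n} → Tour n → Fin n → Fin n → ℕ
arcℕ D u w = ⟦ arc D u w ⟧

one-direction : ∀ {n} (D : Tour n) u w → arcℕ D u w + arcℕ D w u ≤ 1
one-direction D u w with u Fin.≟ w
... | yes refl rewrite arc-irrefl D u = z≤n
... | no u≢w rewrite arc-anti D u w u≢w = ≤-reflexive (⟦not⟧ (arc D u w))

between-+ : ∀ {n} (f g : Fin n → Fin n → ℕ) U W →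
            between (λ u w → f u w + g u w) U W ≡ between f U W + between g U W
between-+ {n} f g U W = trans
  (sum-cong (fins n) (λ u → trans (cong (⟦ U u ⟧ *_) (row u)) (ℕₚ.*-distribˡ-+ ⟦ U u ⟧ (S f u) (S g u))))
  (sum-+ (fins n) (λ u → ⟦ U u ⟧ * S f u) (λ u → ⟦ U u ⟧ * S g u))
  where
  S : (Fin n → Fin n → ℕ) → Fin n → ℕ
  S h u = sum (fins n) (λ w → ⟦ W w ⟧ * h u w)
  row : ∀ u → S (λ u w → f u w + g u w) u ≡ S f u + S g u
  row u = trans (sum-cong (fins n) (λ w → ℕₚ.*-distribˡ-+ ⟦ W w ⟧ (f u w) (g u w)))
    (sum-+ (fins n) (λ w → ⟦ W w ⟧ * f u w) (λ w → ⟦ W w ⟧ * g u w))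

between-mono : ∀ {n} {f g : Fin n → Fin n → ℕ} U W → (∀ u w → f u w ≤ g u w) → between f U W ≤ between g U W
between-mono U W h = sum-mono (fins _) (λ u → ℕₚ.*-monoʳ-≤ ⟦ U u ⟧ (sum-mono (fins _) (λ w → ℕₚ.*-monoʳ-≤ ⟦ W w ⟧ (h u w))))

between-one : ∀ {n} (U W : Fin n → Bool) → between (λ _ _ → 1) U W ≡ card U * card W
between-one {n} U W = trans
  (sum-cong (fins n) (λ u → cong (⟦ U u ⟧ *_) (sum-cong (fins n) (λ w → ℕₚ.*-identityʳ ⟦ W w ⟧))))
  (sum-*ʳ (fins n) (λ u → ⟦ U u ⟧) (card W))

module Discrepancy {n} (D : Tour n) (U W : Fin n → Bool) where

  row : Fin n → ℤ
  row u = Int.sum (fins n) (λ w → pos ⟦ W w ⟧ ℤ.* sign D u w)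

  excess : ℤ
  excess = Int.sum (fins n) (λ u → pos ⟦ U u ⟧ ℤ.* row u)

  rows : ℕ
  rows = sum (fins n) (λ u → ∣ row u ∣²)

  excess²≤ : ∣ excess ∣² ≤ n * rows
  excess²≤ = ≤-trans (cauchy-schwarz-ℤ (fins n) _) (≤-trans
    (≤-reflexive (cong (_* sum (fins n) (λ u → ∣ pos ⟦ U u ⟧ ℤ.* row u ∣²)) (length-fins n)))
    (ℕₚ.*-monoʳ-≤ n (sum-mono (fins n) (λ u → ∣⟦⟧*∣²≤ (U u) (row u)))))

  rows-codegree : pos rows ≡ Int.sum (fins n) (λ w → pos ⟦ W w ⟧ ℤ.* Int.sum (fins n) (λ w′ → pos ⟦ W w′ ⟧ ℤ.* codegree D w w′))
  rows-codegree = begin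
    pos rows
      ≡⟨ sum-ℤ (fins n) _ ⟩
    Int.sum (fins n) (λ u → pos ∣ row u ∣²)
      ≡⟨ Int.sum-cong (fins n) (λ u → trans (pos-∣∣² (row u)) (sym (Int.sum-product (fins n) (fins n) (a u) (a u)))) ⟩
    Int.sum (fins n) (λ u → Int.sum (fins n) (λ w → Int.sum (fins n) (λ w′ → a u w ℤ.* a u w′)))
      ≡⟨ Int.sum-swap (fins n) (fins n) (λ u w → Int.sum (fins n) (λ w′ → a u w ℤ.* a u w′)) ⟩
    Int.sum (fins n) (λ w → Int.sum (fins n) (λ u → Int.sum (fins n) (λ w′ → a u w ℤ.* a u w′)))
      ≡⟨ Int.sum-cong (fins n) (λ w → trans (Int.sum-swap (fins n) (fins n) (λ u w′ → a u w ℤ.* a u w′))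
           (trans (Int.sum-cong (fins n) (pull w)) (Int.sum-*ˡ (fins n) (pos ⟦ W w ⟧) _))) ⟩
    Int.sum (fins n) (λ w → pos ⟦ W w ⟧ ℤ.* Int.sum (fins n) (λ w′ → pos ⟦ W w′ ⟧ ℤ.* codegree D w w′)) ∎
    where
    open ≡-Reasoning
    a : Fin n → Fin n → ℤ
    a u w = pos ⟦ W w ⟧ ℤ.* sign D u w
    identity : ∀ p q s t → (p ℤ.* s) ℤ.* (q ℤ.* t) ≡ (p ℤ.* q) ℤ.* (s ℤ.* t)
    identity = ℤ-Solver.solve-∀
    pull : ∀ w w′ → Int.sum (fins n) (λ u → a u w ℤ.* a u w′) ≡ pos ⟦ W w ⟧ ℤ.* (pos ⟦ W w′ ⟧ ℤ.* codegree D w w′)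
    pull w w′ = trans (Int.sum-cong (fins n) (λ u → identity (pos ⟦ W w ⟧) (pos ⟦ W w′ ⟧) (sign D u w) (sign D u w′)))
      (trans (Int.sum-*ˡ (fins n) (pos ⟦ W w ⟧ ℤ.* pos ⟦ W w′ ⟧) _) (ℤₚ.*-assoc (pos ⟦ W w ⟧) (pos ⟦ W w′ ⟧) _))

  rows²≤ : sq rows ≤ n * n * irregularity D
  rows²≤ = begin
    sq rows
      ≡⟨ cong ∣_∣² rows-codegree ⟩
    ∣ Int.sum (fins n) (λ w → pos ⟦ W w ⟧ ℤ.* c w) ∣²
      ≤⟨ cauchy-schwarz-ℤ (fins n) _ ⟩
    length (fins n) * sum (fins n) (λ w → ∣ pos ⟦ W w ⟧ ℤ.* c w ∣²)
      ≡⟨ cong (_* sum (fins n) (λ w → ∣ pos ⟦ W w ⟧ ℤ.* c w ∣²)) (length-fins n) ⟩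
    n * sum (fins n) (λ w → ∣ pos ⟦ W w ⟧ ℤ.* c w ∣²)
      ≤⟨ ℕₚ.*-monoʳ-≤ n (sum-mono (fins n) (λ w → ≤-trans (∣⟦⟧*∣²≤ (W w) (c w)) (≤-trans (cauchy-schwarz-ℤ (fins n) _)
           (≤-reflexive (cong (_* sum (fins n) (λ w′ → ∣ pos ⟦ W w′ ⟧ ℤ.* codegree D w w′ ∣²)) (length-fins n)))))) ⟩
    n * sum (fins n) (λ w → n * sum (fins n) (λ w′ → ∣ pos ⟦ W w′ ⟧ ℤ.* codegree D w w′ ∣²))
      ≤⟨ ℕₚ.*-monoʳ-≤ n (sum-mono (fins n) (λ w → ℕₚ.*-monoʳ-≤ n
           (sum-mono (fins n) (λ w′ → ∣⟦⟧*∣²≤ (W w′) (codegree D w w′))))) ⟩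
    n * sum (fins n) (λ w → n * sum (fins n) (λ w′ → ∣ codegree D w w′ ∣²))
      ≡⟨ trans (cong (n *_) (sum-*ˡ (fins n) n _)) (sym (ℕₚ.*-assoc n n _)) ⟩
    n * n * irregularity D ∎
    where
    open ℕₚ.≤-Reasoning
    c : Fin n → ℤ
    c w = Int.sum (fins n) (λ w′ → pos ⟦ W w′ ⟧ ℤ.* codegree D w w′)

  -- Cauchy-Schwarz over u drops the indicator of `U`; Cauchy-Schwarz over w and w′ then drops that
  -- of `W`. The bound is thus uniform in both sets, at the price of a fourth power.
  excess⁴≤ : sq ∣ excess ∣² ≤ sq (n * n) * irregularity D
  excess⁴≤ = begin
    sq ∣ excess ∣²                         ≤⟨ *-mono-≤ excess²≤ excess²≤ ⟩
    sq (n * rows)                          ≡⟨ identity n rows ⟩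
    n * n * sq rows                        ≤⟨ ℕₚ.*-monoʳ-≤ (n * n) rows²≤ ⟩
    n * n * (n * n * irregularity D)       ≡⟨ ℕₚ.*-assoc (n * n) (n * n) _ ⟨
    sq (n * n) * irregularity D            ∎
    where
    open ℕₚ.≤-Reasoning
    identity : ∀ n r → n * r * (n * r) ≡ n * n * (r * r)
    identity = solve-∀

  reverse : Fin n → Fin n → ℕ
  reverse u w = arcℕ D w u

  excess-between : pos (between (arcℕ D) U W) ≡ pos (between reverse U W) ℤ.+ excess
  excess-between = begin
    pos (between (arcℕ D) U W)
      ≡⟨ sum-ℤ (fins n) _ ⟩
    Int.sum (fins n) (λ u → pos (⟦ U u ⟧ * sum (fins n) (λ w → ⟦ W w ⟧ * arcℕ D u w)))
      ≡⟨ Int.sum-cong (fins n) outer ⟩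
    Int.sum (fins n) (λ u → pos (⟦ U u ⟧ * sum (fins n) (λ w → ⟦ W w ⟧ * reverse u w)) ℤ.+ pos ⟦ U u ⟧ ℤ.* row u)
      ≡⟨ Int.sum-+ (fins n) _ _ ⟩
    Int.sum (fins n) (λ u → pos (⟦ U u ⟧ * sum (fins n) (λ w → ⟦ W w ⟧ * reverse u w))) ℤ.+ excess
      ≡⟨ cong (ℤ._+ excess) (sum-ℤ (fins n) _) ⟨
    pos (between reverse U W) ℤ.+ excess ∎
    where
    open ≡-Reasoning
    identity : ∀ p x y → p ℤ.* x ≡ p ℤ.* y ℤ.+ p ℤ.* (x ℤ.- y)
    identity = ℤ-Solver.solve-∀
    inner : ∀ u → pos (sum (fins n) (λ w → ⟦ W w ⟧ * arcℕ D u w)) ≡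
                  pos (sum (fins n) (λ w → ⟦ W w ⟧ * reverse u w)) ℤ.+ row u
    inner u = trans (sum-ℤ (fins n) _) (trans (Int.sum-cong (fins n) (λ w → trans (ℤₚ.pos-* ⟦ W w ⟧ _)
        (trans (identity (pos ⟦ W w ⟧) (pos (arcℕ D u w)) (pos (reverse u w)))
          (cong (ℤ._+ pos ⟦ W w ⟧ ℤ.* sign D u w) (sym (ℤₚ.pos-* ⟦ W w ⟧ (reverse u w)))))))
      (trans (Int.sum-+ (fins n) _ _) (cong (ℤ._+ row u) (sym (sum-ℤ (fins n) _)))))
    outer : ∀ u → pos (⟦ U u ⟧ * sum (fins n) (λ w → ⟦ W w ⟧ * arcℕ D u w)) ≡
      pos (⟦ U u ⟧ * sum (fins n) (λ w → ⟦ W w ⟧ * reverse u w)) ℤ.+ pos ⟦ U u ⟧ ℤ.* row u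
    outer u = trans (ℤₚ.pos-* ⟦ U u ⟧ _) (trans (cong (pos ⟦ U u ⟧ ℤ.*_) (inner u))
      (trans (ℤₚ.*-distribˡ-+ (pos ⟦ U u ⟧) (pos (sum (fins n) (λ w → ⟦ W w ⟧ * reverse u w))) (row u))
        (cong (ℤ._+ pos ⟦ U u ⟧ ℤ.* row u) (sym (ℤₚ.pos-* ⟦ U u ⟧ _)))))

  -- The two directions differ by `excess` and together have at most ∣U∣∣W∣ arcs.
  between≤ : 2 * between (arcℕ D) U W ≤ card U * card W + ∣ excess ∣
  between≤ = begin
    2 * e⁺               ≡⟨ cong (e⁺ +_) (ℕₚ.+-identityʳ e⁺) ⟩
    e⁺ + e⁺              ≤⟨ ℕₚ.+-monoʳ-≤ e⁺ (≤-trans (≤-reflexive (cong ∣_∣ excess-between)) (ℤₚ.∣i+j∣≤∣i∣+∣j∣ (pos e⁻) excess)) ⟩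
    e⁺ + (e⁻ + ∣ excess ∣) ≡⟨ ℕₚ.+-assoc e⁺ e⁻ _ ⟨
    e⁺ + e⁻ + ∣ excess ∣   ≡⟨ cong (_+ ∣ excess ∣) (between-+ (arcℕ D) reverse U W) ⟨
    between (λ u w → arcℕ D u w + reverse u w) U W + ∣ excess ∣
      ≤⟨ ℕₚ.+-monoˡ-≤ ∣ excess ∣ (≤-trans (between-mono U W (one-direction D)) (≤-reflexive (between-one U W))) ⟩
    card U * card W + ∣ excess ∣ ∎
    where
    open ℕₚ.≤-Reasoning
    e⁺ = between (arcℕ D) U W
    e⁻ = between reverse U W

discrepancy : ∀ {n} (D : Tour n) L → sq (sq L) * irregularity D ≤ sq (n * n) → ∀ U W →
              L * (2 * between (arcℕ D) U W) ≤ L * (card U * card W) + n * n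
discrepancy {n} D L regular U W = ≤-trans (ℕₚ.*-monoʳ-≤ L between≤)
  (≤-trans (≤-reflexive (ℕₚ.*-distribˡ-+ L _ _)) (ℕₚ.+-monoʳ-≤ (L * (card U * card W)) small))
  where
  open Discrepancy D U W
  small : L * ∣ excess ∣ ≤ n * n
  small = sq-cancel-≤ (sq-cancel-≤ (begin
    sq (sq (L * ∣ excess ∣))                  ≡⟨ identity L ∣ excess ∣ ⟩
    sq (sq L) * sq ∣ excess ∣²                ≤⟨ ℕₚ.*-monoʳ-≤ (sq (sq L)) excess⁴≤ ⟩
    sq (sq L) * (sq (n * n) * irregularity D) ≡⟨ *-swap (sq (sq L)) (sq (n * n)) _ ⟩
    sq (n * n) * (sq (sq L) * irregularity D) ≤⟨ ℕₚ.*-monoʳ-≤ (sq (n * n)) regular ⟩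
    sq (sq (n * n)) ∎))
    where
    open ℕₚ.≤-Reasoning
    identity : ∀ a b → (a * b * (a * b)) * (a * b * (a * b)) ≡ (a * a * (a * a)) * (b * b * (b * b))
    identity = solve-∀

-- Triangle-free subdigraphs of a quasirandom tournament

VertexSet : ℕ → Set
VertexSet n = Fin n → Bool

_⊑_ : ∀ {n} → VertexSet n → VertexSet n → Set
A ⊑ B = ∀ u → A u ≡ true → B u ≡ true

⊑-trans : ∀ {n} {A B C : VertexSet n} → A ⊑ B → B ⊑ C → A ⊑ C
⊑-trans p q u a = q u (p u a)

_∖_ : ∀ {n} → VertexSet n → VertexSet n → VertexSet n
(A ∖ B) u = A u ∧ not (B u)

∖-⊑ : ∀ {n} (A B : VertexSet n) → (A ∖ B) ⊑ A
∖-⊑ A B u p with A u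
... | true = refl

weight : ∀ {n} → VertexSet n → (Fin n → ℕ) → ℕ
weight U d = sum (fins _) (λ u → ⟦ U u ⟧ * d u)

weight-cong : ∀ {n} (U : VertexSet n) {d e : Fin n → ℕ} → (∀ u → d u ≡ e u) → weight U d ≡ weight U e
weight-cong {n} U h = sum-cong (fins n) (λ u → cong (⟦ U u ⟧ *_) (h u))

weight-+ : ∀ {n} (U : VertexSet n) (d e : Fin n → ℕ) → weight U (λ u → d u + e u) ≡ weight U d + weight U e
weight-+ {n} U d e = trans (sum-cong (fins n) (λ u → ℕₚ.*-distribˡ-+ ⟦ U u ⟧ (d u) (e u)))
  (sum-+ (fins n) (λ u → ⟦ U u ⟧ * d u) (λ u → ⟦ U u ⟧ * e u))

weight-1 : ∀ {n} (U : VertexSet n) → weight U (λ _ → 1) ≡ card U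
weight-1 {n} U = sum-cong (fins n) (λ u → ℕₚ.*-identityʳ ⟦ U u ⟧)

weight-split : ∀ {n} {U B : VertexSet n} → B ⊑ U → ∀ d → weight U d ≡ weight B d + weight (U ∖ B) d
weight-split {n} {U} {B} B⊑U d = trans (sum-cong (fins n) pointwise)
  (sum-+ (fins n) (λ u → ⟦ B u ⟧ * d u) (λ u → ⟦ (U ∖ B) u ⟧ * d u))
  where
  pointwise : ∀ u → ⟦ U u ⟧ * d u ≡ ⟦ B u ⟧ * d u + ⟦ (U ∖ B) u ⟧ * d u
  pointwise u with B u in e
  ... | false = cong (λ b → ⟦ b ⟧ * d u) (sym (Boolₚ.∧-identityʳ (U u)))
  ... | true rewrite B⊑U u e = sym (ℕₚ.+-identityʳ _)

card-split : ∀ {n} {U B : VertexSet n} → B ⊑ U → card U ≡ card B + card (U ∖ B)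
card-split {U = U} {B} p = trans (sym (weight-1 U)) (trans (weight-split p (λ _ → 1))
  (cong₂ _+_ (weight-1 B) (weight-1 (U ∖ B))))

card≤n : ∀ {n} (U : VertexSet n) → card U ≤ n
card≤n {n} U = ≤-trans (sum-mono (fins n) (λ u → ⟦⟧≤1 (U u)))
  (≤-reflexive (trans (sym (length-sum (fins n))) (length-fins n)))

between-transpose : ∀ {n} (f : Fin n → Fin n → ℕ) U W → between f U W ≡ between (λ u w → f w u) W U
between-transpose {n} f U W = begin
  sum (fins n) (λ u → ⟦ U u ⟧ * sum (fins n) (λ w → ⟦ W w ⟧ * f u w))
    ≡⟨ sum-cong (fins n) (λ u → sym (sum-*ˡ (fins n) ⟦ U u ⟧ _)) ⟩
  sum (fins n) (λ u → sum (fins n) (λ w → ⟦ U u ⟧ * (⟦ W w ⟧ * f u w)))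
    ≡⟨ sum-swap (fins n) (fins n) _ ⟩
  sum (fins n) (λ w → sum (fins n) (λ u → ⟦ U u ⟧ * (⟦ W w ⟧ * f u w)))
    ≡⟨ sum-cong (fins n) (λ w → trans (sum-cong (fins n) (λ u → *-swap ⟦ U u ⟧ ⟦ W w ⟧ (f u w))) (sum-*ˡ (fins n) ⟦ W w ⟧ _)) ⟩
  sum (fins n) (λ w → ⟦ W w ⟧ * sum (fins n) (λ u → ⟦ U u ⟧ * f u w)) ∎
  where
  open ≡-Reasoning

-- Multiplicities `μ` instead of a set allow an average over two sets that may overlap.
below-average : ∀ {n} (μ d : Fin n → ℕ) → 1 ≤ sum (fins n) μ →
  ∃ λ u → 1 ≤ μ u × sum (fins n) μ * d u ≤ sum (fins n) (λ u → μ u * d u)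
below-average {n} μ d nonzero with Finₚ.any? (λ u → (1 ℕ.≤? μ u) ×-dec (sum (fins n) μ * d u ℕ.≤? sum (fins n) (λ u → μ u * d u)))
... | yes p = p
... | no ¬p = contradiction (begin
    m * suc S                            ≡⟨ sum-*ʳ (fins n) μ (suc S) ⟨
    sum (fins n) (λ u → μ u * suc S)     ≤⟨ sum-mono (fins n) above ⟩
    sum (fins n) (λ u → m * (μ u * d u)) ≡⟨ sum-*ˡ (fins n) m _ ⟩
    m * S ∎)
  (ℕₚ.<⇒≱ (ℕₚ.*-monoʳ-< m {{ℕ.>-nonZero nonzero}} (ℕₚ.n<1+n S)))
  where
  open ℕₚ.≤-Reasoning
  m = sum (fins n) μ
  S = sum (fins n) (λ u → μ u * d u)
  above : ∀ u → μ u * suc S ≤ m * (μ u * d u)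
  above u with 1 ℕ.≤? μ u
  ... | no  μ≱1 rewrite ℕₚ.n<1⇒n≡0 (ℕₚ.≰⇒> μ≱1) = z≤n
  ... | yes μ≥1 = ≤-trans (ℕₚ.*-monoʳ-≤ (μ u) (ℕₚ.≰⇒> (λ le → ¬p (u , μ≥1 , le)))) (≤-reflexive (*-swap (μ u) m (d u)))

⟦⟧≥1 : ∀ {b} → 1 ≤ ⟦ b ⟧ → b ≡ true
⟦⟧≥1 {true} _ = refl

point-⊑ : ∀ {n} (U : VertexSet n) {u} → U u ≡ true → (u ==_) ⊑ U
point-⊑ U p v e = subst (λ v → U v ≡ true) (==⇒≡ e) p

weight-point : ∀ {n} (U : VertexSet n) {u} → U u ≡ true → ∀ d → weight U d ≡ d u + weight (U ∖ (u ==_)) d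
weight-point U {u} p d = trans (weight-split (point-⊑ U p) d) (cong (_+ weight (U ∖ (u ==_)) d) (sum-point u d))

card-point : ∀ {n} (U : VertexSet n) {u} → U u ≡ true → card U ≡ suc (card (U ∖ (u ==_)))
card-point U {u} p = trans (card-split (point-⊑ U p)) (cong (_+ card (U ∖ (u ==_))) (sum-==-fins u))

-- Discarding vertices of minimal weight one at a time does not decrease the average.
shrink : ∀ {n} (d : Fin n → ℕ) p k (U : VertexSet n) → card U ≡ p + k →
         ∃ λ U′ → U′ ⊑ U × card U′ ≡ p × p * weight U d ≤ (p + k) * weight U′ d
shrink d p zero U e = U , (λ _ a → a) , trans e (ℕₚ.+-identityʳ p) ,
  ≤-reflexive (cong (_* weight U d) (sym (ℕₚ.+-identityʳ p)))
shrink d zero (suc k) U e with shrink d zero k (U ∖ (u ==_)) (ℕₚ.suc-injective (trans (sym (card-point U u∈U)) e))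
  where
  avg = below-average (λ u → ⟦ U u ⟧) d (≤-trans (s≤s z≤n) (≤-reflexive (sym e)))
  u = proj₁ avg
  u∈U = ⟦⟧≥1 (proj₁ (proj₂ avg))
... | U′ , sub , c , _ = U′ , ⊑-trans sub (∖-⊑ U _) , c , z≤n
shrink d p@(suc p′) (suc k) U e = go (shrink d p k U₁ (ℕₚ.suc-injective (trans (sym (card-point U u∈U)) (trans e (ℕₚ.+-suc p k)))))
  where
  avg = below-average (λ u → ⟦ U u ⟧) d (≤-trans (s≤s z≤n) (≤-reflexive (sym e)))
  u = proj₁ avg
  u∈U = ⟦⟧≥1 (proj₁ (proj₂ avg))
  U₁ = U ∖ (u ==_)
  m = p + k
  light : suc m * d u ≤ d u + weight U₁ d
  light = subst₂ (λ a b → a * d u ≤ b) (trans e (ℕₚ.+-suc p k)) (weight-point U u∈U d) (proj₂ (proj₂ avg))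
  go : (∃ λ U′ → U′ ⊑ U₁ × card U′ ≡ p × p * weight U₁ d ≤ m * weight U′ d) →
       ∃ λ U′ → U′ ⊑ U × card U′ ≡ p × p * weight U d ≤ (p + suc k) * weight U′ d
  go (U′ , sub , c , dense) = U′ , ⊑-trans sub (∖-⊑ U _) , c , ℕₚ.*-cancelˡ-≤ m (begin
    m * (p * weight U d)             ≡⟨ cong (λ x → m * (p * x)) (weight-point U u∈U d) ⟩
    m * (p * (d u + weight U₁ d))    ≤⟨ by-adding (ℕₚ.*-monoʳ-≤ p light) (one m p (d u) (weight U₁ d)) ⟩
    suc m * (p * weight U₁ d)        ≤⟨ ℕₚ.*-monoʳ-≤ (suc m) dense ⟩
    suc m * (m * weight U′ d)        ≡⟨ two m (weight U′ d) ⟩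
    m * (suc m * weight U′ d)        ≡⟨ cong (λ x → m * (x * weight U′ d)) (ℕₚ.+-suc p k) ⟨
    m * ((p + suc k) * weight U′ d)  ∎)
    where
    open ℕₚ.≤-Reasoning
    one : ∀ m p x y → m * (p * (x + y)) + p * (x + y) ≡ suc m * (p * y) + p * (suc m * x)
    one = solve-∀
    two : ∀ m x → suc m * (m * x) ≡ m * (suc m * x)
    two = solve-∀

subset-of-size : ∀ {n} (U : VertexSet n) p → p ≤ card U → ∃ λ U′ → U′ ⊑ U × card U′ ≡ p
subset-of-size U p le with shrink (λ _ → 0) p (card U ∸ p) U (sym (ℕₚ.m+[n∸m]≡n le))
... | U′ , sub , c , _ = U′ , sub , c

-- Exhaustive search over all vertex sets makes the existence of a hole decidable. Sets are
-- functions here, so the predicate has to respect pointwise equality.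
anySet? : ∀ {n} {P : VertexSet n → Set} → (∀ A → Dec (P A)) → (∀ {A B} → (∀ u → A u ≡ B u) → P A → P B) → Dec (∃ P)
anySet? P? ext = map′ (λ (S , p) → lookup S , p)
  (λ (A , p) → tabulate A , ext (λ u → sym (Vecₚ.lookup∘tabulate A u)) p)
  (anySubset? (λ S → P? (lookup S)))

_⊑?_ : ∀ {n} (A B : VertexSet n) → Dec (A ⊑ B)
A ⊑? B = Finₚ.all? (λ u → (A u Boolₚ.≟ true) →-dec (B u Boolₚ.≟ true))

-- The density increment argument.  F is the oriented graph left after deleting a transversal.
module TriangleFree {n} (F : Fin n → Fin n → Bool) (r q M : ℕ) (2≤r : 2 ≤ r) (1≤q : 1 ≤ q) (q≤n : q ≤ n)
  (no-triangle : ∀ {u v w} → F u v ≡ true → F v w ≡ true → F w u ≡ true → ⊥)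
  (oriented : ∀ u w → ⟦ F u w ⟧ + ⟦ F w u ⟧ ≤ 1)
  (quasirandom : ∀ U W → M * (2 * between (λ u w → ⟦ F u w ⟧) U W) ≤ M * (card U * card W) + q * q) where

  f g : Fin n → Fin n → ℕ
  f u w = ⟦ F u w ⟧
  g u w = f u w + f w u

  g-sym : ∀ u w → g u w ≡ g w u
  g-sym u w = ℕₚ.+-comm (f u w) (f w u)

  g-irrefl : ∀ u → g u u ≡ 0
  g-irrefl u with F u u | oriented u u
  ... | false | _ = refl
  ... | true  | s≤s ()

  between-sym : ∀ U W → between g U W ≡ between g W U
  between-sym U W = trans (between-transpose g U W)
    (weight-cong W (λ w → weight-cong U (λ u → g-sym u w)))

  between-g : ∀ U W → between g U W ≡ between f U W + between f W U
  between-g U W = trans (between-+ f (λ u w → f w u) U W) (cong (between f U W +_) (between-transpose (λ u w → f w u) U W))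

  between-g≤ : ∀ U W → between g U W ≤ card U * card W
  between-g≤ U W = ≤-trans (between-mono U W oriented) (≤-reflexive (between-one U W))

  shrink-left : ∀ a b h X Y → 1 ≤ h → h ≤ card X → a * (card X * card Y) ≤ b * between g X Y →
    ∃ λ X′ → X′ ⊑ X × card X′ ≡ h × a * (h * card Y) ≤ b * between g X′ Y
  shrink-left a b h X Y 1≤h le dense
    with shrink (λ u → weight Y (g u)) h (card X ∸ h) X (sym (ℕₚ.m+[n∸m]≡n le))
  ... | X′ , sub , c , avg = X′ , sub , c , ℕₚ.*-cancelˡ-≤ (card X) {{ℕ.>-nonZero (≤-trans 1≤h le)}} (begin
    card X * (a * (h * card Y))   ≡⟨ one (card X) a h (card Y) ⟩
    h * (a * (card X * card Y))   ≤⟨ ℕₚ.*-monoʳ-≤ h dense ⟩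
    h * (b * between g X Y)       ≡⟨ *-swap h b (between g X Y) ⟩
    b * (h * between g X Y)       ≤⟨ ℕₚ.*-monoʳ-≤ b avg ⟩
    b * ((h + (card X ∸ h)) * between g X′ Y) ≡⟨ cong (λ x → b * (x * between g X′ Y)) (ℕₚ.m+[n∸m]≡n le) ⟩
    b * (card X * between g X′ Y) ≡⟨ *-swap b (card X) _ ⟩
    card X * (b * between g X′ Y) ∎)
    where
    open ℕₚ.≤-Reasoning
    one : ∀ x a h y → x * (a * (h * y)) ≡ h * (a * (x * y))
    one = solve-∀

  -- A density of at least a/b survives cutting both sides down to size `h`; the second cut is the
  -- first with the sides exchanged.
  shrink-both : ∀ a b h X Y → 1 ≤ h → h ≤ card X → h ≤ card Y → a * (card X * card Y) ≤ b * between g X Y →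
    ∃ λ X′ → ∃ λ Y′ → X′ ⊑ X × Y′ ⊑ Y × card X′ ≡ h × card Y′ ≡ h × a * (h * h) ≤ b * between g X′ Y′
  shrink-both a b h X Y 1≤h le le′ dense =
    let X′ , sub , c , dense₁ = shrink-left a b h X Y 1≤h le dense
        Y′ , sub′ , c′ , dense₂ = shrink-left a b h Y X′ 1≤h le′ (exchange X′ c dense₁)
    in X′ , Y′ , sub , sub′ , c , c′ , exchange′ X′ Y′ c dense₂
    where
    exchange : ∀ X′ → card X′ ≡ h → a * (h * card Y) ≤ b * between g X′ Y →
               a * (card Y * card X′) ≤ b * between g Y X′
    exchange X′ c dense′ = begin
      a * (card Y * card X′) ≡⟨ cong (a *_) (ℕₚ.*-comm (card Y) (card X′)) ⟩
      a * (card X′ * card Y) ≡⟨ cong (λ x → a * (x * card Y)) c ⟩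
      a * (h * card Y)       ≤⟨ dense′ ⟩
      b * between g X′ Y     ≡⟨ cong (b *_) (between-sym X′ Y) ⟩
      b * between g Y X′     ∎
      where open ℕₚ.≤-Reasoning
    exchange′ : ∀ X′ Y′ → card X′ ≡ h → a * (h * card X′) ≤ b * between g Y′ X′ →
                a * (h * h) ≤ b * between g X′ Y′
    exchange′ X′ Y′ c dense′ = begin
      a * (h * h)        ≡⟨ cong (λ x → a * (h * x)) c ⟨
      a * (h * card X′)  ≤⟨ dense′ ⟩
      b * between g Y′ X′ ≡⟨ cong (b *_) (between-sym Y′ X′) ⟩
      b * between g X′ Y′ ∎
      where open ℕₚ.≤-Reasoning

  -- Either direction counts: a vertex sending to `W` and receiving from `U` forbids arcs one way, a
  -- vertex sending to `U` and receiving from `W` the other way.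
  record Hole (h : ℕ) (U W A B : VertexSet n) : Set where
    constructor hole
    field
      A⊑W   : A ⊑ W
      B⊑U   : B ⊑ U
      cardA : card A ≡ h
      cardB : card B ≡ h
      empty : between f A B ≡ 0 ⊎ between f B A ≡ 0

  hole-cong : ∀ {h U W A A′ B B′} → (∀ u → A u ≡ A′ u) → (∀ u → B u ≡ B′ u) → Hole h U W A B → Hole h U W A′ B′
  hole-cong {A = A} {A′} {B} {B′} a b (hole p q c d e) = hole
    (λ u x → p u (trans (a u) x)) (λ u x → q u (trans (b u) x))
    (trans (sym (card-cong a)) c) (trans (sym (card-cong b)) d)
    (Data.Sum.map (trans (sym (between-cong a b))) (trans (sym (between-cong b a))) e)
    where
    card-cong : ∀ {A A′ : VertexSet n} → (∀ u → A u ≡ A′ u) → card A ≡ card A′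
    card-cong a = sum-cong (fins n) (λ u → cong ⟦_⟧ (a u))
    between-cong : ∀ {A A′ B B′ : VertexSet n} → (∀ u → A u ≡ A′ u) → (∀ u → B u ≡ B′ u) → between f A B ≡ between f A′ B′
    between-cong a b = sum-cong (fins n) (λ u → cong₂ (λ x y → ⟦ x ⟧ * y) (a u)
      (sum-cong (fins n) (λ w → cong (λ x → ⟦ x ⟧ * f u w) (b w))))

  hole? : ∀ h U W → Dec (∃ λ A → ∃ λ B → Hole h U W A B)
  hole? h U W = anySet? (λ A → anySet? (dec A) (hole-cong {U = U} {W} {A} (λ _ → refl)))
    (λ a (B , x) → B , hole-cong {U = U} {W} {B = B} a (λ _ → refl) x)
    where
    dec : ∀ A B → Dec (Hole h U W A B)
    dec A B = map′ (λ (a , b , c , d , e) → hole a b c d e) (λ (hole a b c d e) → a , b , c , d , e)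
      (A ⊑? W ×-dec B ⊑? U ×-dec card A ℕ.≟ h ×-dec card B ℕ.≟ h ×-dec
       (between f A B ℕ.≟ 0 ⊎-dec between f B A ℕ.≟ 0))

  -- Holes are tested at the fraction 1/r of both sets; `h` is thus the threshold below which a
  -- degree into the pair counts as small.
  record JoinedPair (V : VertexSet n) : Set where
    constructor joined
    field
      {h}     : ℕ
      {U W}   : VertexSet n
      q≤h     : q ≤ h
      U⊑V     : U ⊑ V
      W⊑V     : W ⊑ V
      cardU   : card U ≡ r * h
      cardW   : card W ≡ r * h
      no-hole : ¬ (∃ λ A → ∃ λ B → Hole h U W A B)

  -- One factor r is spent per hole. At the final size q the error in `quasirandom` is still only
  -- one M-th of the rectangle.
  size : ℕ → ℕ
  size zero    = q
  size (suc j) = r * size j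

  q≤size : ∀ j → q ≤ size j
  q≤size zero    = ≤-refl
  q≤size (suc j) = ≤-trans (q≤size j) (≤-trans (≤-reflexive (sym (ℕₚ.*-identityˡ _)))
    (ℕₚ.*-monoˡ-≤ (size j) (≤-trans (s≤s z≤n) 2≤r)))

  -- One direction is empty, and quasirandomness allows the other at most about half of the pairs;
  -- the error q² is absorbed because q ≤ h.
  hole-sparse : ∀ {h U W A B} → q ≤ h → Hole h U W A B → 2 * M * between g B A ≤ (M + 1) * (h * h)
  hole-sparse {h} {A = A} {B} q≤h (hole _ _ cA cB e) = begin
    2 * M * between g B A           ≡⟨ one M (between g B A) ⟩
    M * (2 * between g B A)         ≡⟨ cong (λ x → M * (2 * x)) (between-g B A) ⟩
    M * (2 * (between f B A + between f A B)) ≤⟨ bound e ⟩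
    M * (h * h) + q * q             ≤⟨ ℕₚ.+-monoʳ-≤ (M * (h * h)) (*-mono-≤ q≤h q≤h) ⟩
    M * (h * h) + h * h             ≡⟨ two M (h * h) ⟩
    (M + 1) * (h * h)               ∎
    where
    open ℕₚ.≤-Reasoning
    one : ∀ M x → 2 * M * x ≡ M * (2 * x)
    one = solve-∀
    two : ∀ M x → M * x + x ≡ (M + 1) * x
    two = solve-∀
    bound : between f A B ≡ 0 ⊎ between f B A ≡ 0 → M * (2 * (between f B A + between f A B)) ≤ M * (h * h) + q * q
    bound (inj₁ z) rewrite z | ℕₚ.+-identityʳ (between f B A) =
      subst₂ (λ x y → M * (2 * between f B A) ≤ M * (x * y) + q * q) cB cA (quasirandom B A)
    bound (inj₂ z) rewrite z =
      subst₂ (λ x y → M * (2 * between f A B) ≤ M * (x * y) + q * q) cA cB (quasirandom A B)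

  -- A hole costs density, so another rectangle of the pair has larger density; after at most
  -- M steps the density would exceed 1.
  find-joined : ∀ j c {V} U W → U ⊑ V → W ⊑ V → card U ≡ size j → card W ≡ size j →
    r * r ≤ c → M < c + j → (M + c) * (size j * size j) ≤ 2 * M * between g U W → JoinedPair V
  -- The density (M + c)/(2M) is claimed with c > M, so it exceeds 1.
  find-joined zero c U W _ _ cU cW _ M<c dense = contradiction dense (ℕₚ.<⇒≱ (begin-strict
    2 * M * between g U W     ≤⟨ ℕₚ.*-monoʳ-≤ (2 * M) (between-g≤ U W) ⟩
    2 * M * (card U * card W) ≡⟨ cong₂ (λ x y → 2 * M * (x * y)) cU cW ⟩
    2 * M * (q * q)           <⟨ ℕₚ.*-monoˡ-< (q * q) {{ℕ.>-nonZero (*-mono-≤ 1≤q 1≤q)}} 2M<M+c ⟩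
    (M + c) * (q * q)         ∎))
    where
    open ℕₚ.≤-Reasoning
    2M<M+c : 2 * M < M + c
    2M<M+c = ≤-trans (≤-reflexive (cong (λ x → suc (M + x)) (ℕₚ.+-identityʳ M)))
      (≤-trans (≤-reflexive (sym (ℕₚ.+-suc M M))) (ℕₚ.+-monoʳ-≤ M (subst (M <_) (ℕₚ.+-identityʳ c) M<c)))
  find-joined (suc j) c {V} U W U⊑V W⊑V cU cW r²≤c M<c dense with hole? (size j) U W
  ... | no none = joined (q≤size j) U⊑V W⊑V cU cW none
  ... | yes (A , B , ho@(hole A⊑W B⊑U cA cB _)) = rectangles
          ((M + suc c) * (card B * card (W ∖ A)) ℕ.≤? 2 * M * between g B (W ∖ A))
          ((M + suc c) * (card (U ∖ B) * card W) ℕ.≤? 2 * M * between g (U ∖ B) W)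
    where
    h = size j
    t = r * h
    1≤h : 1 ≤ h
    1≤h = ≤-trans 1≤q (q≤size j)
    h+h≤t : h + h ≤ t
    h+h≤t = ≤-trans (≤-reflexive (cong (h +_) (sym (ℕₚ.+-identityʳ h)))) (ℕₚ.*-monoˡ-≤ h 2≤r)
    rest : ∀ {X Y : VertexSet n} → Y ⊑ X → card X ≡ t → card Y ≡ h → card (X ∖ Y) ≡ t ∸ h
    rest {X} {Y} sub cX cY = trans (sym (ℕₚ.m+n∸m≡n h _)) (cong (_∸ h)
      (trans (cong (_+ card (X ∖ Y)) (sym cY)) (trans (sym (card-split sub)) cX)))
    h≤t : h ≤ t
    h≤t = ≤-trans (ℕₚ.m≤m+n h h) h+h≤t
    h≤e : h ≤ t ∸ h
    h≤e = ≤-trans (≤-reflexive (sym (ℕₚ.m+n∸m≡n h h))) (ℕₚ.∸-monoˡ-≤ h h+h≤t)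
    recurse : ∀ X Y → X ⊑ U → Y ⊑ W → h ≤ card X → h ≤ card Y →
      (M + suc c) * (card X * card Y) ≤ 2 * M * between g X Y → JoinedPair V
    recurse X Y sX sY hX hY dense′ =
      let X′ , Y′ , sX′ , sY′ , cX , cY , dense″ = shrink-both (M + suc c) (2 * M) h X Y 1≤h hX hY dense′
      in find-joined j (suc c) X′ Y′
      (⊑-trans sX′ (⊑-trans sX U⊑V)) (⊑-trans sY′ (⊑-trans sY W⊑V)) cX cY
      (ℕₚ.m≤n⇒m≤1+n r²≤c) (subst (M <_) (ℕₚ.+-suc c j) M<c) dense″
    rectangles : Dec _ → Dec _ → JoinedPair V
    rectangles (yes p) _ = recurse B (W ∖ A) B⊑U (∖-⊑ W A) (≤-reflexive (sym cB))
      (≤-trans h≤e (≤-reflexive (sym (rest A⊑W cW cA)))) p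
    rectangles _ (yes p) = recurse (U ∖ B) W (∖-⊑ U B) (λ _ x → x)
      (≤-trans h≤e (≤-reflexive (sym (rest B⊑U cU cB)))) (≤-trans h≤t (≤-reflexive (sym cW))) p
    -- The hole and the two rectangles tile `U` × `W`. With the hole at density (M + 1)/(2M) at most
    -- and both rectangles below (M + c + 1)/(2M), the total times 2M stays below (M + c + 1)t² -
    -- ch². This is at most (M + c)t² because r² ≤ c, against the density assumed.
    rectangles (no ¬p) (no ¬p′) = contradiction total (ℕₚ.<⇒≱ (s≤s z≤n))
      where
      open ℕₚ.≤-Reasoning
      e = t ∸ h
      w₀ = between g B A
      w₁ = between g B (W ∖ A)
      w₂ = between g (U ∖ B) W
      split : between g U W ≡ w₀ + w₁ + w₂
      split = trans (weight-split B⊑U (λ u → weight W (g u))) (cong (_+ w₂)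
        (trans (between-sym B W) (trans (weight-split A⊑W (λ w → weight B (g w)))
          (cong₂ _+_ (between-sym A B) (between-sym (W ∖ A) B)))))
      less₁ : suc (2 * M * w₁) ≤ (M + suc c) * (h * e)
      less₁ = subst₂ (λ x y → suc (2 * M * w₁) ≤ (M + suc c) * (x * y)) cB (rest A⊑W cW cA) (ℕₚ.≰⇒> ¬p)
      less₂ : suc (2 * M * w₂) ≤ (M + suc c) * (e * t)
      less₂ = subst₂ (λ x y → suc (2 * M * w₂) ≤ (M + suc c) * (x * y)) (rest B⊑U cU cB) cW (ℕₚ.≰⇒> ¬p′)
      t²≤ch² : t * t ≤ c * (h * h)
      t²≤ch² = ≤-trans (≤-reflexive (identity r h)) (ℕₚ.*-monoˡ-≤ (h * h) r²≤c)
        where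
        identity : ∀ r h → r * h * (r * h) ≡ r * r * (h * h)
        identity = solve-∀
      combine : ∀ M c h e t w₀ w₁ w₂ → t ≡ h + e →
        2 + ((M + 1) * (h * h) + ((M + suc c) * (h * e) + ((M + suc c) * (e * t) +
          (c * (h * h) + 2 * M * (w₀ + w₁ + w₂))))) ≡
        0 + (2 * M * w₀ + (suc (2 * M * w₁) + (suc (2 * M * w₂) + (t * t + (M + c) * (t * t)))))
      combine M c h e _ w₀ w₁ w₂ refl = identity M c h e w₀ w₁ w₂
        where
        identity : ∀ M c h e w₀ w₁ w₂ →
          2 + ((M + 1) * (h * h) + ((M + suc c) * (h * e) + ((M + suc c) * (e * (h + e)) +
            (c * (h * h) + 2 * M * (w₀ + w₁ + w₂))))) ≡
          0 + (2 * M * w₀ + (suc (2 * M * w₁) + (suc (2 * M * w₂) + ((h + e) * (h + e) + (M + c) * ((h + e) * (h + e))))))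
        identity = solve-∀
      total : 2 ≤ 0
      total = by-adding
        (+-mono-≤ (hole-sparse (q≤size j) ho) (+-mono-≤ less₁ (+-mono-≤ less₂ (+-mono-≤ t²≤ch²
          (subst (λ x → (M + c) * (t * t) ≤ 2 * M * x) split dense)))))
        (combine M c h e t w₀ w₁ w₂ (sym (ℕₚ.m+[n∸m]≡n h≤t)))

  -- Degrees into a pair without holes

  between-empty : ∀ A B → (∀ u w → A u ≡ true → B w ≡ true → F u w ≡ true → ⊥) → between f A B ≡ 0
  between-empty A B none = trans (sum-cong (fins n) outer) (sum-zero (fins n))
    where
    inner : ∀ u → A u ≡ true → ∀ w → ⟦ B w ⟧ * f u w ≡ 0
    inner u a w with B w in b | F u w in e
    ... | true  | true  = ⊥-elim (none u w a b e)
    ... | true  | false = refl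
    ... | false | _     = refl
    outer : ∀ u → ⟦ A u ⟧ * weight B (f u) ≡ 0
    outer u with A u in a
    ... | false = refl
    ... | true  = trans (ℕₚ.+-identityʳ _) (trans (sum-cong (fins n) (inner u a)) (sum-zero (fins n)))

  out into : VertexSet n → Fin n → ℕ
  out  X z = weight X (λ x → f z x)
  into X z = weight X (λ x → f x z)

  degree-split : ∀ X z → weight X (g z) ≡ out X z + into X z
  degree-split X z = weight-+ X (f z) (λ x → f x z)

  module Pair {V : VertexSet n} (J : JoinedPair V) (1≤M : 1 ≤ M) where
    open JoinedPair J

    neighbours : (p : Fin n → Bool) (X : VertexSet n) → h ≤ weight X (λ x → ⟦ p x ⟧) →
                 ∃ λ A → A ⊑ X × card A ≡ h × (∀ x → A x ≡ true → p x ≡ true)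
    neighbours p X le =
      let A , sub , c = subset-of-size (λ x → X x ∧ p x) h (≤-trans le (≤-reflexive
            (sum-cong (fins n) (λ x → sym (⟦∧⟧ (X x) (p x))))))
      in A , ⊑-trans sub (λ x → left (X x)) , c , λ x a → right (X x) (sub x a)
      where
      left : ∀ a {b} → a ∧ b ≡ true → a ≡ true
      left true _ = refl
      right : ∀ a {b} → a ∧ b ≡ true → b ≡ true
      right true e = e

    -- An arc from an out-neighbour of z to an in-neighbour of z would close a directed triangle.
    out-into : ∀ X Y z → h ≤ out X z → h ≤ into Y z →
      ∃ λ A → ∃ λ B → A ⊑ X × B ⊑ Y × card A ≡ h × card B ≡ h × between f A B ≡ 0
    out-into X Y z p p′ =
      let A , sA , cA , toA   = neighbours (λ x → F z x) X p
          B , sB , cB , fromB = neighbours (λ x → F x z) Y p′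
      in A , B , sA , sB , cA , cB , between-empty A B (λ a b a∈A b∈B e → no-triangle e (fromB b b∈B) (toA a a∈A))

    out-W : ∀ {z} → ¬ (out W z < h) → into U z < h
    out-W {z} p with into U z ℕ.<? h
    ... | yes lt = lt
    ... | no  p′ = let A , B , sA , sB , cA , cB , e = out-into W U z (ℕₚ.≮⇒≥ p) (ℕₚ.≮⇒≥ p′) in
      ⊥-elim (no-hole (A , B , hole sA sB cA cB (inj₁ e)))

    out-U : ∀ {z} → ¬ (out U z < h) → into W z < h
    out-U {z} p with into W z ℕ.<? h
    ... | yes lt = lt
    ... | no  p′ = let B , A , sB , sA , cB , cA , e = out-into U W z (ℕₚ.≮⇒≥ p) (ℕₚ.≮⇒≥ p′) in
      ⊥-elim (no-hole (A , B , hole sA sB cA cB (inj₂ e)))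

    -- Every kind leaves about half of the 2rh possible adjacencies: in the first two a single
    -- direction remains, which quasirandomness halves on average, and in the last two a single set.
    data Kind (z : Fin n) : Set where
      few-out  : out W z < h → out U z < h → Kind z
      few-into : into W z < h → into U z < h → Kind z
      few-W    : out W z < h → into W z < h → Kind z
      few-U    : out U z < h → into U z < h → Kind z

    kind : ∀ z → Kind z
    kind z with out W z ℕ.<? h | out U z ℕ.<? h
    ... | yes p | yes p′ = few-out p p′
    ... | yes p | no  p′ = few-W p (out-U p′)
    ... | no  p | yes p′ = few-U p′ (out-W p)
    ... | no  p | no  p′ = few-into (out-U p′) (out-W p)

    is-out is-into is-mixed : ∀ {z} → Kind z → Bool
    is-out (few-out _ _) = true
    is-out _             = false
    is-into (few-into _ _) = true
    is-into _              = false
    is-mixed (few-W _ _) = true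
    is-mixed (few-U _ _) = true
    is-mixed _           = false

    Z₁ Z₂ Z₃ : VertexSet n
    Z₁ z = V z ∧ is-out (kind z)
    Z₂ z = V z ∧ is-into (kind z)
    Z₃ z = V z ∧ is-mixed (kind z)

    kinds : card Z₁ + (card Z₂ + card Z₃) ≡ card V
    kinds = sym (trans (sum-cong (fins n) (λ z → pointwise (V z) (kind z)))
      (trans (sum-+ (fins n) (λ z → ⟦ Z₁ z ⟧) (λ z → ⟦ Z₂ z ⟧ + ⟦ Z₃ z ⟧)) (cong (card Z₁ +_) (sum-+ (fins n) (λ z → ⟦ Z₂ z ⟧) (λ z → ⟦ Z₃ z ⟧)))))
      where
      pointwise : ∀ b {z} (k : Kind z) → ⟦ b ⟧ ≡ ⟦ b ∧ is-out k ⟧ + (⟦ b ∧ is-into k ⟧ + ⟦ b ∧ is-mixed k ⟧)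
      pointwise false _              = refl
      pointwise true  (few-out _ _)  = refl
      pointwise true  (few-into _ _) = refl
      pointwise true  (few-W _ _)    = refl
      pointwise true  (few-U _ _)    = refl

    t : ℕ
    t = r * h

    degree≤ : ∀ X z → card X ≡ t → out X z + into X z ≤ t
    degree≤ X z c = begin
      out X z + into X z     ≡⟨ degree-split X z ⟨
      weight X (g z)         ≤⟨ sum-mono (fins n) (λ x → ℕₚ.*-monoʳ-≤ ⟦ X x ⟧ (oriented z x)) ⟩
      weight X (λ _ → 1)     ≡⟨ trans (weight-1 X) c ⟩
      t                      ∎
      where open ℕₚ.≤-Reasoning

    local : ∀ z → ⟦ V z ⟧ * (weight U (g z) + weight W (g z)) ≤
      ⟦ V z ⟧ * (2 * h) + (⟦ Z₁ z ⟧ * (into W z + into U z) + (⟦ Z₂ z ⟧ * (out W z + out U z) + ⟦ Z₃ z ⟧ * t))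
    local z with V z
    ... | false = z≤n
    ... | true  = subst₂ (λ x y → 1 * (x + y) ≤ 1 * (2 * h) +
          (⟦ is-out (kind z) ⟧ * (into W z + into U z) + (⟦ is-into (kind z) ⟧ * (out W z + out U z) + ⟦ is-mixed (kind z) ⟧ * t)))
        (sym (degree-split U z)) (sym (degree-split W z)) (bound (kind z))
      where
      bound : (k : Kind z) → 1 * ((out U z + into U z) + (out W z + into W z)) ≤ 1 * (2 * h) +
        (⟦ is-out k ⟧ * (into W z + into U z) + (⟦ is-into k ⟧ * (out W z + out U z) + ⟦ is-mixed k ⟧ * t))
      bound (few-out p p′) = by-adding (+-mono-≤ (ℕₚ.<⇒≤ p) (ℕₚ.<⇒≤ p′))
        (identity h (out U z) (into U z) (out W z) (into W z) t)
        where
        identity : ∀ h a b c d t → 1 * ((a + b) + (c + d)) + (h + h) ≡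
          1 * (2 * h) + (1 * (d + b) + (0 * (c + a) + 0 * t)) + (c + a)
        identity = solve-∀
      bound (few-into p p′) = by-adding (+-mono-≤ (ℕₚ.<⇒≤ p) (ℕₚ.<⇒≤ p′))
        (identity h (out U z) (into U z) (out W z) (into W z) t)
        where
        identity : ∀ h a b c d t → 1 * ((a + b) + (c + d)) + (h + h) ≡
          1 * (2 * h) + (0 * (d + b) + (1 * (c + a) + 0 * t)) + (d + b)
        identity = solve-∀
      bound (few-W p p′) = by-adding (+-mono-≤ (+-mono-≤ (ℕₚ.<⇒≤ p) (ℕₚ.<⇒≤ p′)) (degree≤ U z cardU))
        (identity h (out U z) (into U z) (out W z) (into W z) t)
        where
        identity : ∀ h a b c d t → 1 * ((a + b) + (c + d)) + ((h + h) + t) ≡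
          1 * (2 * h) + (0 * (d + b) + (0 * (c + a) + 1 * t)) + ((c + d) + (a + b))
        identity = solve-∀
      bound (few-U p p′) = by-adding (+-mono-≤ (+-mono-≤ (ℕₚ.<⇒≤ p) (ℕₚ.<⇒≤ p′)) (degree≤ W z cardW))
        (identity h (out U z) (into U z) (out W z) (into W z) t)
        where
        identity : ∀ h a b c d t → 1 * ((a + b) + (c + d)) + ((h + h) + t) ≡
          1 * (2 * h) + (0 * (d + b) + (0 * (c + a) + 1 * t)) + ((a + b) + (c + d))
        identity = solve-∀

    total : ℕ
    total = between g U V + between g W V

    total≤ : total ≤ card V * (2 * h) + ((between f W Z₁ + between f U Z₁) +
                     ((between f Z₂ W + between f Z₂ U) + card Z₃ * t))
    total≤ = begin
      between g U V + between g W V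
        ≡⟨ cong₂ _+_ (between-sym U V) (between-sym W V) ⟩
      between g V U + between g V W
        ≡⟨ weight-+ V (λ z → weight U (g z)) (λ z → weight W (g z)) ⟨
      weight V (λ z → weight U (g z) + weight W (g z))
        ≤⟨ sum-mono (fins n) local ⟩
      sum (fins n) (λ z → ⟦ V z ⟧ * (2 * h) + (⟦ Z₁ z ⟧ * (into W z + into U z) + (⟦ Z₂ z ⟧ * (out W z + out U z) + ⟦ Z₃ z ⟧ * t)))
        ≡⟨ sum-+ (fins n) (λ z → ⟦ V z ⟧ * (2 * h)) _ ⟩
      sum (fins n) (λ z → ⟦ V z ⟧ * (2 * h)) +
      sum (fins n) (λ z → ⟦ Z₁ z ⟧ * (into W z + into U z) + (⟦ Z₂ z ⟧ * (out W z + out U z) + ⟦ Z₃ z ⟧ * t))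
        ≡⟨ cong₂ _+_ (sum-*ʳ (fins n) (λ z → ⟦ V z ⟧) (2 * h))
             (trans (sum-+ (fins n) (λ z → ⟦ Z₁ z ⟧ * (into W z + into U z)) _)
               (cong₂ _+_ (weight-+ Z₁ (into W) (into U))
                 (trans (sum-+ (fins n) (λ z → ⟦ Z₂ z ⟧ * (out W z + out U z)) _)
                   (cong₂ _+_ (weight-+ Z₂ (out W) (out U)) (sum-*ʳ (fins n) (λ z → ⟦ Z₃ z ⟧) t))))) ⟩
      card V * (2 * h) + ((weight Z₁ (into W) + weight Z₁ (into U)) + ((between f Z₂ W + between f Z₂ U) + card Z₃ * t))
        ≡⟨ cong (λ x → card V * (2 * h) + (x + ((between f Z₂ W + between f Z₂ U) + card Z₃ * t)))
             (cong₂ _+_ (sym (between-transpose f W Z₁)) (sym (between-transpose f U Z₁))) ⟩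
      card V * (2 * h) + ((between f W Z₁ + between f U Z₁) + ((between f Z₂ W + between f Z₂ U) + card Z₃ * t)) ∎
      where open ℕₚ.≤-Reasoning

    -- Vertices of the first two kinds are halved by four applications of `quasirandom`. Of the
    -- error 4Mhn, half pays for the two small degrees at each vertex and half for the four terms
    -- q², each at most Mhn and entering with factor 1/2.
    M-total≤ : M * total ≤ M * (t * card V) + 4 * (M * h) * n
    M-total≤ = ℕₚ.*-cancelˡ-≤ 2 (by-adding
      (+-mono-≤ (ℕₚ.*-monoʳ-≤ (2 * M) total≤) (+-mono-≤ q₁ (+-mono-≤ q₂ (+-mono-≤ q₃ (+-mono-≤ q₄
        (+-mono-≤ (ℕₚ.*-monoʳ-≤ 4 q²≤) (ℕₚ.*-monoʳ-≤ (4 * (M * h)) (card≤n V))))))))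
      (identity M h t n q total (card V) (card Z₁) (card Z₂) (card Z₃) (between f W Z₁) (between f U Z₁)
        (between f Z₂ W) (between f Z₂ U) (sym kinds)))
      where
      q₁ : M * (2 * between f W Z₁) ≤ M * (t * card Z₁) + q * q
      q₁ = subst (λ x → M * (2 * between f W Z₁) ≤ M * (x * card Z₁) + q * q) cardW (quasirandom W Z₁)
      q₂ : M * (2 * between f U Z₁) ≤ M * (t * card Z₁) + q * q
      q₂ = subst (λ x → M * (2 * between f U Z₁) ≤ M * (x * card Z₁) + q * q) cardU (quasirandom U Z₁)
      q₃ : M * (2 * between f Z₂ W) ≤ M * (card Z₂ * t) + q * q
      q₃ = subst (λ x → M * (2 * between f Z₂ W) ≤ M * (card Z₂ * x) + q * q) cardW (quasirandom Z₂ W)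
      q₄ : M * (2 * between f Z₂ U) ≤ M * (card Z₂ * t) + q * q
      q₄ = subst (λ x → M * (2 * between f Z₂ U) ≤ M * (card Z₂ * x) + q * q) cardU (quasirandom Z₂ U)
      q²≤ : q * q ≤ M * h * n
      q²≤ = *-mono-≤ (≤-trans q≤h (≤-trans (≤-reflexive (sym (ℕₚ.*-identityˡ h))) (ℕₚ.*-monoˡ-≤ h 1≤M))) q≤n
      identity : ∀ M h t n q T v z₁ z₂ z₃ a b c d → v ≡ z₁ + (z₂ + z₃) →
        2 * (M * T) + (2 * M * (v * (2 * h) + ((a + b) + ((c + d) + z₃ * t))) + ((M * (t * z₁) + q * q) +
          ((M * (t * z₁) + q * q) + ((M * (z₂ * t) + q * q) + ((M * (z₂ * t) + q * q) +
          (4 * (M * h * n) + 4 * (M * h) * n)))))) ≡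
        2 * (M * (t * v) + 4 * (M * h) * n) + (2 * M * T + (M * (2 * a) + (M * (2 * b) + (M * (2 * c) + (M * (2 * d) +
          (4 * (q * q) + 4 * (M * h) * v))))))
      identity M h t n q T _ z₁ z₂ z₃ a b c d refl = ring M h t n q T z₁ z₂ z₃ a b c d
        where
        ring : ∀ M h t n q T z₁ z₂ z₃ a b c d → let v = z₁ + (z₂ + z₃) in
          2 * (M * T) + (2 * M * (v * (2 * h) + ((a + b) + ((c + d) + z₃ * t))) + ((M * (t * z₁) + q * q) +
            ((M * (t * z₁) + q * q) + ((M * (z₂ * t) + q * q) + ((M * (z₂ * t) + q * q) +
            (4 * (M * h * n) + 4 * (M * h) * n)))))) ≡
          2 * (M * (t * v) + 4 * (M * h) * n) + (2 * M * T + (M * (2 * a) + (M * (2 * b) + (M * (2 * c) + (M * (2 * d) +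
            (4 * (q * q) + 4 * (M * h) * v))))))
        ring = solve-∀

    -- The degrees into `V`, averaged over the 2rh members of `U` and `W` with multiplicity, are at
    -- most ∣V∣/2 + 2n/r.
    low-degree-vertex : ∃ λ u → V u ≡ true × 2 * r * weight V (g u) ≤ r * card V + 4 * n
    low-degree-vertex with below-average (λ u → ⟦ U u ⟧ + ⟦ W u ⟧) (λ u → weight V (g u)) nonempty
      where
      1≤h : 1 ≤ h
      1≤h = ≤-trans 1≤q q≤h
      nonempty : 1 ≤ sum (fins n) (λ u → ⟦ U u ⟧ + ⟦ W u ⟧)
      nonempty = ≤-trans (*-mono-≤ (≤-trans (s≤s z≤n) 2≤r) 1≤h) (≤-trans (≤-reflexive (sym cardU))
        (≤-trans (ℕₚ.m≤m+n (card U) (card W)) (≤-reflexive (sym (sum-+ (fins n) (λ u → ⟦ U u ⟧) (λ u → ⟦ W u ⟧))))))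
    ... | u , member , low = u , u∈V member , ℕₚ.*-cancelˡ-≤ (M * h) {{ℕ.>-nonZero (*-mono-≤ 1≤M (≤-trans 1≤q q≤h))}} (begin
      M * h * (2 * r * d)          ≡⟨ one M h r d ⟩
      M * ((t + t) * d)            ≡⟨ cong (λ x → M * (x * d)) (cong₂ _+_ cardU cardW) ⟨
      M * ((card U + card W) * d)  ≡⟨ cong (λ x → M * (x * d)) (sum-+ (fins n) (λ u → ⟦ U u ⟧) (λ u → ⟦ W u ⟧)) ⟨
      M * (sum (fins n) (λ u → ⟦ U u ⟧ + ⟦ W u ⟧) * d)
                                   ≤⟨ ℕₚ.*-monoʳ-≤ M low ⟩
      M * sum (fins n) (λ u → (⟦ U u ⟧ + ⟦ W u ⟧) * weight V (g u))
                                   ≡⟨ cong (M *_) (trans (sum-cong (fins n) (λ u → ℕₚ.*-distribʳ-+ (weight V (g u)) ⟦ U u ⟧ ⟦ W u ⟧))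
                                        (sum-+ (fins n) (λ u → ⟦ U u ⟧ * weight V (g u)) (λ u → ⟦ W u ⟧ * weight V (g u)))) ⟩
      M * total                    ≤⟨ M-total≤ ⟩
      M * (t * card V) + 4 * (M * h) * n ≡⟨ two M h r n (card V) ⟩
      M * h * (r * card V + 4 * n) ∎)
      where
      open ℕₚ.≤-Reasoning
      d = weight V (g u)
      one : ∀ M h r d → M * h * (2 * r * d) ≡ M * ((r * h + r * h) * d)
      one = solve-∀
      two : ∀ M h r n v → M * (r * h * v) + 4 * (M * h) * n ≡ M * h * (r * v + 4 * n)
      two = solve-∀
      u∈V : 1 ≤ ⟦ U u ⟧ + ⟦ W u ⟧ → V u ≡ true
      u∈V p with U u in e | W u in e′
      ... | true  | _    = U⊑V u e
      ... | false | true = W⊑V u e′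
      u∈V () | false | false

  remove-vertex : ∀ V {u} → V u ≡ true →
    between g V V ≡ between g (V ∖ (u ==_)) (V ∖ (u ==_)) + 2 * weight V (g u)
  remove-vertex V {u} u∈V = begin
    between g V V
      ≡⟨ weight-point V u∈V (λ z → weight V (g z)) ⟩
    weight V (g u) + between g V₁ V
      ≡⟨ cong (weight V (g u) +_) (between-sym V₁ V) ⟩
    weight V (g u) + between g V V₁
      ≡⟨ cong (weight V (g u) +_) (weight-point V u∈V (λ z → weight V₁ (g z))) ⟩
    weight V (g u) + (weight V₁ (g u) + between g V₁ V₁)
      ≡⟨ cong (λ x → weight V (g u) + (x + between g V₁ V₁)) (sym same) ⟩
    weight V (g u) + (weight V (g u) + between g V₁ V₁)
      ≡⟨ collect (weight V (g u)) (between g V₁ V₁) ⟩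
    between g V₁ V₁ + 2 * weight V (g u) ∎
    where
    open ≡-Reasoning
    V₁ = V ∖ (u ==_)
    same : weight V (g u) ≡ weight V₁ (g u)
    same = trans (weight-point V u∈V (g u)) (cong (_+ weight V₁ (g u)) (g-irrefl u))
    collect : ∀ d x → d + (d + x) ≡ x + 2 * d
    collect = solve-∀

  -- If the density of V noticeably exceeds that of a bipartite graph, then V contains a joined
  -- pair, hence a vertex whose degree is at most about half of ∣V∣; remove it.
  density-bound : M ≡ r * (r * r) → ∀ J → M < r * r + J → r * size J ≤ n → r ≤ n →
    ∀ v V → card V ≡ v → 2 * M * between g V V ≤ M * (v * v) + 9 * (r * r) * n * v
  density-bound M≡ J M<J small r≤n = induct
    where
    open ℕₚ.≤-Reasoning
    1≤r : 1 ≤ r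
    1≤r = ≤-trans (s≤s z≤n) 2≤r
    1≤M : 1 ≤ M
    1≤M = ≤-trans (*-mono-≤ 1≤r (*-mono-≤ 1≤r 1≤r)) (≤-reflexive (sym M≡))
    Bound : VertexSet n → ℕ → Set
    Bound V v = 2 * M * between g V V ≤ M * (v * v) + 9 * (r * r) * n * v
    tiny : ∀ v V → card V ≡ v → v ≤ size J → Bound V v
    -- Below the size at which the search can start, the linear error term alone exceeds the trivial
    -- bound, as r · size J ≤ n.
    tiny v V refl v≤ = begin
      2 * M * between g V V         ≤⟨ ℕₚ.*-monoʳ-≤ (2 * M) (between-g≤ V V) ⟩
      2 * M * (v * v)               ≤⟨ ℕₚ.*-monoʳ-≤ (2 * M) (ℕₚ.*-monoˡ-≤ v v≤) ⟩
      2 * M * (size J * v)          ≡⟨ cong (λ x → 2 * x * (size J * v)) M≡ ⟩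
      2 * (r * (r * r)) * (size J * v) ≡⟨ one r (size J) v ⟩
      2 * (r * r) * (r * size J) * v ≤⟨ ℕₚ.*-monoˡ-≤ v (*-mono-≤ (ℕₚ.*-monoˡ-≤ (r * r) (s≤s (s≤s (z≤n {7})))) small) ⟩
      9 * (r * r) * n * v           ≤⟨ ℕₚ.m≤n+m _ _ ⟩
      M * (v * v) + 9 * (r * r) * n * v ∎
      where
      one : ∀ r s v → 2 * (r * (r * r)) * (s * v) ≡ 2 * (r * r) * (r * s) * v
      one = solve-∀
    sparse : ∀ v V → card V ≡ v → 2 * M * between g V V ≤ (M + r * r) * (v * v) → Bound V v
    sparse v V refl le = begin
      2 * M * between g V V             ≤⟨ le ⟩
      (M + r * r) * (v * v)             ≡⟨ one M (r * r) v ⟩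
      M * (v * v) + 1 * (r * r) * v * v ≤⟨ ℕₚ.+-monoʳ-≤ (M * (v * v)) (ℕₚ.*-monoˡ-≤ v
                                             (*-mono-≤ (ℕₚ.*-monoˡ-≤ (r * r) (s≤s (z≤n {8}))) (card≤n V))) ⟩
      M * (v * v) + 9 * (r * r) * n * v ∎
      where
      one : ∀ M c v → (M + c) * (v * v) ≡ M * (v * v) + 1 * c * v * v
      one = solve-∀
    step : ∀ v V {u} → card V ≡ suc v → 2 * r * weight V (g u) ≤ r * card V + 4 * n →
      between g V V ≡ between g (V ∖ (u ==_)) (V ∖ (u ==_)) + 2 * weight V (g u) →
      Bound (V ∖ (u ==_)) v → Bound V (suc v)
    -- Restoring u adds at most 2M(v + 1) + 8r²n, while the quadratic term grows by M(2v + 1). The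
    -- surplus M = r³ is at most r²n, which makes 9r²n per vertex.
    step v V {u} c low e ih rewrite c | e = by-adding
      (+-mono-≤ ih (+-mono-≤ (ℕₚ.*-monoʳ-≤ (2 * (r * r)) low) (ℕₚ.*-monoʳ-≤ (r * r) r≤n)))
      (ring M r n v (between g (V ∖ (u ==_)) (V ∖ (u ==_))) (weight V (g u)) M≡)
      where
      ring : ∀ M r n v w d → M ≡ r * (r * r) →
        2 * M * (w + 2 * d) + (M * (v * v) + 9 * (r * r) * n * v + (2 * (r * r) * (r * suc v + 4 * n) + r * r * n)) ≡
        M * (suc v * suc v) + 9 * (r * r) * n * suc v + (2 * M * w + (2 * (r * r) * (2 * r * d) + r * r * r))
      ring _ r n v w d refl = poly r n v w d
        where
        poly : ∀ r n v w d → let M = r * (r * r) in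
          2 * M * (w + 2 * d) + (M * (v * v) + 9 * (r * r) * n * v + (2 * (r * r) * (r * suc v + 4 * n) + r * r * n)) ≡
          M * (suc v * suc v) + 9 * (r * r) * n * suc v + (2 * M * w + (2 * (r * r) * (2 * r * d) + r * r * r))
        poly = solve-∀
    induct : ∀ v V → card V ≡ v → Bound V v
    dense : ∀ v V → card V ≡ suc v → size J ≤ suc v → (M + r * r) * (suc v * suc v) ≤ 2 * M * between g V V → Bound V (suc v)
    dense v V c J≤ le =
      let U , W , sU , sW , cU , cW , le′ = shrink-both (M + r * r) (2 * M) (size J) V V (≤-trans 1≤q (q≤size J))
            (≤-trans J≤ (≤-reflexive (sym c))) (≤-trans J≤ (≤-reflexive (sym c)))
            (subst (λ x → (M + r * r) * (x * x) ≤ 2 * M * between g V V) (sym c) le)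
          u , u∈V , low = Pair.low-degree-vertex (find-joined J (r * r) U W sU sW cU cW ≤-refl M<J le′) 1≤M
      in step v V c low (remove-vertex V u∈V)
           (induct v (V ∖ (u ==_)) (ℕₚ.suc-injective (trans (sym (card-point V u∈V)) c)))
    induct zero V c = tiny 0 V c z≤n
    induct (suc v) V c with suc v ℕ.≤? size J | 2 * M * between g V V ℕ.≤? (M + r * r) * (suc v * suc v)
    ... | yes p | _     = tiny (suc v) V c p
    ... | no  _ | yes p = sparse (suc v) V c p
    ... | no  p | no p′ = dense v V c (ℕₚ.<⇒≤ (ℕₚ.≰⇒> p)) (ℕₚ.<⇒≤ (ℕₚ.≰⇒> p′))

-- Deterministic bounds

_==²_ : ∀ {n} → ArcPair n → ArcPair n → Bool
(a , b) ==² (u , v) = (a == u) ∧ (b == v)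

==²⇒≡ : ∀ {n} {x y : ArcPair n} → (x ==² y) ≡ true → x ≡ y
==²⇒≡ {x = a , b} {u , v} e with a == u in p | b == v in p′
... | true | true = cong₂ _,_ (==⇒≡ p) (==⇒≡ p′)

==²-refl : ∀ {n} (x : ArcPair n) → (x ==² x) ≡ true
==²-refl (a , b) rewrite ==-refl a = ==-refl b

sum-pairs : ∀ {n} → (ArcPair n → ℕ) → ℕ
sum-pairs f = sum (fins _) (λ u → sum (fins _) (λ v → f (u , v)))

sum-pairs-+ : ∀ {n} (f g : ArcPair n → ℕ) → sum-pairs (λ a → f a + g a) ≡ sum-pairs f + sum-pairs g
sum-pairs-+ {n} f g = trans (sum-cong (fins n) (λ u → sum-+ (fins n) (λ v → f (u , v)) (λ v → g (u , v))))
  (sum-+ (fins n) _ _)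

sum-pairs-mono : ∀ {n} {f g : ArcPair n → ℕ} → (∀ a → f a ≤ g a) → sum-pairs f ≤ sum-pairs g
sum-pairs-mono {n} h = sum-mono (fins n) (λ u → sum-mono (fins n) (λ v → h (u , v)))

sum-pairs-const : ∀ {n} c → sum-pairs {n} (λ _ → c) ≡ n * (n * c)
sum-pairs-const {n} c = trans (sum-cong (fins n) (λ _ → sum-const-fins n c)) (sum-const-fins n (n * c))

sum-pairs-point : ∀ {n} (x : ArcPair n) → sum-pairs (λ a → ⟦ x ==² a ⟧) ≡ 1
sum-pairs-point {n} (a , b) = trans (sum-cong (fins n) (λ u → trans (sum-cong (fins n) (λ v → ⟦∧⟧ (a == u) (b == v)))
  (sum-*ˡ (fins n) ⟦ a == u ⟧ _))) (trans (sum-point a (λ _ → sum (fins n) (λ v → ⟦ b == v ⟧))) (sum-==-fins b))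

sum-pairs-occurrences : ∀ {n} (xs : List (ArcPair n)) → sum-pairs (λ a → sum xs (λ x → ⟦ x ==² a ⟧)) ≡ length xs
sum-pairs-occurrences {n} xs = begin
  sum-pairs (λ a → sum xs (λ x → ⟦ x ==² a ⟧))
    ≡⟨ sum-cong (fins n) (λ u → sum-swap (fins n) xs _) ⟩
  sum (fins n) (λ u → sum xs (λ x → sum (fins n) (λ v → ⟦ x ==² (u , v) ⟧)))
    ≡⟨ sum-swap (fins n) xs _ ⟩
  sum xs (λ x → sum-pairs (λ a → ⟦ x ==² a ⟧))
    ≡⟨ sum-cong xs sum-pairs-point ⟩
  sum xs (λ _ → 1)
    ≡⟨ length-sum xs ⟨
  length xs ∎
  where open ≡-Reasoning

occurrences-≤ : ∀ {n} (Q : ArcPair n → Bool) a {xs} → Unique xs → All (λ x → Q x ≡ true) xs →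
                sum xs (λ x → ⟦ x ==² a ⟧) ≤ ⟦ Q a ⟧
occurrences-≤ Q a [] [] = z≤n
occurrences-≤ Q a {x ∷ xs} (new ∷ uniq) (q ∷ qs) with x ==² a in e
... | false = occurrences-≤ Q a uniq qs
... | true rewrite sym (==²⇒≡ {x = x} {a} e) | q = ≤-reflexive (cong suc (absent new))
  where
  absent : ∀ {ys} → All (x ≢_) ys → sum ys (λ y → ⟦ y ==² x ⟧) ≡ 0
  absent [] = refl
  absent (_∷_ {y} x≢y ps) with y ==² x in e′
  ... | false = absent ps
  ... | true  = contradiction (sym (==²⇒≡ {x = y} {x} e′)) x≢y

unique-length-≤ : ∀ {n} (Q : ArcPair n → Bool) {xs} → Unique xs → All (λ x → Q x ≡ true) xs →
                  length xs ≤ sum-pairs (λ a → ⟦ Q a ⟧)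
unique-length-≤ Q {xs} uniq qs = ≤-trans (≤-reflexive (sym (sum-pairs-occurrences xs)))
  (sum-pairs-mono (λ a → occurrences-≤ Q a uniq qs))

isArc : ∀ {n} → Tour n → ArcPair n → Bool
isArc D (u , v) = arc D u v

arc-count : ∀ {n} → Tour n → ℕ
arc-count D = sum-pairs (λ a → ⟦ isArc D a ⟧)

arc-count-≡ : ∀ {n} (D : Tour n) → 2 * arc-count D + n ≡ n * n
arc-count-≡ {n} D = begin
  2 * sum-pairs A + n
    ≡⟨ cong₂ (λ x y → sum-pairs A + x + y) (ℕₚ.+-identityʳ (sum-pairs A)) (sym diagonal) ⟩
  sum-pairs A + sum-pairs A + sum-pairs E
    ≡⟨ cong (λ x → sum-pairs A + x + sum-pairs E) (sum-swap (fins n) (fins n) (λ u v → ⟦ arc D u v ⟧)) ⟩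
  sum-pairs A + sum-pairs B + sum-pairs E
    ≡⟨ cong (_+ sum-pairs E) (sum-pairs-+ A B) ⟨
  sum-pairs (λ a → A a + B a) + sum-pairs E
    ≡⟨ sum-pairs-+ (λ a → A a + B a) E ⟨
  sum-pairs (λ a → A a + B a + E a)
    ≡⟨ sum-cong (fins n) (λ u → sum-cong (fins n) (λ v → pointwise u v)) ⟩
  sum-pairs {n} (λ _ → 1)
    ≡⟨ trans (sum-pairs-const {n} 1) (cong (n *_) (ℕₚ.*-identityʳ n)) ⟩
  n * n ∎
  where
  open ≡-Reasoning
  A B E : ArcPair n → ℕ
  A a = ⟦ isArc D a ⟧
  B (u , v) = ⟦ arc D v u ⟧
  E (u , v) = ⟦ u == v ⟧
  diagonal : sum-pairs E ≡ n
  diagonal = trans (sum-cong (fins n) sum-==-fins) (trans (sym (length-sum (fins n))) (length-fins n))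
  pointwise : ∀ u v → A (u , v) + B (u , v) + E (u , v) ≡ 1
  pointwise u v with u Fin.≟ v
  ... | yes refl rewrite arc-irrefl D u = refl
  ... | no  u≢v  rewrite arc-anti D u v u≢v = trans (ℕₚ.+-identityʳ _) (⟦not⟧ (arc D u v))

T⇒≡true : ∀ {b} → T b → b ≡ true
T⇒≡true {true} _ = refl

Arc-≢ : ∀ {n} (D : Tour n) {u v} → Arc D u v → u ≢ v
Arc-≢ D {u} a refl = subst T (arc-irrefl D u) a

-- The triangles use 3∣P∣ distinct arcs out of n(n - 1)/2.
packing-size-≤ : ∀ {n} (D : Tour n) P → IsPacking D P → 6 * length P ≤ n * n
packing-size-≤ {n} D P (triangles , disjoint) = begin
  6 * length P          ≡⟨ ℕₚ.*-assoc 2 3 (length P) ⟩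
  2 * (3 * length P)    ≡⟨ cong (2 *_) (sym (length-arcs P)) ⟩
  2 * length (concatMap arcsOf P)
                        ≤⟨ ℕₚ.*-monoʳ-≤ 2 (unique-length-≤ (isArc D) (unique triangles disjoint) (arcs triangles)) ⟩
  2 * arc-count D       ≤⟨ ℕₚ.m≤m+n _ n ⟩
  2 * arc-count D + n   ≡⟨ arc-count-≡ D ⟩
  n * n                 ∎
  where
  open ℕₚ.≤-Reasoning
  length-arcs : ∀ P → length (concatMap arcsOf P) ≡ 3 * length P
  length-arcs []      = refl
  length-arcs (t ∷ P) = trans (cong (3 +_) (length-arcs P)) (sym (ℕₚ.*-suc 3 (length P)))
  arcs : ∀ {P} → All (IsTriangle D) P → All (λ a → isArc D a ≡ true) (concatMap arcsOf P)
  arcs []                 = []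
  arcs ((a , b , c) ∷ ts) = T⇒≡true a ∷ T⇒≡true b ∷ T⇒≡true c ∷ arcs ts
  unique : ∀ {P} → All (IsTriangle D) P → AllPairs ArcDisjoint P → Unique (concatMap arcsOf P)
  unique [] [] = []
  unique {t@(u , v , w) ∷ P} ((a , b , c) ∷ ts) (d ∷ ds) = Uniqueₚ.++⁺ distinct (unique ts ds) apart
    where
    distinct : Unique (arcsOf t)
    distinct = ((λ e → Arc-≢ D a (cong proj₁ e)) ∷ (λ e → Arc-≢ D c (sym (cong proj₁ e))) ∷ []) ∷
               ((λ e → Arc-≢ D b (cong proj₁ e)) ∷ []) ∷ [] ∷ []
    apart : ∀ {x} → ¬ (x ∈ arcsOf t × x ∈ concatMap arcsOf P)
    apart (p , p′) with find (∈ₚ.∈-concatMap⁻ arcsOf {xs = P} p′)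
    ... | s , s∈P , x∈s = All.lookup d s∈P p x∈s

-- A walk around a triangle cannot keep going down in a linear order, nor keep going up. `R-cyclic`
-- is this property, and it makes the arcs along `R` meet every directed triangle.
module OneWay {n} (D : Tour n) {R : Fin n → Fin n → Set} (R? : ∀ u v → Dec (R u v))
  (R-cyclic : ∀ {u v w} → u ≢ v → v ≢ w → w ≢ u → R u v ⊎ (R v w ⊎ R w u)) where

  OneWayArc : ArcPair n → Set
  OneWayArc (u , v) = Arc D u v × R u v

  oneWay? : ∀ a → Dec (OneWayArc a)
  oneWay? (u , v) = Boolₚ.T? (arc D u v) ×-dec R? u v

  pairs : List (ArcPair n)
  pairs = cartesianProduct (fins n) (fins n)

  arcs : List (ArcPair n)
  arcs = filter oneWay? pairs

  arcs-transversal : IsTransversal D arcs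
  arcs-transversal = All.map proj₁ (Allₚ.all-filter oneWay? pairs) , meet
    where
    select : ∀ {u v} → Arc D u v → R u v → (u , v) ∈ arcs
    select a r = ∈ₚ.∈-filter⁺ oneWay? (∈ₚ.∈-cartesianProduct⁺ (∈-fins _) (∈-fins _)) (a , r)
    meet : ∀ t → IsTriangle D t → Σ[ a ∈ ArcPair n ] (a ∈ arcsOf t × a ∈ arcs)
    meet (u , v , w) (a , b , c) with R-cyclic (Arc-≢ D a) (Arc-≢ D b) (Arc-≢ D c)
    ... | inj₁ r        = (u , v) , here refl , select a r
    ... | inj₂ (inj₁ r) = (v , w) , there (here refl) , select b r
    ... | inj₂ (inj₂ r) = (w , u) , there (there (here refl)) , select c r

  length-arcs : length arcs ≡ sum-pairs (λ a → ⟦ ⌊ oneWay? a ⌋ ⟧)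
  length-arcs = trans (length-filter-sum oneWay? pairs) (sum-cartesianProduct (fins n) (fins n) _)

<-cyclic : ∀ {n} {u v w : Fin n} → u ≢ v → v ≢ w → w ≢ u → u Fin.< v ⊎ (v Fin.< w ⊎ w Fin.< u)
<-cyclic {u = u} {v} {w} u≢v v≢w w≢u with Finₚ.<-cmp u v | Finₚ.<-cmp v w
... | tri< lt _ _ | _           = inj₁ lt
... | tri≈ _ e _  | _           = contradiction e u≢v
... | tri> _ _ _  | tri< lt _ _ = inj₂ (inj₁ lt)
... | tri> _ _ _  | tri≈ _ e _  = contradiction e v≢w
... | tri> _ _ gt | tri> _ _ gt′ = inj₂ (inj₂ (ℕₚ.<-trans gt′ gt))

>-cyclic : ∀ {n} {u v w : Fin n} → u ≢ v → v ≢ w → w ≢ u → v Fin.< u ⊎ (w Fin.< v ⊎ u Fin.< w)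
>-cyclic u≢v v≢w w≢u with <-cyclic (u≢v ∘ sym) (w≢u ∘ sym) (v≢w ∘ sym)
... | inj₁ p        = inj₁ p
... | inj₂ (inj₁ p) = inj₂ (inj₂ p)
... | inj₂ (inj₂ p) = inj₂ (inj₁ p)

-- The arcs going up and the arcs going down in the order of Fin n are both transversals.
small-transversal : ∀ {n} (D : Tour n) → ∃ λ X → IsTransversal D X × 4 * length X ≤ n * n
small-transversal {n} D = pick (ℕₚ.≤-total (length Up.arcs) (length Down.arcs))
  where
  module Up   = OneWay D {λ u v → u Fin.< v} Finₚ._<?_ <-cyclic
  module Down = OneWay D {λ u v → v Fin.< u} (λ u v → v Finₚ.<? u) >-cyclic
  pointwise : ∀ a → ⟦ ⌊ Up.oneWay? a ⌋ ⟧ + ⟦ ⌊ Down.oneWay? a ⌋ ⟧ ≤ ⟦ isArc D a ⟧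
  pointwise (u , v) with Boolₚ.T? (arc D u v) | u Finₚ.<? v | v Finₚ.<? u
  ... | no  _ | _     | _     = z≤n
  ... | yes a | yes p | yes p′ = contradiction p′ (ℕₚ.<-asym p)
  ... | yes a | yes p | no  _ = ≤-reflexive (sym (cong ⟦_⟧ (T⇒≡true a)))
  ... | yes a | no  _ | yes _ = ≤-reflexive (sym (cong ⟦_⟧ (T⇒≡true a)))
  ... | yes a | no  _ | no  _ = z≤n
  both : length Up.arcs + length Down.arcs ≤ arc-count D
  both = ≤-trans (≤-reflexive (trans (cong₂ _+_ Up.length-arcs Down.length-arcs)
    (sym (sum-pairs-+ (λ a → ⟦ ⌊ Up.oneWay? a ⌋ ⟧) (λ a → ⟦ ⌊ Down.oneWay? a ⌋ ⟧))))) (sum-pairs-mono pointwise)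
  finish : ∀ {x y c} → x ≤ y → x + y ≤ c → 2 * c + n ≡ n * n → 4 * x ≤ n * n
  finish {x} {y} {c} x≤y x+y≤c e = ≤-trans (by-adding (+-mono-≤ (ℕₚ.*-monoʳ-≤ 2 x≤y) (ℕₚ.*-monoʳ-≤ 2 x+y≤c)) (identity x y c))
    (≤-trans (ℕₚ.m≤m+n (2 * c) n) (≤-reflexive e))
    where
    identity : ∀ x y c → 4 * x + (2 * y + 2 * c) ≡ 2 * c + (2 * x + 2 * (x + y))
    identity = solve-∀
  pick : length Up.arcs ≤ length Down.arcs ⊎ length Down.arcs ≤ length Up.arcs →
         ∃ λ X → IsTransversal D X × 4 * length X ≤ n * n
  pick (inj₁ le) = Up.arcs , Up.arcs-transversal , finish le both (arc-count-≡ D)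
  pick (inj₂ le) = Down.arcs , Down.arcs-transversal ,
    finish le (≤-trans (≤-reflexive (ℕₚ.+-comm (length Down.arcs) _)) both) (arc-count-≡ D)

-- The digraph left by deleting a transversal

module AfterDeletion {n} (D : Tour n) (X : List (ArcPair n)) (X-transversal : IsTransversal D X) where

  open Data.List.Membership.DecPropositional (Data.Product.Properties.≡-dec (Fin._≟_ {n}) (Fin._≟_ {n})) using (_∈?_)

  F : Fin n → Fin n → Bool
  F u v = arc D u v ∧ not ⌊ (u , v) ∈? X ⌋

  F-arc : ∀ {u v} → F u v ≡ true → Arc D u v × (u , v) ∉ X
  F-arc {u} {v} e with arc D u v in a | (u , v) ∈? X
  ... | true | no p = tt , p

  no-triangle : ∀ {u v w} → F u v ≡ true → F v w ≡ true → F w u ≡ true → ⊥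
  no-triangle {u} {v} {w} e₁ e₂ e₃ with F-arc {u} {v} e₁ | F-arc {v} {w} e₂ | F-arc {w} {u} e₃
  ... | a , p | b , p′ | c , p″ with proj₂ X-transversal (u , v , w) (a , b , c)
  ... | _ , here refl , m                 = p m
  ... | _ , there (here refl) , m         = p′ m
  ... | _ , there (there (here refl)) , m = p″ m

  F≤arc : ∀ u v → ⟦ F u v ⟧ ≤ arcℕ D u v
  F≤arc u v with arc D u v
  ... | true  = ⟦⟧≤1 _
  ... | false = z≤n

  oriented : ∀ u v → ⟦ F u v ⟧ + ⟦ F v u ⟧ ≤ 1
  oriented u v = ≤-trans (+-mono-≤ (F≤arc u v) (F≤arc v u)) (one-direction D u v)

  -- An arc of `D` survives in `F` or occurs in `X`; occurrences are counted with multiplicity,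
  -- since `X` is a list.
  arcs≤ : arc-count D ≤ sum-pairs (λ (u , v) → ⟦ F u v ⟧) + length X
  arcs≤ = ≤-trans (sum-pairs-mono pointwise) (≤-reflexive (trans
    (sum-pairs-+ (λ (u , v) → ⟦ F u v ⟧) (λ a → sum X (λ x → ⟦ x ==² a ⟧)))
    (cong (sum-pairs (λ (u , v) → ⟦ F u v ⟧) +_) (sum-pairs-occurrences X))))
    where
    pointwise : ∀ a → ⟦ isArc D a ⟧ ≤ ⟦ F (proj₁ a) (proj₂ a) ⟧ + sum X (λ x → ⟦ x ==² a ⟧)
    pointwise (u , v) with (u , v) ∈? X
    ... | no  _ = ≤-trans (≤-reflexive (cong ⟦_⟧ (sym (Boolₚ.∧-identityʳ (arc D u v))))) (ℕₚ.m≤m+n _ _)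
    ... | yes m = ≤-trans (⟦⟧≤1 _) (≤-trans
      (≤-trans (≤-reflexive (sym (cong ⟦_⟧ (==²-refl (u , v))))) (∈⇒≤sum (λ x → ⟦ x ==² (u , v) ⟧) m))
      (ℕₚ.m≤n+m _ ⟦ arc D u v ∧ false ⟧))

-- The density bound reads e ≤ n²/4 + 9n²/(4r). With r = 3(k + 1) the error is three quarters of
-- n²/(k + 1); the n/2 by which the number of arcs falls short of n²/2 fits into the last quarter
-- because 2(k + 1) ≤ n.
transversal-count : ∀ {n r M} k x a e → 2 * suc k ≤ n → r ≡ 3 * suc k → M ≡ r * (r * r) → 2 * a + n ≡ n * n → a ≤ e + x →
  2 * M * (2 * e) ≤ M * (n * n) + 9 * (r * r) * n * n → suc k * (n * n) ≤ 4 * suc k * x + 4 * (n * n)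
transversal-count {n} k x a e 2k≤n refl refl a≡ a≤ dense = ℕₚ.*-cancelˡ-≤ c (by-adding
  (+-mono-≤ dense (+-mono-≤ (ℕₚ.*-monoʳ-≤ (2 * (c * K)) (≤-trans (≤-reflexive (sym a≡)) (ℕₚ.+-monoˡ-≤ n (ℕₚ.*-monoʳ-≤ 2 a≤))))
    (ℕₚ.*-monoʳ-≤ (c * n) 2k≤n)))
  (identity K n e x))
  where
  K = suc k
  c = 27 * (K * K)
  identity : ∀ K n e x → let r = 3 * K; M = r * (r * r); c = 27 * (K * K) in
    c * (K * (n * n)) + (M * (n * n) + 9 * (r * r) * n * n + (2 * (c * K) * (2 * (e + x) + n) + c * n * n)) ≡
    c * (4 * K * x + 4 * (n * n)) + (2 * M * (2 * e) + (2 * (c * K) * (n * n) + c * n * (2 * K)))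
  identity = solve-∀

-- b = r^(J+1), and q = ⌊n/b⌋ is the size of the smallest sets in the density increment.
transversal-size-≥ : ∀ {n} k r M J b q L → r ≡ 3 * suc k → M ≡ r * (r * r) → M < r * r + J →
  b ≡ r ^ suc J → L ≡ 4 * M * (b * b) → q * b ≤ n → n ≤ suc q * b → 1 ≤ q → 1 ≤ b → 2 * suc k ≤ n → r ≤ n →
  (D : Tour n) → sq (sq L) * irregularity D ≤ sq (n * n) →
  ∀ X → IsTransversal D X → suc k * (n * n) ≤ 4 * suc k * length X + 4 * (n * n)
transversal-size-≥ {n} k r M J b q L r≡ M≡ M<J b≡ L≡ qb≤n n≤ 1≤q 1≤b 2k≤n r≤n D regular X transversal =
  transversal-count k (length X) (arc-count D) e 2k≤n r≡ M≡ (arc-count-≡ D) arcs≤ dense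
  where
  open AfterDeletion D X transversal
  1≤r : 1 ≤ r
  1≤r = ≤-trans (s≤s z≤n) (≤-reflexive (sym r≡))
  2≤r : 2 ≤ r
  2≤r = ≤-trans (≤-trans (s≤s (s≤s (z≤n {1}))) (ℕₚ.*-monoʳ-≤ 3 (s≤s (z≤n {k})))) (≤-reflexive (sym r≡))
  1≤M : 1 ≤ M
  1≤M = ≤-trans (*-mono-≤ 1≤r (*-mono-≤ 1≤r 1≤r)) (≤-reflexive (sym M≡))
  -- The origin of L = 4Mb²: from n ≤ 2qb, a discrepancy of n²/L is at most q²/M.
  Mn²≤Lq² : M * (n * n) ≤ L * (q * q)
  Mn²≤Lq² = begin
    M * (n * n)                         ≤⟨ ℕₚ.*-monoʳ-≤ M (*-mono-≤ n≤2qb n≤2qb) ⟩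
    M * ((q + q) * b * ((q + q) * b))   ≡⟨ identity M q b ⟩
    4 * M * (b * b) * (q * q)           ≡⟨ cong (_* (q * q)) L≡ ⟨
    L * (q * q)                         ∎
    where
    open ℕₚ.≤-Reasoning
    n≤2qb : n ≤ (q + q) * b
    n≤2qb = ≤-trans n≤ (ℕₚ.*-monoˡ-≤ b (ℕₚ.+-monoˡ-≤ q 1≤q))
    identity : ∀ M q b → M * ((q + q) * b * ((q + q) * b)) ≡ 4 * M * (b * b) * (q * q)
    identity = solve-∀
  1≤L : 1 ≤ L
  1≤L = ≤-trans (*-mono-≤ (*-mono-≤ (s≤s (z≤n {3})) 1≤M) (*-mono-≤ 1≤b 1≤b)) (≤-reflexive (sym L≡))
  -- Only an upper bound on the number of arcs is demanded, and it passes from `D` to its subdigraph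
  -- `F`.
  quasirandom : ∀ U W → M * (2 * between (λ u w → ⟦ F u w ⟧) U W) ≤ M * (card U * card W) + q * q
  quasirandom U W = ℕₚ.*-cancelˡ-≤ L {{ℕ.>-nonZero 1≤L}} (begin
    L * (M * (2 * x))                       ≡⟨ *-swap L M (2 * x) ⟩
    M * (L * (2 * x))                       ≤⟨ ℕₚ.*-monoʳ-≤ M (ℕₚ.*-monoʳ-≤ L (ℕₚ.*-monoʳ-≤ 2 (between-mono U W F≤arc))) ⟩
    M * (L * (2 * between (arcℕ D) U W))    ≤⟨ ℕₚ.*-monoʳ-≤ M (discrepancy D L regular U W) ⟩
    M * (L * (card U * card W) + n * n)     ≡⟨ ℕₚ.*-distribˡ-+ M (L * (card U * card W)) (n * n) ⟩
    M * (L * (card U * card W)) + M * (n * n) ≤⟨ ℕₚ.+-monoʳ-≤ (M * (L * (card U * card W))) Mn²≤Lq² ⟩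
    M * (L * (card U * card W)) + L * (q * q) ≡⟨ collect M L (card U * card W) (q * q) ⟩
    L * (M * (card U * card W) + q * q)     ∎)
    where
    open ℕₚ.≤-Reasoning
    x = between (λ u w → ⟦ F u w ⟧) U W
    collect : ∀ M L x y → M * (L * x) + L * y ≡ L * (M * x + y)
    collect = solve-∀
  q≤n : q ≤ n
  q≤n = ≤-trans (≤-reflexive (sym (ℕₚ.*-identityʳ q))) (≤-trans (ℕₚ.*-monoʳ-≤ q 1≤b) qb≤n)
  open TriangleFree F r q M 2≤r 1≤q q≤n no-triangle oriented quasirandom
  size-≡ : ∀ j → size j ≡ r ^ j * q
  size-≡ zero    = sym (ℕₚ.+-identityʳ q)
  size-≡ (suc j) = trans (cong (r *_) (size-≡ j)) (sym (ℕₚ.*-assoc r (r ^ j) q))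
  fits : r * size J ≤ n
  fits = ≤-trans (≤-reflexive (trans (size-≡ (suc J)) (trans (cong (_* q) (sym b≡)) (ℕₚ.*-comm b q)))) qb≤n
  all : VertexSet n
  all _ = true
  card-all : card all ≡ n
  card-all = trans (sum-const-fins n 1) (ℕₚ.*-identityʳ n)
  e : ℕ
  e = sum-pairs (λ (u , v) → ⟦ F u v ⟧)
  between-all : between g all all ≡ 2 * e
  between-all = trans (between-g all all) (trans (cong₂ _+_ same same) (cong (e +_) (sym (ℕₚ.+-identityʳ e))))
    where
    same : between f all all ≡ e
    same = sum-cong (fins n) (λ u → trans (ℕₚ.*-identityˡ _) (sum-cong (fins n) (λ v → ℕₚ.*-identityˡ _)))
  dense : 2 * M * (2 * e) ≤ M * (n * n) + 9 * (r * r) * n * n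
  dense = subst (λ x → 2 * M * x ≤ M * (n * n) + 9 * (r * r) * n * n) between-all
    (density-bound M≡ J M<J fits r≤n n all card-all)

-- Concentration by Markov's inequality

-- The allowance 6n² is spent as follows: 4n² on live arcs, and 12(k + 1)·2^r·n ≤ 2n² on degenerate
-- pairs and on the vertices outside the fibres.
packing-size-≥ : ∀ {n} k r q → n ≤ suc q * 2 ^ r → 6 * suc k * 2 ^ r ≤ n →
  (fits : q * 2 ^ r ≤ n) (D : Tour n) →
  suc k * BlockPacking.sum² {q} {r} {n} fits (BlockPacking.leftover {q} {r} {n} fits D) ≤ 2 * (n * n) →
  ∃ λ P → IsPacking D P × suc k * (n * n) ≤ 6 * suc k * length P + 6 * (n * n)
packing-size-≥ {n} k r q n≤ large fits D few =
  let P , valid , size≥ = large-packing D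
  in P , valid , finish (suc k) (length P) (sum² (leftover D)) (2 ^ r) size fits n≤N+s few large size≥
  where
  open BlockPacking {q} {r} {n} fits
  n≤N+s : n ≤ size + 2 ^ r
  n≤N+s = ≤-trans n≤ (≤-reflexive (ℕₚ.+-comm (2 ^ r) size))
  finish : ∀ K p Y s N → N ≤ n → n ≤ N + s → K * Y ≤ 2 * (n * n) → 6 * K * s ≤ n →
    N * N ≤ 6 * p + 2 * Y + 9 * (N * s) → K * (n * n) ≤ 6 * K * p + 6 * (n * n)
  finish K p Y s N N≤n n≤N+s few large size≥ = by-adding
    (+-mono-≤ (ℕₚ.*-monoʳ-≤ K size≥) (+-mono-≤ (ℕₚ.*-monoʳ-≤ 2 few) (+-mono-≤ (ℕₚ.*-monoʳ-≤ K n²≤)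
      (+-mono-≤ (ℕₚ.*-monoʳ-≤ (9 * K * s) N≤n) (ℕₚ.*-monoʳ-≤ (2 * n) large)))))
    (identity K p Y s N n)
    where
    n²≤ : n * n ≤ N * N + 3 * (n * s)
    n²≤ = by-adding (+-mono-≤ (ℕₚ.*-monoˡ-≤ n n≤N+s)
      (+-mono-≤ (ℕₚ.*-monoʳ-≤ N n≤N+s) (+-mono-≤ (ℕₚ.*-monoˡ-≤ s N≤n) (z≤n {n * s})))) (expand N n s)
      where
      expand : ∀ N n s → n * n + ((N + s) * n + (N * (N + s) + (n * s + n * s))) ≡
                         N * N + 3 * (n * s) + (n * n + (N * n + (N * s + 0)))
      expand = solve-∀
    identity : ∀ K p Y s N n →
      K * (n * n) + (K * (6 * p + 2 * Y + 9 * (N * s)) + (2 * (2 * (n * n)) + (K * (N * N + 3 * (n * s)) +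
        (9 * K * s * n + 2 * n * n)))) ≡
      6 * K * p + 6 * (n * n) + (K * (N * N) + (2 * (K * Y) + (K * (n * n) + (9 * K * s * N + 2 * n * (6 * K * s)))))
    identity = solve-∀

markov : ∀ {A : Set} (xs : List A) (Z : A → ℕ) B c → 1 ≤ B → c * sum xs Z ≤ B * length xs →
         c * sum xs (λ x → ⟦ not ⌊ Z x ℕ.≤? B ⌋ ⟧) ≤ length xs
markov xs Z B c 1≤B mean = ℕₚ.*-cancelˡ-≤ B {{ℕ.>-nonZero 1≤B}} (begin
  B * (c * sum xs bad)          ≡⟨ *-swap B c (sum xs bad) ⟩
  c * (B * sum xs bad)          ≡⟨ cong (c *_) (sum-*ˡ xs B bad) ⟨
  c * sum xs (λ x → B * bad x)  ≤⟨ ℕₚ.*-monoʳ-≤ c (sum-mono xs large) ⟩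
  c * sum xs Z                  ≤⟨ mean ⟩
  B * length xs                 ∎)
  where
  open ℕₚ.≤-Reasoning
  bad : _ → ℕ
  bad x = ⟦ not ⌊ Z x ℕ.≤? B ⌋ ⟧
  large : ∀ x → B * bad x ≤ Z x
  large x with Z x ℕ.≤? B
  ... | yes _ = ≤-trans (≤-reflexive (ℕₚ.*-zeroʳ B)) z≤n
  ... | no  p = ≤-trans (≤-reflexive (ℕₚ.*-identityʳ B)) (ℕₚ.<⇒≤ (ℕₚ.≰⇒> p))

-- Union bound: by Markov's inequality each condition fails for at most one in 2(m + 1) tournaments.
both-likely : ∀ {n} m (Z Z′ : Tour n → ℕ) B B′ {E : Tour n → Set} → 1 ≤ B → 1 ≤ B′ →
  2 * suc m * sum (allTour n) Z ≤ B * length (allTour n) →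
  2 * suc m * sum (allTour n) Z′ ≤ B′ * length (allTour n) →
  (∀ D → Z D ≤ B → Z′ D ≤ B′ → E D) → ProbAtLeast n m E
both-likely {n} m Z Z′ B B′ {E} 1≤B 1≤B′ mean mean′ implies =
  filter good? Ω , filter-⊆ good? Ω ,
  All.map (λ {D} (p , p′) → implies D p p′) (Allₚ.all-filter good? Ω) ,
  ℕₚ.*-cancelˡ-≤ 2 (by-adding
    (+-mono-≤ (ℕₚ.*-monoʳ-≤ (2 * suc m) cover) (+-mono-≤ (markov Ω Z B (2 * suc m) 1≤B mean) (markov Ω Z′ B′ (2 * suc m) 1≤B′ mean′)))
    (identity m (length Ω) (length (filter good? Ω)) (sum Ω bad) (sum Ω bad′)))
  where
  Ω = allTour n
  good? : ∀ D → Dec (Z D ≤ B × Z′ D ≤ B′)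
  good? D = (Z D ℕ.≤? B) ×-dec (Z′ D ℕ.≤? B′)
  bad bad′ : Tour n → ℕ
  bad  D = ⟦ not ⌊ Z D ℕ.≤? B ⌋ ⟧
  bad′ D = ⟦ not ⌊ Z′ D ℕ.≤? B′ ⌋ ⟧
  pointwise : ∀ D → 1 ≤ ⟦ ⌊ good? D ⌋ ⟧ + (bad D + bad′ D)
  pointwise D with Z D ℕ.≤? B | Z′ D ℕ.≤? B′
  ... | yes _ | yes _ = ≤-refl
  ... | yes _ | no  _ = ≤-refl
  ... | no  _ | yes _ = s≤s z≤n
  ... | no  _ | no  _ = s≤s z≤n
  cover : length Ω ≤ length (filter good? Ω) + (sum Ω bad + sum Ω bad′)
  cover = begin
    length Ω                                                ≡⟨ length-sum Ω ⟩
    sum Ω (λ _ → 1)                                         ≤⟨ sum-mono Ω pointwise ⟩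
    sum Ω (λ D → ⟦ ⌊ good? D ⌋ ⟧ + (bad D + bad′ D))        ≡⟨ sum-+ Ω (λ D → ⟦ ⌊ good? D ⌋ ⟧) (λ D → bad D + bad′ D) ⟩
    sum Ω (λ D → ⟦ ⌊ good? D ⌋ ⟧) + sum Ω (λ D → bad D + bad′ D)
      ≡⟨ cong₂ _+_ (sym (length-filter-sum good? Ω)) (sum-+ Ω bad bad′) ⟩
    length (filter good? Ω) + (sum Ω bad + sum Ω bad′)      ∎
    where open ℕₚ.≤-Reasoning
  identity : ∀ m t g x y → 2 * (m * t) + (2 * suc m * (g + (x + y)) + (t + t)) ≡
    2 * (suc m * g) + (2 * suc m * t + (2 * suc m * x + 2 * suc m * y))
  identity = solve-∀

-- Choice of the constants

div-bounds : ∀ n b .{{_ : ℕ.NonZero b}} → (n / b) * b ≤ n × n ≤ suc (n / b) * b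
div-bounds n b = m/n*n≤m n b , ≤-trans (≤-reflexive (trans (m≡m%n+[m/n]*n n b) (ℕₚ.+-comm (n % b) _)))
  (≤-trans (ℕₚ.+-monoʳ-≤ (n / b * b) (ℕₚ.<⇒≤ (m%n<n n b))) (≤-reflexive (ℕₚ.+-comm (n / b * b) b)))

likely : ∀ k m R r M J b L {n} → suc k * suc m * num R ≤ den R → r ≡ 3 * suc k → M ≡ r * (r * r) →
  M < r * r + J → b ≡ r ^ suc J → L ≡ 4 * M * (b * b) → 1 ≤ b →
  1 ≤ n → b ≤ n → 2 * suc k ≤ n → r ≤ n → 6 * suc k * 2 ^ R ≤ n → 4 * suc m * sq (sq L) ≤ n →
  ProbAtLeast n m (λ D → νClose k D × τClose k D)
likely k m R r M J b L {n} decay r≡ M≡ M<J b≡ L≡ 1≤b 1≤n b≤n 2k≤n r≤n s≤n L≤n =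
  both-likely m (λ D → suc k * sum² (leftover D)) (λ D → sq (sq L) * irregularity D)
    (2 * (n * n)) (sq (n * n)) (*-mono-≤ (s≤s (z≤n {1})) 1≤n²) (*-mono-≤ 1≤n² 1≤n²)
    mean mean′ implies
  where
  instance
    b≢0 : ℕ.NonZero b
    b≢0 = ℕ.>-nonZero 1≤b
    2^R≢0 : ℕ.NonZero (2 ^ R)
    2^R≢0 = ℕₚ.m^n≢0 2 R
  fits : n / 2 ^ R * 2 ^ R ≤ n
  fits = proj₁ (div-bounds n (2 ^ R))
  open BlockPacking {n / 2 ^ R} {R} {n} fits
  open ℕₚ.≤-Reasoning
  Ω = allTour n
  1≤n² : 1 ≤ n * n
  1≤n² = *-mono-≤ 1≤n 1≤n
  -- The rounds run until q ≤ 1/((k + 1)(m + 1)): one factor is the accuracy, the other is lost to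
  -- Markov's inequality.
  mean : 2 * suc m * sum Ω (λ D → suc k * sum² (leftover D)) ≤ 2 * (n * n) * length Ω
  mean = begin
    2 * suc m * sum Ω (λ D → suc k * sum² (leftover D))
      ≡⟨ cong (2 * suc m *_) (sum-*ˡ Ω (suc k) (λ D → sum² (leftover D))) ⟩
    2 * suc m * (suc k * sum Ω (λ D → sum² (leftover D)))
      ≡⟨ regroup (suc m) (suc k) (sum Ω (λ D → sum² (leftover D))) ⟩
    2 * (suc k * suc m * sum Ω (λ D → sum² (leftover D)))
      ≤⟨ ℕₚ.*-monoʳ-≤ 2 (≤-trans (expected-leftover (suc k * suc m) decay) (ℕₚ.*-monoˡ-≤ (length Ω) (*-mono-≤ fits fits))) ⟩
    2 * (n * n * length Ω)
      ≡⟨ ℕₚ.*-assoc 2 (n * n) (length Ω) ⟨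
    2 * (n * n) * length Ω ∎
    where
    regroup : ∀ m k x → 2 * m * (k * x) ≡ 2 * (k * m * x)
    regroup = solve-∀
  -- The expected irregularity is at most 2n³ and the threshold is n⁴/L⁴, so n ≥ 4(m + 1)L⁴
  -- suffices.
  mean′ : 2 * suc m * sum Ω (λ D → sq (sq L) * irregularity D) ≤ sq (n * n) * length Ω
  mean′ = begin
    2 * suc m * sum Ω (λ D → sq (sq L) * irregularity D)
      ≡⟨ cong (2 * suc m *_) (sum-*ˡ Ω (sq (sq L)) irregularity) ⟩
    2 * suc m * (sq (sq L) * sum Ω irregularity)
      ≤⟨ ℕₚ.*-monoʳ-≤ (2 * suc m) (ℕₚ.*-monoʳ-≤ (sq (sq L)) (expected-irregularity n)) ⟩
    2 * suc m * (sq (sq L) * (2 * (n * n * n) * length Ω))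
      ≡⟨ regroup (suc m) (sq (sq L)) n (length Ω) ⟩
    4 * suc m * sq (sq L) * (n * n * n * length Ω)
      ≤⟨ ℕₚ.*-monoˡ-≤ (n * n * n * length Ω) L≤n ⟩
    n * (n * n * n * length Ω)
      ≡⟨ fourth n (length Ω) ⟩
    sq (n * n) * length Ω ∎
    where
    regroup : ∀ m l n t → 2 * m * (l * (2 * (n * n * n) * t)) ≡ 4 * m * l * (n * n * n * t)
    regroup = solve-∀
    fourth : ∀ n t → n * (n * n * n * t) ≡ n * n * (n * n) * t
    fourth = solve-∀
  1≤n/b : 1 ≤ n / b
  1≤n/b = m≥n⇒m/n>0 b≤n
  scale : ∀ c {x y} → c * x ≤ y → c * suc k * x ≤ suc k * y
  scale c {x} {y} le = ≤-trans (≤-reflexive (regroup c (suc k) x)) (ℕₚ.*-monoʳ-≤ (suc k) le)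
    where
    regroup : ∀ c k x → c * k * x ≡ k * (c * x)
    regroup = solve-∀
  implies : ∀ D → suc k * sum² (leftover D) ≤ 2 * (n * n) → sq (sq L) * irregularity D ≤ sq (n * n) →
            νClose k D × τClose k D
  implies D few regular =
    (packing-size-≥ k R (n / 2 ^ R) (proj₂ (div-bounds n (2 ^ R))) s≤n fits D few ,
     λ P packing → ≤-trans (scale 6 (packing-size-≤ D P packing)) (ℕₚ.m≤m+n _ _)) ,
    (let X , transversal , small = small-transversal D in
     X , transversal , ≤-trans (scale 4 small) (ℕₚ.m≤m+n _ _)) ,
    transversal-size-≥ k r M J b (n / b) L r≡ M≡ M<J b≡ L≡ (proj₁ (div-bounds n b)) (proj₂ (div-bounds n b))
      1≤n/b 1≤b 2k≤n r≤n D regular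

theorem9 : (k m : ℕ) → Σ[ N ∈ ℕ ] ((n : ℕ) → N ≤ n →
    ProbAtLeast n m (λ D → νClose k D × τClose k D))
theorem9 k m = with-constants (num/den→0 (suc k * suc m))
    (3 * suc k) refl
    (3 * suc k * (3 * suc k * (3 * suc k))) refl _ refl _ refl _ refl
  where
  with-constants : (∃ λ R → suc k * suc m * num R ≤ den R) → ∀ r → r ≡ 3 * suc k → ∀ M → M ≡ r * (r * r) →
    ∀ J → J ≡ suc M → ∀ b → b ≡ r ^ suc J → ∀ L → L ≡ 4 * M * (b * b) →
    Σ[ N ∈ ℕ ] ((n : ℕ) → N ≤ n → ProbAtLeast n m (λ D → νClose k D × τClose k D))
  with-constants (R , decay) r r≡ M M≡ J J≡ b b≡ L L≡ =
    1 + (b + (2 * suc k + (r + (6 * suc k * 2 ^ R + 4 * suc m * sq (sq L))))) , λ n N≤n →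
      let p₁ = ℕₚ.m+n≤o⇒n≤o 1 N≤n
          p₂ = ℕₚ.m+n≤o⇒n≤o b p₁
          p₃ = ℕₚ.m+n≤o⇒n≤o (2 * suc k) p₂
          p₄ = ℕₚ.m+n≤o⇒n≤o r p₃
      in likely k m R r M J b L decay r≡ M≡ M<J b≡ L≡ 1≤b
           (ℕₚ.m+n≤o⇒m≤o 1 N≤n) (ℕₚ.m+n≤o⇒m≤o b p₁) (ℕₚ.m+n≤o⇒m≤o (2 * suc k) p₂) (ℕₚ.m+n≤o⇒m≤o r p₃)
           (ℕₚ.m+n≤o⇒m≤o (6 * suc k * 2 ^ R) p₄) (ℕₚ.m+n≤o⇒n≤o (6 * suc k * 2 ^ R) p₄)
    where
    -- The search begins at excess c = r² and gains one unit per level, so J = M + 1 levels push it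
    -- beyond M.
    M<J : M < r * r + J
    M<J = ≤-trans (≤-reflexive (sym J≡)) (ℕₚ.m≤n+m J (r * r))
    1≤b : 1 ≤ b
    1≤b = ≤-trans (ℕₚ.m^n>0 r {{ℕ.>-nonZero (≤-trans (s≤s z≤n) (≤-reflexive (sym r≡)))}} (suc J)) (≤-reflexive (sym b≡))
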